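{- Let $M$ be a simple connected regular matroid, and let $e$ and $f$ be distinct elements of $M$. Suppose that every circuit of $M$ containing both $e$ and $f$ is spanning. Then $M\cong M(L)$ for some clean ladder $L$.
   Context: All matroids and graphs are finite. A circuit $C$ of a matroid $M$ is spanning if $r_M(C)=r(M)$. A matroid is regular if it is representable over every field. $M(L)$ denotes the cycle matroid of the graph $L$. Let $B_3$ denote the graph consisting of two vertices joined by three edges. A 2-sum of two graphs with basepoint $p$, where $p$ is the unique common edge of the two otherwise disjoint graphs, is obtained by identifying the two copies of $p$ (with their end-vertices identified, in either of the two possible ways) and then deleting the edge $p$. A graph $L$ is a clean ladder if it can be constructed, by taking successive 2-sums, via a path decomposition whose vertices are labeled, in order, by graphs $G_0,G_1,\dots,G_n$ ($n\ge 0$) where: (i) each $G_i$ is isomorphic to $K_4$, $K_3$, or $B_3$; (ii) each edge of the path is the basepoint of the 2-sum between its endpoints (so consecutive $G_{i-1}$, $G_i$ share exactly one edge, the basepoint $p_i$; non-consecutive ones share none; and for $0<i<n$ the two basepoints of $G_i$ are distinct edges of $G_i$); (iii) neither $G_0$ nor $G_n$ is isomorphic to $B_3$; (iv) no two consecutive vertices of the path are both isomorphic to $B_3$; and (v) whenever $0<i<n$ and $G_i\cong K_4$, the two edges of $G_i$ that are basepoints of 2-sums form a matching. (When $n=0$, $L=G_0$.) -}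

module Defs where

open import Algebra.Apartness.Bundles using (HeytingCommutativeRing; HeytingField)
import Algebra.Definitions.RawMonoid as RawMonoidDefs
open import Algebra.Bundles using (CommutativeRing)
open import Data.Bool.Base using (Bool; if_then_else_)
open import Data.Fin.Base
  using (Fin; zero; suc; _↑ˡ_; _↑ʳ_; splitAt; punchIn; punchOut)
open import Data.Fin.Patterns
open import Data.Fin.Permutation using (Permutation; _⟨$⟩ʳ_; _⟨$⟩ˡ_)
open import Data.Fin.Properties using (_≟_; any?; all?; punchOut-injective)
open import Data.Fin.Subset
  using (Subset; inside; outside; _∈_; _∉_; _⊆_; _⊂_; _∪_; _-_; ⁅_⁆; ∣_∣; ⊥; ⊤)
open import Data.Fin.Subset.Properties
  using (_∈?_; _⊆?_; ∉⊥; p⊆q⇒∣p∣≤∣q∣; p⊂q⇒∣p∣<∣q∣; x∈⁅x⁆; x∈⁅y⁆⇒x≡y;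
         x∈p∪q⁺; x∈p∪q⁻; x∈p∧x≢y⇒x∈p-y; p⊆p∪q; p─q⊆p; ∪-identityʳ)
open import Data.List.Base using (List; []; _∷_; _++_; map; filter; allFin)
open import Data.List.Extrema.Nat using (max)
import Data.List.Membership.Propositional as List
open import Data.List.Membership.Propositional.Properties
  using (∈-filter⁺; ∈-filter⁻; ∈-allFin)
import Data.List.Membership.DecPropositional as DecMembership
open import Data.List.Relation.Unary.All as All using (All; []; _∷_)
open import Data.List.Relation.Unary.All.Properties using (¬Any⇒All¬; All¬⇒¬Any)
open import Data.List.Relation.Unary.AllPairs using ([]; _∷_)
open import Data.List.Relation.Unary.Any using (here; there)
open import Data.List.Relation.Unary.Unique.Propositional using (Unique)
open import Data.Nat.Base using (ℕ; zero; suc; _+_; _≤_; _<_; s≤s)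
open import Data.Nat.Properties
  using (≤-refl; ≤-trans; <-≤-trans; <⇒≱; n≤1+n)
open import Data.Product.Base
  using (Σ-syntax; ∃-syntax; _×_; _,_; proj₁; proj₂; map₁; map₂; swap)
open import Data.Sum.Base using (_⊎_; inj₁; inj₂; [_,_]′)
open import Data.Vec.Base using ([]; _∷_; lookup; tabulate; there)
open import Function.Base using (_∘_; case_of_)
open import Function.Bundles using (_⇔_)
open import Level using (0ℓ)
open import Relation.Binary.PropositionalEquality
  using (_≡_; _≢_; refl; sym; trans)
open import Relation.Nullary using (¬_; Dec; yes; no; contradiction)
open import Relation.Nullary.Decidable
  using (¬?; _×-dec_; _⊎-dec_; map′; toWitness; decidable-stable)
open import Relation.Unary using (Decidable)

------------------------------------------------------------------------
-- Matroids

-- Independence is decidable: matroids are finite, and this is the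
-- classical notion of a family of subsets of a finite set.
record Matroid (n : ℕ) : Set₁ where
  field
    Indep      : Subset n → Set
    indep?     : Decidable Indep
    ∅-indep    : Indep ⊥
    hereditary : ∀ {I J} → I ⊆ J → Indep J → Indep I
    augment    : ∀ {I J} → Indep I → Indep J → ∣ I ∣ < ∣ J ∣ →
                 ∃[ e ] (e ∈ J × e ∉ I × Indep (I ∪ ⁅ e ⁆))

open Matroid

image : ∀ {m n} → Permutation m n → Subset m → Subset n
image π X = tabulate (λ j → lookup X (π ⟨$⟩ˡ j))

infix 4 _≅_
_≅_ : ∀ {m n} → Matroid m → Matroid n → Set
_≅_ {m} {n} M N =
  Σ[ π ∈ Permutation m n ] (∀ X → Indep M X ⇔ Indep N (image π X))

subsets : ∀ n → List (Subset n)
subsets zero    = [] ∷ []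
subsets (suc n) = map (outside ∷_) (subsets n) ++ map (inside ∷_) (subsets n)

module _ {n : ℕ} (M : Matroid n) where

  Circuit : Subset n → Set
  Circuit C = ¬ Indep M C × (∀ D → D ⊂ C → Indep M D)

  rank : Subset n → ℕ
  rank X =
    max 0 (map ∣_∣ (filter (λ I → indep? M I ×-dec (I ⊆? X)) (subsets n)))

  Spanning : Subset n → Set
  Spanning X = rank X ≡ rank ⊤

  -- No loops (one-element circuits) and no parallel pairs (two-element
  -- circuits).
  Simple : Set
  Simple = ∀ C → Circuit C → 3 ≤ ∣ C ∣

  Connected : Set
  Connected = ∀ e f → e ≢ f → ∃[ C ] (Circuit C × e ∈ C × f ∈ C)

-- The columns of A labelled by X are linearly independent.  Coefficient
-- families on X are families on all columns vanishing outside X.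
IndependentColumns : ∀ (F : HeytingField 0ℓ 0ℓ 0ℓ) {d n} →
  (Fin d → Fin n → HeytingField.Carrier F) → Subset n → Set
IndependentColumns F A X =
  ∀ (c : Fin _ → Carrier) → (∀ j → j ∉ X → c j ≈ 0#) →
  (∀ i → sum (λ j → c j * A i j) ≈ 0#) → ∀ j → c j ≈ 0#
  where
  open HeytingField F
  open HeytingCommutativeRing heytingCommutativeRing using (commutativeRing)
  open CommutativeRing commutativeRing using (+-rawMonoid)
  open RawMonoidDefs +-rawMonoid using (sum)

Representable : ∀ {n} → HeytingField 0ℓ 0ℓ 0ℓ → Matroid n → Set
Representable {n} F M =
  ∃[ d ] Σ[ A ∈ (Fin d → Fin n → HeytingField.Carrier F) ]
    (∀ X → Indep M X ⇔ IndependentColumns F A X)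

-- Classically a Heyting field is exactly a field, with _#_ the negation
-- of _≈_.
Regular : ∀ {n} → Matroid n → Set₁
Regular M = ∀ (F : HeytingField 0ℓ 0ℓ 0ℓ) → Representable F M

------------------------------------------------------------------------
-- Graphs

-- Finite multigraphs with v vertices and m edges; loops are allowed, and
-- the order of the two ends of an edge carries no meaning.
Graph : ℕ → ℕ → Set
Graph v m = Fin m → Fin v × Fin v

Joins : ∀ {v m} → Graph v m → Fin m → Fin v → Fin v → Set
Joins G e x y = G e ≡ (x , y) ⊎ G e ≡ (y , x)

infix 4 _≅ᴳ_
_≅ᴳ_ : ∀ {v m v′ m′} → Graph v m → Graph v′ m′ → Set
_≅ᴳ_ {v} {m} {v′} {m′} G H =
  Σ[ φ ∈ Permutation v v′ ] Σ[ ψ ∈ Permutation m m′ ]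
    (∀ e x y → Joins G e x y ⇔ Joins H (ψ ⟨$⟩ʳ e) (φ ⟨$⟩ʳ x) (φ ⟨$⟩ʳ y))

data Walk {v m} (G : Graph v m) : Fin v → Fin v → Set where
  []   : ∀ {x} → Walk G x x
  step : ∀ {x y z} (e : Fin m) → Joins G e x y → Walk G y z → Walk G x z

vertices : ∀ {v m} {G : Graph v m} {x y} → Walk G x y → List (Fin v)
vertices {x = x} []           = x ∷ []
vertices {x = x} (step _ _ w) = x ∷ vertices w

edges : ∀ {v m} {G : Graph v m} {x y} → Walk G x y → List (Fin m)
edges []           = []
edges (step e _ w) = e ∷ edges w

-- A path closed up by a further edge.  An empty path gives a loop, and a
-- one-edge path gives a pair of parallel edges.
record Cycle {v m} (G : Graph v m) : Set where
  field
    {start end} : Fin v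
    path        : Walk G start end
    path-unique : Unique (vertices path)
    closing     : Fin m
    closes      : Joins G closing end start
    fresh       : closing List.∉ edges path

cycleEdges : ∀ {v m} {G : Graph v m} → Cycle G → List (Fin m)
cycleEdges c = Cycle.closing c ∷ edges (Cycle.path c)

Acyclic : ∀ {v m} → Graph v m → Subset m → Set
Acyclic G X = ¬ (Σ[ c ∈ Cycle G ] All (_∈ X) (cycleEdges c))

------------------------------------------------------------------------
-- The acyclic edge sets of a graph form a matroid

module CycleMatroidProof {v m} (G : Graph v m) where

  J : Fin m → Fin v → Fin v → Set
  J = Joins G

  J-sym : ∀ {e x y} → J e x y → J e y x
  J-sym (inj₁ p) = inj₂ p
  J-sym (inj₂ p) = inj₁ p

  J-ends : ∀ {e x y x′ y′} → J e x y → J e x′ y′ →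
           (x ≡ x′ × y ≡ y′) ⊎ (x ≡ y′ × y ≡ x′)
  J-ends (inj₁ p) (inj₁ q) with refl ← trans (sym p) q = inj₁ (refl , refl)
  J-ends (inj₁ p) (inj₂ q) with refl ← trans (sym p) q = inj₂ (refl , refl)
  J-ends (inj₂ p) (inj₁ q) with refl ← trans (sym p) q = inj₂ (refl , refl)
  J-ends (inj₂ p) (inj₂ q) with refl ← trans (sym p) q = inj₁ (refl , refl)

  EdgePred : Set₁
  EdgePred = Fin m → Set

  data Conn (P : EdgePred) : Fin v → Fin v → Set where
    []   : ∀ {x} → Conn P x x
    step : ∀ {x y z} e → P e → J e x y → Conn P y z → Conn P x z

  mono : ∀ {P Q : EdgePred} → (∀ {e} → P e → Q e) →
         ∀ {x y} → Conn P x y → Conn Q x y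
  mono f []             = []
  mono f (step e p j c) = step e (f p) j (mono f c)

  infixr 5 _⊕_
  _⊕_ : ∀ {P x y z} → Conn P x y → Conn P y z → Conn P x z
  []           ⊕ d = d
  step e p j c ⊕ d = step e p j (c ⊕ d)

  rev : ∀ {P x y} → Conn P x y → Conn P y x
  rev []             = []
  rev (step e p j c) = rev c ⊕ step e p (J-sym j) []

  -- A walk in P + f either avoids f or may be taken to use it once.
  split : ∀ {P Q : EdgePred} {f a b} → J f a b →
          (∀ {e} → Q e → P e ⊎ e ≡ f) → ∀ {x y} → Conn Q x y →
          Conn P x y ⊎ (Conn P x a × Conn P b y) ⊎ (Conn P x b × Conn P a y)
  split jf h [] = inj₁ []
  split jf h (step e q j c) with h q | split jf h c
  ... | inj₁ p | inj₁ d              = inj₁ (step e p j d)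
  ... | inj₁ p | inj₂ (inj₁ (d , k)) = inj₂ (inj₁ (step e p j d , k))
  ... | inj₁ p | inj₂ (inj₂ (d , k)) = inj₂ (inj₂ (step e p j d , k))
  ... | inj₂ refl | r with J-ends j jf | r
  ... | inj₁ (refl , refl) | inj₁ d              = inj₂ (inj₁ ([] , d))
  ... | inj₁ (refl , refl) | inj₂ (inj₁ (d , k)) = inj₂ (inj₁ ([] , k))
  ... | inj₁ (refl , refl) | inj₂ (inj₂ (d , k)) = inj₁ k
  ... | inj₂ (refl , refl) | inj₁ d              = inj₂ (inj₂ ([] , d))
  ... | inj₂ (refl , refl) | inj₂ (inj₁ (d , k)) = inj₁ k
  ... | inj₂ (refl , refl) | inj₂ (inj₂ (d , k)) = inj₂ (inj₂ ([] , k))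

  conn?-list : ∀ es x y → Dec (Conn (List._∈ es) x y)
  conn?-list [] x y = map′ (λ { refl → [] }) (λ { [] → refl ; (step _ () _ _) }) (x ≟ y)
  conn?-list (f ∷ es) x y =
    map′ to (split (inj₁ refl) λ { (here p) → inj₂ p ; (there q) → inj₁ q })
      (conn?-list es x y
        ⊎-dec (conn?-list es x a ×-dec conn?-list es b y)
        ⊎-dec (conn?-list es x b ×-dec conn?-list es a y))
    where
    a = proj₁ (G f)
    b = proj₂ (G f)
    to : Conn (List._∈ es) x y ⊎
         (Conn (List._∈ es) x a × Conn (List._∈ es) b y) ⊎
         (Conn (List._∈ es) x b × Conn (List._∈ es) a y) →
         Conn (List._∈ (f ∷ es)) x y
    to (inj₁ c) = mono there c
    to (inj₂ (inj₁ (c , d))) =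
      mono there c ⊕ step f (here refl) (inj₁ refl) (mono there d)
    to (inj₂ (inj₂ (c , d))) =
      mono there c ⊕ step f (here refl) (inj₂ refl) (mono there d)

  conn? : ∀ {P : EdgePred} → Decidable P → ∀ x y → Dec (Conn P x y)
  conn? P? x y = map′
    (mono (λ i → proj₂ (∈-filter⁻ P? {xs = allFin m} i)))
    (mono (λ p → ∈-filter⁺ P? (∈-allFin _) p))
    (conn?-list (filter P? (allFin m)) x y)

  infixl 6 _without_
  _without_ : EdgePred → Fin m → EdgePred
  (P without e) g = P g × g ≢ e

  Cyclic : EdgePred → Set
  Cyclic P = ∃[ e ] (P e × Conn (P without e) (proj₁ (G e)) (proj₂ (G e)))

  cyclic : ∀ {P : EdgePred} e {x y} → P e → J e x y →
           Conn (P without e) x y → Cyclic P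
  cyclic {P} e p j c with J-ends j (inj₁ refl)
  ... | inj₁ (refl , refl) = e , p , c
  ... | inj₂ (refl , refl) = e , p , rev c

  cyclic-mono : ∀ {P Q : EdgePred} → (∀ {e} → P e → Q e) → Cyclic P → Cyclic Q
  cyclic-mono f (e , p , c) = e , f p , mono (map₁ f) c

  cyclic? : ∀ {P : EdgePred} → Decidable P → Dec (Cyclic P)
  cyclic? P? = any? λ e →
    P? e ×-dec conn? (λ g → P? g ×-dec ¬? (g ≟ e)) _ _

  PathIn : EdgePred → Fin v → Fin v → Set
  PathIn P x y = Σ[ w ∈ Walk G x y ] (Unique (vertices w) × All P (edges w))

  suffix : ∀ {P x y z} ((w , _) : PathIn P y z) → x List.∈ vertices w → PathIn P x z
  suffix ([] , u , a) (here refl) = [] , u , a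
  suffix (step e j w , u , a) (here refl) = step e j w , u , a
  suffix (step e j w , (_ ∷ u) , (_ ∷ a)) (there i) = suffix (w , u , a) i

  toPath : ∀ {P x y} → Conn P x y → PathIn P x y
  toPath [] = [] , ([] ∷ []) , []
  toPath {x = x} (step e p j c) with toPath c
  ... | w , u , a with DecMembership._∈?_ _≟_ x (vertices w)
  ... | yes i = suffix (w , u , a) i
  ... | no  i = step e j w , (¬Any⇒All¬ _ i ∷ u) , (p ∷ a)

  fromWalk : ∀ {P x y} (w : Walk G x y) → All P (edges w) → Conn P x y
  fromWalk [] [] = []
  fromWalk (step e j w) (p ∷ a) = step e p j (fromWalk w a)

  first∈ : ∀ {x y} (w : Walk G x y) → x List.∈ vertices w
  first∈ []           = here refl
  first∈ (step _ _ _) = here refl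

  ends∈ : ∀ {x y e a b} (w : Walk G x y) → e List.∈ edges w → J e a b →
          a List.∈ vertices w
  ends∈ (step e j w) (here refl) j′ with J-ends j′ j
  ... | inj₁ (refl , refl) = here refl
  ... | inj₂ (refl , refl) = there (first∈ w)
  ends∈ (step e j w) (there i) j′ = there (ends∈ w i j′)

  all-without : ∀ {P : EdgePred} {e} {es : List (Fin m)} →
                All P es → e List.∉ es → All (P without e) es
  all-without []      _ = []
  all-without (p ∷ a) i = (p , λ { refl → i (here refl) }) ∷ all-without a (i ∘ there)

  cut : ∀ {P : EdgePred} {x y g} ((w , _) : PathIn P x y) → g List.∈ edges w →
        ∃[ c ] ∃[ d ] (J g c d × Conn (P without g) x c × Conn (P without g) d y)
  cut (step e j w , (n ∷ u) , (p ∷ a)) (here refl) =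
    _ , _ , j , [] ,
    fromWalk w (all-without a (λ i → All¬⇒¬Any n (ends∈ w i j)))
  cut (step e j w , (n ∷ u) , (p ∷ a)) (there i) with cut (w , u , a) i
  ... | c , d , k , s , t =
    c , d , k ,
    step e (p , λ { refl → All¬⇒¬Any n (ends∈ w i j) }) j s , t

  cycle⇒cyclic : ∀ {P : EdgePred} (c : Cycle G) → All P (cycleEdges c) → Cyclic P
  cycle⇒cyclic c (p ∷ a) =
    cyclic closing p (J-sym closes) (fromWalk path (all-without a fresh))
    where open Cycle c

  cyclic⇒cycle : ∀ {P : EdgePred} → Cyclic P → Σ[ c ∈ Cycle G ] All P (cycleEdges c)
  cyclic⇒cycle {P} (e , p , c) with toPath c
  ... | w , u , a = record
    { path = w ; path-unique = u ; closing = e ; closes = inj₂ refl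
    ; fresh = λ i → proj₂ (All.lookup a i) refl } , (p ∷ All.map proj₁ a)

  -- If P is cyclic but P - f is not, then P - f connects the ends of f.
  bridge : ∀ {P : EdgePred} {f a b} → J f a b → ¬ Cyclic (P without f) →
           Cyclic P → Conn (P without f) a b
  bridge {P} {f} {a} {b} jf acyc (e , p , c) with e ≟ f
  ... | yes refl with J-ends jf (inj₁ refl)
  ...   | inj₁ (refl , refl) = c
  ...   | inj₂ (refl , refl) = rev c
  bridge {P} {f} {a} {b} jf acyc (e , p , c) | no e≢f = case split jf h c of λ where
      (inj₁ d) → contradiction (e , (p , e≢f) , d) acyc
      (inj₂ (inj₁ (d , k))) → rev (up d) ⊕ step e (p , e≢f) (inj₁ refl) (rev (up k))
      (inj₂ (inj₂ (d , k))) → up k ⊕ step e (p , e≢f) (inj₂ refl) (up d)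
    where
    h : ∀ {g} → (P without e) g → (P without f without e) g ⊎ g ≡ f
    h {g} (q , n) with g ≟ f
    ... | yes r = inj₂ r
    ... | no  r = inj₁ ((q , r) , n)
    up : ∀ {x y} → Conn (P without f without e) x y → Conn (P without f) x y
    up = mono proj₁

  private
    ∣∪⁅⁆∣ : ∀ {n} (p : Subset n) x → ∣ p ∪ ⁅ x ⁆ ∣ ≤ suc ∣ p ∣
    ∣∪⁅⁆∣ (inside  ∷ p) zero    rewrite ∪-identityʳ p = n≤1+n _
    ∣∪⁅⁆∣ (outside ∷ p) zero    rewrite ∪-identityʳ p = ≤-refl
    ∣∪⁅⁆∣ (inside  ∷ p) (suc x) = s≤s (∣∪⁅⁆∣ p x)
    ∣∪⁅⁆∣ (outside ∷ p) (suc x) = ∣∪⁅⁆∣ p x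

    ∉-- : ∀ {n} (p : Subset n) {x} → x ∉ p - x
    ∉-- (inside  ∷ p) {zero}  ()
    ∉-- (outside ∷ p) {zero}  ()
    ∉-- (_       ∷ p) {suc x} (there i) = ∉-- p i

    card-swap : ∀ {n} (p : Subset n) {g f} → f ∉ p →
                ∣ p ∣ ≤ ∣ (p - g) ∪ ⁅ f ⁆ ∣
    card-swap p {g} {f} f∉p = ≤-trans
      (≤-trans (p⊆q⇒∣p∣≤∣q∣ sub) (∣∪⁅⁆∣ (p - g) g))
      (p⊂q⇒∣p∣<∣q∣ (p⊆p∪q ⁅ f ⁆ , f , x∈p∪q⁺ (inj₂ (x∈⁅x⁆ f)) ,
                     f∉p ∘ p─q⊆p p ⁅ g ⁆))
      where
      sub : p ⊆ (p - g) ∪ ⁅ g ⁆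
      sub {x} i with x ≟ g
      ... | yes refl = x∈p∪q⁺ (inj₂ (x∈⁅x⁆ x))
      ... | no  n    = x∈p∪q⁺ (inj₁ (x∈p∧x≢y⇒x∈p-y i n))

  Indᴳ : Subset m → Set
  Indᴳ X = ¬ Cyclic (_∈ X)

  -- If K is acyclic, K + f is not, and f ∈ I with I acyclic, then some
  -- g ∈ K - I can be exchanged for f.
  exchange : ∀ {I K f} → Indᴳ I → Indᴳ K → f ∈ I → f ∉ K → ¬ Indᴳ (K ∪ ⁅ f ⁆) →
             ∃[ g ] (g ∈ K × g ∉ I × Indᴳ ((K - g) ∪ ⁅ f ⁆))
  exchange {I} {K} {f} indI indK f∈I f∉K dep = findG
    where
    a = proj₁ (G f)
    b = proj₂ (G f)

    drop-f : ∀ {e} → ((_∈ (K ∪ ⁅ f ⁆)) without f) e → e ∈ K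
    drop-f (i , n) with x∈p∪q⁻ K ⁅ f ⁆ i
    ... | inj₁ k = k
    ... | inj₂ k = contradiction (x∈⁅y⁆⇒x≡y f k) n

    a~b : PathIn (_∈ K) a b
    a~b = toPath (mono drop-f (bridge (inj₁ refl) (indK ∘ cyclic-mono drop-f)
            (decidable-stable (cyclic? (_∈? (K ∪ ⁅ f ⁆))) dep)))

    offender : ∀ (es : List (Fin m)) → All (_∈ I) es ⊎ ∃[ g ] (g List.∈ es × g ∉ I)
    offender [] = inj₁ []
    offender (e ∷ es) with e ∈? I | offender es
    ... | no  n | _                  = inj₂ (e , here refl , n)
    ... | yes i | inj₁ is            = inj₁ (i ∷ is)
    ... | yes i | inj₂ (g , g∈ , g∉) = inj₂ (g , there g∈ , g∉)

    findG : ∃[ g ] (g ∈ K × g ∉ I × Indᴳ ((K - g) ∪ ⁅ f ⁆))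
    findG with a~b
    ... | w , u , al with offender (edges w)
    ... | inj₁ is = contradiction
            (f , f∈I , fromWalk w (all-without is (f∉K ∘ All.lookup al))) indI
    ... | inj₂ (g , g∈w , g∉I) with cut (w , u , al) g∈w
    ... | c , d , jg , s , t = g , g∈K , g∉I , indep
      where
      g∈K = All.lookup al g∈w
      drop : ∀ {e} → ((_∈ ((K - g) ∪ ⁅ f ⁆)) without f) e → ((_∈ K) without g) e
      drop (i , n) with x∈p∪q⁻ (K - g) ⁅ f ⁆ i
      ... | inj₁ k = p─q⊆p K ⁅ g ⁆ k , λ { refl → ∉-- K k }
      ... | inj₂ k = contradiction (x∈⁅y⁆⇒x≡y f k) n
      indep : Indᴳ ((K - g) ∪ ⁅ f ⁆)
      indep cyc = indK (cyclic g g∈K jg (rev s ⊕ a~b′ ⊕ rev t))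
        where
        a~b′ : Conn ((_∈ K) without g) a b
        a~b′ = mono drop (bridge (inj₁ refl)
                 (λ q → indK (cyclic-mono (proj₁ ∘ drop) q)) cyc)

  -- Induction on a list covering the part of I outside K.
  augmentᴳ : ∀ {I} (fs : List (Fin m)) {K} → Indᴳ I → Indᴳ K → ∣ I ∣ < ∣ K ∣ →
             (∀ {i} → i ∈ I → i ∈ K ⊎ i List.∈ fs) →
             ∃[ e ] (e ∈ K × e ∉ I × Indᴳ (I ∪ ⁅ e ⁆))
  augmentᴳ {I} [] {K} indI indK lt cov with any? (λ e → (e ∈? K) ×-dec ¬? (e ∈? I))
  ... | yes (e , e∈K , e∉I) = e , e∈K , e∉I , indK ∘ cyclic-mono sub
    where
    sub : I ∪ ⁅ e ⁆ ⊆ K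
    sub i with x∈p∪q⁻ I ⁅ e ⁆ i
    ... | inj₂ k with refl ← x∈⁅y⁆⇒x≡y e k = e∈K
    ... | inj₁ k with cov k
    ...   | inj₁ l  = l
    ...   | inj₂ ()
  ... | no none = contradiction
          (p⊆q⇒∣p∣≤∣q∣ λ {x} k → decidable-stable (x ∈? I) (λ n → none (x , k , n)))
          (<⇒≱ lt)
  augmentᴳ {I} (f ∷ fs) {K} indI indK lt cov with f ∈? K | f ∈? I
  ... | yes f∈K | _ = augmentᴳ fs indI indK lt cov′
    where
    cov′ : ∀ {i} → i ∈ I → i ∈ K ⊎ i List.∈ fs
    cov′ i with cov i
    ... | inj₁ k            = inj₁ k
    ... | inj₂ (here refl)  = inj₁ f∈K
    ... | inj₂ (there k)    = inj₂ k
  ... | no _ | no f∉I = augmentᴳ fs indI indK lt cov′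
    where
    cov′ : ∀ {i} → i ∈ I → i ∈ K ⊎ i List.∈ fs
    cov′ i with cov i
    ... | inj₁ k            = inj₁ k
    ... | inj₂ (here refl)  = contradiction i f∉I
    ... | inj₂ (there k)    = inj₂ k
  ... | no f∉K | yes f∈I with cyclic? (_∈? (K ∪ ⁅ f ⁆))
  ... | no indK+f = finish (augmentᴳ fs indI indK+f
          (<-≤-trans lt (p⊆q⇒∣p∣≤∣q∣ {p = K} (p⊆p∪q ⁅ f ⁆))) cov′)
    where
    cov′ : ∀ {i} → i ∈ I → i ∈ (K ∪ ⁅ f ⁆) ⊎ i List.∈ fs
    cov′ i with cov i
    ... | inj₁ k            = inj₁ (x∈p∪q⁺ (inj₁ k))
    ... | inj₂ (here refl)  = inj₁ (x∈p∪q⁺ (inj₂ (x∈⁅x⁆ f)))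
    ... | inj₂ (there k)    = inj₂ k
    finish : ∃[ e ] (e ∈ (K ∪ ⁅ f ⁆) × e ∉ I × Indᴳ (I ∪ ⁅ e ⁆)) →
             ∃[ e ] (e ∈ K × e ∉ I × Indᴳ (I ∪ ⁅ e ⁆))
    finish (e , i , n , ind) with x∈p∪q⁻ K ⁅ f ⁆ i
    ... | inj₁ k = e , k , n , ind
    ... | inj₂ k with refl ← x∈⁅y⁆⇒x≡y f k = contradiction f∈I n
  ... | yes cyc with exchange indI indK f∈I f∉K (λ k → k cyc)
  ... | g , g∈K , g∉I , indK′ = finish (augmentᴳ fs indI indK′
          (<-≤-trans lt (card-swap K f∉K)) cov′)
    where
    cov′ : ∀ {i} → i ∈ I → i ∈ ((K - g) ∪ ⁅ f ⁆) ⊎ i List.∈ fs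
    cov′ i with cov i
    ... | inj₁ k            = inj₁ (x∈p∪q⁺ (inj₁ (x∈p∧x≢y⇒x∈p-y k λ { refl → g∉I i })))
    ... | inj₂ (here refl)  = inj₁ (x∈p∪q⁺ (inj₂ (x∈⁅x⁆ f)))
    ... | inj₂ (there k)    = inj₂ k
    finish : ∃[ e ] (e ∈ ((K - g) ∪ ⁅ f ⁆) × e ∉ I × Indᴳ (I ∪ ⁅ e ⁆)) →
             ∃[ e ] (e ∈ K × e ∉ I × Indᴳ (I ∪ ⁅ e ⁆))
    finish (e , i , n , ind) with x∈p∪q⁻ (K - g) ⁅ f ⁆ i
    ... | inj₁ k = e , p─q⊆p K ⁅ g ⁆ k , n , ind
    ... | inj₂ k with refl ← x∈⁅y⁆⇒x≡y f k = contradiction f∈I n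

  ind⇒acyclic : ∀ {X} → Indᴳ X → Acyclic G X
  ind⇒acyclic ind (c , a) = ind (cycle⇒cyclic c a)

  acyclic⇒ind : ∀ {X} → Acyclic G X → Indᴳ X
  acyclic⇒ind acyc cyc = acyc (cyclic⇒cycle cyc)

cycleMatroid : ∀ {v m} → Graph v m → Matroid m
cycleMatroid {m = m} G = record
  { Indep      = Acyclic G
  ; indep?     = λ X → map′ ind⇒acyclic acyclic⇒ind (¬? (cyclic? (_∈? X)))
  ; ∅-indep    = λ { (_ , (i ∷ _)) → ∉⊥ i }
  ; hereditary = λ { I⊆J acyc (c , a) → acyc (c , All.map I⊆J a) }
  ; augment    = λ i j lt →
      map₂ (map₂ (map₂ ind⇒acyclic))
        (augmentᴳ (allFin m) (acyclic⇒ind i) (acyclic⇒ind j) lt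
          (λ {k} _ → inj₂ (∈-allFin k)))
  }
  where open CycleMatroidProof G

------------------------------------------------------------------------
-- 2-sums of graphs

Loopless : ∀ {v m} → Graph v m → Set
Loopless G = ∀ e → proj₁ (G e) ≢ proj₂ (G e)

-- Sends the vertices a and b of one graph to a′ and b′ among the v
-- vertices of another one, and its w remaining vertices to new vertices.
mergeEnds : ∀ {v w} (a b : Fin (2 + w)) → a ≢ b → (a′ b′ : Fin v) →
            Fin (2 + w) → Fin (v + w)
mergeEnds {v} {w} a b a≢b a′ b′ x with a ≟ x | b ≟ x
... | yes _   | _       = a′ ↑ˡ w
... | no  _   | yes _   = b′ ↑ˡ w
... | no  a≢x | no  b≢x =
  v ↑ʳ punchOut {i = punchOut a≢b} {j = punchOut a≢x}
         (b≢x ∘ punchOut-injective a≢b a≢x)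

-- The 2-sum of G and H, the edge p of G being identified with the edge q
-- of H.  If σ is false, the first end of p is identified with the first
-- end of q; if σ is true, with the second.  The edges of the 2-sum are
-- those of H other than q, followed by those of G other than p.
twoSum : ∀ {v a w b} (σ : Bool)
         (G : Graph v (suc a)) (p : Fin (suc a))
         (H : Graph (2 + w) (suc b)) (q : Fin (suc b)) → Loopless H →
         Graph (v + w) (b + a)
twoSum {v} {a} {w} {b} σ G p H q loopless i =
  [ (λ j → let (x , y) = H (punchIn q j) in fromH x , fromH y)
  , (λ j → let (x , y) = G (punchIn p j) in x ↑ˡ w , y ↑ˡ w)
  ]′ (splitAt b i)
  where
  ends : Fin v × Fin v
  ends = if σ then swap (G p) else G p

  fromH : Fin (2 + w) → Fin (v + w)
  fromH = mergeEnds (proj₁ (H q)) (proj₂ (H q)) (loopless q) (proj₁ ends) (proj₂ ends)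

------------------------------------------------------------------------
-- Clean ladders

data Piece : Set where
  K₄ K₃ B₃ : Piece

-- The piece k has 2 + extraVertices k vertices and 2 + extraEdges k edges.
extraVertices : Piece → ℕ
extraVertices K₄ = 2
extraVertices K₃ = 1
extraVertices B₃ = 0

extraEdges : Piece → ℕ
extraEdges K₄ = 4
extraEdges K₃ = 1
extraEdges B₃ = 1

Vertex Edge : Piece → Set
Vertex k = Fin (2 + extraVertices k)
Edge   k = Fin (2 + extraEdges k)

graph : (k : Piece) → Graph (2 + extraVertices k) (2 + extraEdges k)
graph K₄ 0F = 0F , 1F
graph K₄ 1F = 0F , 2F
graph K₄ 2F = 0F , 3F
graph K₄ 3F = 1F , 2F
graph K₄ 4F = 1F , 3F
graph K₄ 5F = 2F , 3F
graph K₃ 0F = 0F , 1F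
graph K₃ 1F = 0F , 2F
graph K₃ 2F = 1F , 2F
graph B₃ _  = 0F , 1F

graph-loopless : ∀ k → Loopless (graph k)
graph-loopless K₄ = toWitness {a? = all? λ e → ¬? (_ ≟ _)} _
graph-loopless K₃ = toWitness {a? = all? λ e → ¬? (_ ≟ _)} _
graph-loopless B₃ = toWitness {a? = all? λ e → ¬? (_ ≟ _)} _

Incident : ∀ {v m} → Graph v m → Fin m → Fin v → Set
Incident G e x = x ≡ proj₁ (G e) ⊎ x ≡ proj₂ (G e)

Matching : ∀ {v m} → Graph v m → Fin m → Fin m → Set
Matching G e f = ∀ x → ¬ (Incident G e x × Incident G f x)

-- Initial segments G₀, …, Gᵢ (i < n) of a path decomposition, together
-- with the basepoints joining them, the ways in which the ends of the
-- basepoints are identified, and the next basepoint, an edge of Gᵢ.  The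
-- index is the label of the last vertex Gᵢ.
data Segment : Piece → Set where
  first : ∀ k → k ≢ B₃ → (p : Edge k) → Segment k
  next  : ∀ {k} → Segment k → (σ : Bool) → ∀ k′ → ¬ (k ≡ B₃ × k′ ≡ B₃) →
          (p p′ : Edge k′) → p ≢ p′ →
          (k′ ≡ K₄ → Matching (graph k′) p p′) → Segment k′

-- In the constructor last, the final two labels are not both B₃ since the
-- final one is not.
data Decomposition : Set where
  single : ∀ k → k ≢ B₃ → Decomposition
  last   : ∀ {k} → Segment k → (σ : Bool) → ∀ k′ → k′ ≢ B₃ →
           (p : Edge k′) → Decomposition

record Rooted : Set where
  field
    {vertexCount edgeCount} : ℕ
    rootedGraph : Graph vertexCount (suc edgeCount)
    root        : Fin (suc edgeCount)

-- The edge p′ of the last piece survives in the 2-sum as punchOut p≢p′.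
segmentGraph : ∀ {k} → Segment k → Rooted
segmentGraph (first k _ p) = record { rootedGraph = graph k ; root = p }
segmentGraph (next s σ k′ _ p p′ p≢p′ _) = record
  { rootedGraph = twoSum σ rootedGraph root (graph k′) p (graph-loopless k′)
  ; root        = punchOut p≢p′ ↑ˡ edgeCount
  }
  where open Rooted (segmentGraph s)

assemble : Decomposition → ∃[ v ] ∃[ m ] Graph v m
assemble (single k _) = _ , _ , graph k
assemble (last s σ k′ _ p) =
  _ , _ , twoSum σ rootedGraph root (graph k′) p (graph-loopless k′)
  where open Rooted (segmentGraph s)

CleanLadder : ∀ {v m} → Graph v m → Set
CleanLadder L = Σ[ D ∈ Decomposition ] (L ≅ᴳ proj₂ (proj₂ (assemble D)))

{-# OPTIONS --safe #-}

-- Let C be a circuit through e and f; it is spanning, so over 𝔽₂ every other element g is a chord,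
-- given by the part D of C with D + g a cycle and f ∉ D.  Any circuit through e and f has exactly as
-- many elements as C.  Applied to C + D + g this forces e ∈ D, and applied to the sum of C and two
-- chords it shows that two sets D are either nested or of the form X + a, X + b.  A representation
-- over 𝔽₃ excludes three chords each containing a private point (or each missing one).  Hence the
-- sets D form a chain in which each link is a single set or a pair X + a, X + b.  Growing an initial
-- part P of C along this chain from {e} to C - f spells a ladder with basepoint value Σ P: a chord
-- with D = P is a B₃, a new element of C a K₃, and a crossing pair with its two elements a K₄.  The
-- ladder and M have the same cut space over 𝔽₂, hence are the same matroid.

module Submission where

open import Defs
open import Algebra.Apartness.Bundles using (HeytingField)
open import Algebra.Bundles using (CommutativeRing)
import Algebra.Properties.Ring as RingProperties
import Algebra.Properties.Semiring.Sum as SemiringSum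
open import Algebra.Structures using (IsCommutativeRing)
open import Data.Bool.Base using (Bool; true; false; not; _∧_; _xor_)
import Data.Bool.Properties as Bool
open import Data.Fin.Base
  using (Fin; zero; suc; _↑ˡ_; _↑ʳ_; splitAt; punchIn; inject₁)
open import Data.Fin.Patterns
import Data.Fin.Permutation as Perm
open import Data.Fin.Permutation using (Permutation)
open import Data.Fin.Properties using (_≟_; any?; all?; join-splitAt; splitAt-↑ˡ; splitAt-↑ʳ)
open import Data.Fin.Subset
  using (Subset; inside; outside; _∈_; _∉_; _⊆_; _⊂_; _∪_; _-_; ⁅_⁆; ∣_∣)
open import Data.Fin.Subset.Properties
  using (_∈?_; _⊆?_; ⊆⊤; p⊆q⇒∣p∣≤∣q∣; p⊂q⇒∣p∣<∣q∣; x∈⁅x⁆; x∈⁅y⁆⇒x≡y; ∣⁅x⁆∣≡1; x∈p∪q⁺; x∈p∪q⁻;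
         x∈p∧x≢y⇒x∈p-y; x∈p⇒∣p-x∣<∣p∣; x∈p⇒p-x⊂p; ∪-identityʳ; p─q⊆p; p─q─q≡p─q)
open import Data.List.Base as List using (List; []; _∷_; allFin)
open import Data.List.Extrema.Nat using (xs≤max; max<v⁺)
import Data.List.Membership.DecPropositional as DecMembership
import Data.List.Membership.Propositional as List
open import Data.List.Membership.Propositional.Properties
  using (∈-map⁺; ∈-filter⁺; ∈-filter⁻; ∈-++⁺ˡ; ∈-++⁺ʳ; ∈-allFin)
open import Data.List.Relation.Unary.All as All using (All; []; _∷_)
import Data.List.Relation.Unary.All.Properties as All
open import Data.List.Relation.Unary.AllPairs using ([]; _∷_)
open import Data.List.Relation.Unary.Any using (here; there)
open import Data.List.Relation.Unary.Unique.Propositional using (Unique)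
open import Data.Maybe.Base using (Maybe; just; nothing)
open import Data.Nat.Base as ℕ using (ℕ; zero; suc; _≤_; _<_; z≤n; s≤s)
import Data.Nat.Properties as ℕ
open import Data.Product.Base using (Σ-syntax; ∃; ∃-syntax; _×_; _,_; proj₁; proj₂)
open import Data.Sum.Base using (_⊎_; inj₁; inj₂; [_,_]′)
open import Data.Vec.Base using (Vec; []; _∷_; lookup; tabulate; _++_; _∷ʳ_; map; toList)
open import Data.Vec.Membership.Propositional.Properties using (∈-lookup; ∈-toList⁺; ∈-toList⁻)
open import Data.Vec.Properties
  using (lookup∘tabulate; lookup⇒[]=; []=⇒lookup; lookup-++ˡ; lookup-++ʳ; lookup-map;
         toList-++; toList-∷ʳ)
open import Data.Vec.Relation.Unary.Any using (index)
open import Data.Vec.Relation.Unary.Any.Properties using (lookup-index)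
open import Function.Base using (id; _∘_; _∘′_; case_of_)
open import Function.Bundles using (Equivalence; mk⇔)
open import Level using (0ℓ)
open import Relation.Binary.Definitions using (DecidableEquality)
open import Relation.Binary.PropositionalEquality
  using (_≡_; _≢_; refl; sym; trans; cong; cong₂; subst; isEquivalence; module ≡-Reasoning)
open import Relation.Nullary using (¬_; Dec; yes; no; does; contradiction)
open import Relation.Nullary.Decidable
  using (¬?; _×-dec_; _→-dec_; map′; toWitness; decidable-stable; dec-true; dec-false)
open import Relation.Unary using (Decidable)

-- Kernels of representations over finite fields

-- Independent sets have at most `∣ C ∣ - 1` elements, and every circuit through e and f is one
-- element larger than some set attaining this bound. So a cycle through e and f with fewer elements
-- than C cannot be a circuit, and each restriction on chords comes from exhibiting one that would
-- be. If D and D′ cross, adding both chords to C trades their symmetric difference for two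
-- elements, so that difference is a pair.
--
-- The field 𝔽₃ serves to exclude the Fano matroid. If three chords have private points a, b, c,
-- then contracting f and all of C outside e, a, b, c leaves F₇ on e, a, b, c and the three chords;
-- if a, b, c are instead the points missed by one chord each, e is contracted in place of f. The
-- argument works with dependence vectors throughout and never forms a minor.
--
-- Cuts suit 2-sums better than cycles: a cut of a 2-sum is a pair of cuts agreeing on the
-- basepoint, so a cut of a ladder can be read piece by piece with a single bit of memory.

record FiniteField : Set₁ where
  infixl 7 _*_
  infixl 6 _+_
  field
    Carrier           : Set
    _+_ _*_           : Carrier → Carrier → Carrier
    -_                : Carrier → Carrier
    0# 1#             : Carrier
    isCommutativeRing : IsCommutativeRing _≡_ _+_ _*_ -_ 0# 1#
    _≟#_              : DecidableEquality Carrier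
    inverse           : ∀ x → x ≢ 0# → ∃[ y ] x * y ≡ 1#
    1≢0               : 1# ≢ 0#
    -- Finiteness enters only as this search through the carrier.
    exists?           : ∀ {P : Carrier → Set} → Decidable P → Dec (∃ P)

  commutativeRing : CommutativeRing 0ℓ 0ℓ
  commutativeRing = record { isCommutativeRing = isCommutativeRing }

  open CommutativeRing commutativeRing public
    using (ring; semiring; +-identityˡ; +-identityʳ; -‿inverseʳ; *-comm; *-assoc; zeroˡ; zeroʳ;
           distribˡ; distribʳ)
    renaming (_-_ to _−_)

  heytingField : HeytingField 0ℓ 0ℓ 0ℓ
  heytingField = record
    { Carrier = Carrier ; _≈_ = _≡_ ; _#_ = _≢_
    ; _+_ = _+_ ; _*_ = _*_ ; -_ = -_ ; 0# = 0# ; 1# = 1#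
    ; isHeytingField = record
      { isHeytingCommutativeRing = record
        { isCommutativeRing = isCommutativeRing
        ; isApartnessRelation = record
          { irrefl  = λ x≡y x≢y → x≢y x≡y
          ; sym     = λ x≢y y≡x → x≢y (sym y≡x)
          ; cotrans = cotrans
          }
        ; #⇒invertible = λ {x} {y} x≢y →
            let (z , xz≡1) = inverse (x − y) (x≢y ∘′ x∙y⁻¹≈ε⇒x≈y x y)
            in z , trans (*-comm z _) xz≡1 , xz≡1
        ; invertible⇒# = λ { {x} {y} (z , _ , xz≡1) refl →
            1≢0 (trans (sym xz≡1) (trans (cong (_* z) (-‿inverseʳ x)) (zeroˡ z))) }
        }
      ; tight = λ x y → decide x y , λ x≡y x≢y → x≢y x≡y
      }
    }
    where
    open RingProperties ring using (x∙y⁻¹≈ε⇒x≈y)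
    decide : ∀ x y → ¬ (x ≢ y) → x ≡ y
    decide x y ¬x≢y with x ≟# y
    ... | yes x≡y = x≡y
    ... | no x≢y  = contradiction x≢y ¬x≢y
    cotrans : ∀ {x y} → x ≢ y → ∀ z → _
    cotrans {x} x≢y z with x ≟# z
    ... | yes refl = inj₂ x≢y
    ... | no x≢z   = inj₁ x≢z

existsBool? : ∀ {P : Bool → Set} → Decidable P → Dec (∃ P)
existsBool? P? with P? true | P? false
... | yes p | _     = yes (true , p)
... | no _  | yes p = yes (false , p)
... | no ¬t | no ¬f = no λ { (true , p) → ¬t p ; (false , p) → ¬f p }

𝔽₂ : FiniteField
𝔽₂ = record
  { isCommutativeRing = CommutativeRing.isCommutativeRing Bool.xor-∧-commutativeRing
  ; _≟#_              = Bool._≟_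
  ; inverse           = λ { true _ → true , refl ; false 0≢0 → contradiction refl 0≢0 }
  ; 1≢0               = λ ()
  ; exists?           = existsBool?
  }

infixl 6 _+₃_
infixl 7 _*₃_

_+₃_ _*₃_ : Fin 3 → Fin 3 → Fin 3
0F +₃ y  = y
1F +₃ 0F = 1F
1F +₃ 1F = 2F
1F +₃ 2F = 0F
2F +₃ 0F = 2F
2F +₃ 1F = 0F
2F +₃ 2F = 1F
0F *₃ y  = 0F
1F *₃ y  = y
2F *₃ 0F = 0F
2F *₃ 1F = 2F
2F *₃ 2F = 1F

-₃_ : Fin 3 → Fin 3
-₃ x = 2F *₃ x

𝔽₃ : FiniteField
𝔽₃ = record
  { Carrier = Fin 3 ; _+_ = _+₃_ ; _*_ = _*₃_ ; -_ = -₃_ ; 0# = 0F ; 1# = 1F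
  ; isCommutativeRing = record
    { isRing = record
      { +-isAbelianGroup = record
        { isGroup = record
          { isMonoid = record
            { isSemigroup = record
              { isMagma = record { isEquivalence = isEquivalence ; ∙-cong = cong₂ _+₃_ }
              ; assoc = toWitness {a? = all? λ x → all? λ y → all? λ z →
                          ((x +₃ y) +₃ z) ≟ (x +₃ (y +₃ z))} _ }
            ; identity = (λ _ → refl) , toWitness {a? = all? λ x → (x +₃ 0F) ≟ x} _ }
          ; inverse = toWitness {a? = all? λ x → ((-₃ x) +₃ x) ≟ 0F} _
                    , toWitness {a? = all? λ x → (x +₃ (-₃ x)) ≟ 0F} _
          ; ⁻¹-cong = cong -₃_ }
        ; comm = toWitness {a? = all? λ x → all? λ y → (x +₃ y) ≟ (y +₃ x)} _ }
      ; *-cong = cong₂ _*₃_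
      ; *-assoc = toWitness {a? = all? λ x → all? λ y → all? λ z →
                    ((x *₃ y) *₃ z) ≟ (x *₃ (y *₃ z))} _
      ; *-identity = (λ _ → refl) , toWitness {a? = all? λ x → (x *₃ 1F) ≟ x} _
      ; distrib = toWitness {a? = all? λ x → all? λ y → all? λ z →
                    (x *₃ (y +₃ z)) ≟ (x *₃ y +₃ x *₃ z)} _
                , toWitness {a? = all? λ x → all? λ y → all? λ z →
                    ((y +₃ z) *₃ x) ≟ (y *₃ x +₃ z *₃ x)} _ }
    ; *-comm = toWitness {a? = all? λ x → all? λ y → (x *₃ y) ≟ (y *₃ x)} _ }
  ; _≟#_ = _≟_
  ; inverse = λ { 0F 0≢0 → contradiction refl 0≢0 ; 1F _ → 1F , refl ; 2F _ → 2F , refl }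
  ; 1≢0 = λ ()
  ; exists? = any?
  }

-- The space of linear dependences among the columns, with the matrix forgotten. All later arguments
-- about a representation use only these closure properties and the link to independence.
record Kernel (F : FiniteField) {n : ℕ} (M : Matroid n) : Set₁ where
  open FiniteField F
  open Matroid M
  field
    K        : (Fin n → Carrier) → Set
    K-resp   : ∀ {c d} → (∀ j → c j ≡ d j) → K c → K d
    K-linear : ∀ α β {c d} → K c → K d → K (λ j → α * c j + β * d j)
    indep⇒0  : ∀ {X c} → Indep X → K c → (∀ j → j ∉ X → c j ≡ 0#) → ∀ j → c j ≡ 0#
    dep⇒≢0   : ∀ {X} → ¬ Indep X →
               ∃[ c ] (K c × (∀ j → j ∉ X → c j ≡ 0#) × ∃[ j ] c j ≢ 0#)

module _ (F : FiniteField) where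
  open FiniteField F
  open SemiringSum semiring using (sum; sum-cong-≗; ∑-distrib-+; *-distribˡ-sum)
  open ≡-Reasoning

  existsVec? : ∀ n {P : Vec Carrier n → Set} → Decidable P → Dec (∃ P)
  existsVec? zero    P? = map′ ([] ,_) (λ { ([] , p) → p }) (P? [])
  existsVec? (suc n) P? = map′ (λ (a , v , p) → a ∷ v , p) (λ { (a ∷ v , p) → a , v , p })
    (exists? λ a → existsVec? n λ v → P? (a ∷ v))

  representable⇒kernel : ∀ {n} {M : Matroid n} → Representable heytingField M → Kernel F M
  representable⇒kernel {n} {M} (d , A , indep⇔) = record
    { K        = K
    ; K-resp   = K-resp
    ; K-linear = λ α β {c} {d} → K-linear α β {c} {d}
    ; indep⇒0  = λ {X} {c} indep Kc supp → Equivalence.to (indep⇔ X) indep c supp Kc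
    ; dep⇒≢0   = dep⇒≢0
    }
    where
    open Matroid M

    K : (Fin n → Carrier) → Set
    K c = ∀ i → sum (λ j → c j * A i j) ≡ 0#

    K-resp : ∀ {c d} → (∀ j → c j ≡ d j) → K c → K d
    K-resp c≗d Kc i = trans (sum-cong-≗ λ j → cong (_* A i j) (sym (c≗d j))) (Kc i)

    K-linear : ∀ α β {c d} → K c → K d → K (λ j → α * c j + β * d j)
    K-linear α β {c} {d} Kc Kd i = begin
      sum (λ j → (α * c j + β * d j) * A i j)
        ≡⟨ sum-cong-≗ (λ j → trans (distribʳ (A i j) (α * c j) (β * d j))
             (cong₂ _+_ (*-assoc α (c j) (A i j)) (*-assoc β (d j) (A i j)))) ⟩
      sum (λ j → α * (c j * A i j) + β * (d j * A i j))
        ≡⟨ ∑-distrib-+ (λ j → α * (c j * A i j)) _ ⟩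
      sum (λ j → α * (c j * A i j)) + sum (λ j → β * (d j * A i j))
        ≡⟨ cong₂ _+_ (scale α Kc) (scale β Kd) ⟩
      0# + 0#
        ≡⟨ +-identityˡ 0# ⟩
      0# ∎
      where
      scale : ∀ γ {b} → K b → sum (λ j → γ * (b j * A i j)) ≡ 0#
      scale γ {b} Kb = begin
        sum (λ j → γ * (b j * A i j)) ≡⟨ *-distribˡ-sum γ (λ j → b j * A i j) ⟨
        γ * sum (λ j → b j * A i j)   ≡⟨ cong (γ *_) (Kb i) ⟩
        γ * 0#                        ≡⟨ zeroʳ γ ⟩
        0#                            ∎

    K? : Decidable K
    K? c = all? λ i → _ ≟# 0#

    dep⇒≢0 : ∀ {X} → ¬ Indep X →
             ∃[ c ] (K c × (∀ j → j ∉ X → c j ≡ 0#) × ∃[ j ] c j ≢ 0#)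
    -- Dependence is given only as a negated universal statement; running through the finitely many
    -- coefficient vectors turns it into a witness.
    dep⇒≢0 {X} dep with existsVec? n (λ v →
      K? (lookup v) ×-dec all? (λ j → ¬? (j ∈? X) →-dec (lookup v j ≟# 0#))
        ×-dec any? (λ j → ¬? (lookup v j ≟# 0#)))
    ... | yes (v , p) = lookup v , p
    ... | no ¬∃ = contradiction (Equivalence.from (indep⇔ X) columns) dep
      where
      columns : IndependentColumns heytingField A X
      columns c supp Kc j with c j ≟# 0#
      ... | yes cj≡0 = cj≡0
      ... | no cj≢0 = contradiction
            ( tabulate c , K-resp (sym ∘ lookup∘tabulate c) Kc
            , (λ i i∉X → trans (lookup∘tabulate c i) (supp i i∉X))
            , j , cj≢0 ∘ trans (sym (lookup∘tabulate c j)))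
            ¬∃

-- Rank and circuits

∣p∪⁅x⁆∣≤1+∣p∣ : ∀ {n} (p : Subset n) x → ∣ p ∪ ⁅ x ⁆ ∣ ≤ suc ∣ p ∣
∣p∪⁅x⁆∣≤1+∣p∣ (inside  ∷ p) zero    rewrite ∪-identityʳ p = ℕ.n≤1+n _
∣p∪⁅x⁆∣≤1+∣p∣ (outside ∷ p) zero    rewrite ∪-identityʳ p = ℕ.≤-refl
∣p∪⁅x⁆∣≤1+∣p∣ (inside  ∷ p) (suc x) = s≤s (∣p∪⁅x⁆∣≤1+∣p∣ p x)
∣p∪⁅x⁆∣≤1+∣p∣ (outside ∷ p) (suc x) = ∣p∪⁅x⁆∣≤1+∣p∣ p x

∣p∣≤1+∣p-x∣ : ∀ {n} (p : Subset n) x → ∣ p ∣ ≤ suc ∣ p - x ∣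
∣p∣≤1+∣p-x∣ p x = ℕ.≤-trans (p⊆q⇒∣p∣≤∣q∣ sub) (∣p∪⁅x⁆∣≤1+∣p∣ (p - x) x)
  where
  sub : p ⊆ (p - x) ∪ ⁅ x ⁆
  sub {y} y∈p with y ≟ x
  ... | yes refl = x∈p∪q⁺ (inj₂ (x∈⁅x⁆ x))
  ... | no y≢x   = x∈p∪q⁺ (inj₁ (x∈p∧x≢y⇒x∈p-y y∈p y≢x))

x∉p-x : ∀ {n} (p : Subset n) {x} → x ∉ p - x
-- Were x still present, removing it once more would shrink the set, but removal is idempotent.
x∉p-x p {x} x∈ = ℕ.<-irrefl (cong ∣_∣ (p─q─q≡p─q p ⁅ x ⁆)) (x∈p⇒∣p-x∣<∣p∣ x∈)

∈-subsets : ∀ {n} (p : Subset n) → p List.∈ subsets n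
∈-subsets []            = here refl
∈-subsets (outside ∷ p) = ∈-++⁺ˡ (∈-map⁺ (outside ∷_) (∈-subsets p))
∈-subsets {suc n} (inside ∷ p) =
  ∈-++⁺ʳ (List.map (outside ∷_) (subsets n)) (∈-map⁺ (inside ∷_) (∈-subsets p))

module _ {n : ℕ} (M : Matroid n) where
  open Matroid M

  indep⇒∣I∣≤rank : ∀ {I X} → Indep I → I ⊆ X → ∣ I ∣ ≤ rank M X
  indep⇒∣I∣≤rank {I} {X} indI I⊆X = All.lookup (xs≤max 0 _)
    (∈-map⁺ ∣_∣ (∈-filter⁺ (λ I → indep? I ×-dec (I ⊆? X)) (∈-subsets I) (indI , I⊆X)))

  rank<∣circuit∣ : ∀ {C x} → Circuit M C → x ∈ C → rank M C < ∣ C ∣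
  -- The default value 0 of `max` also has to lie below `∣ C ∣`; this is what the element x
  -- provides.
  rank<∣circuit∣ {C} (depC , _) x∈C = max<v⁺ (ℕ.≤-<-trans z≤n (x∈p⇒∣p-x∣<∣p∣ x∈C))
    (All.map⁺ (All.tabulate λ I∈ →
      smaller (proj₂ (∈-filter⁻ (λ I → indep? I ×-dec (I ⊆? C)) {xs = subsets n} I∈))))
    where
    smaller : ∀ {I} → Indep I × I ⊆ C → ∣ I ∣ < ∣ C ∣
    smaller {I} (indI , I⊆C) with any? (λ y → (y ∈? C) ×-dec ¬? (y ∈? I))
    ... | yes (y , y∈C , y∉I) = p⊂q⇒∣p∣<∣q∣ (I⊆C , y , y∈C , y∉I)
    ... | no ∄y = contradiction
      (hereditary (λ {y} y∈C → decidable-stable (y ∈? I) (λ y∉I → ∄y (y , y∈C , y∉I))) indI)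
      depC

  -- The spanning hypothesis enters the proof only through this bound on independent sets.
  ∣indep∣<∣spanning-circuit∣ : ∀ {C I x} → Circuit M C → Spanning M C → x ∈ C → Indep I →
                               ∣ I ∣ < ∣ C ∣
  ∣indep∣<∣spanning-circuit∣ circ span x∈C indI = ℕ.≤-<-trans
    (subst (_ ≤_) (sym span) (indep⇒∣I∣≤rank indI ⊆⊤)) (rank<∣circuit∣ circ x∈C)

  dep⇒circuit : ∀ {X} → ¬ Indep X → ∃[ C ] (Circuit M C × C ⊆ X)
  dep⇒circuit {X} = go ∣ X ∣ ℕ.≤-refl
    where
    go : ∀ k {X} → ∣ X ∣ ≤ k → ¬ Indep X → ∃[ C ] (Circuit M C × C ⊆ X)
    go k {X} ∣X∣≤k dep with any? (λ x → (x ∈? X) ×-dec ¬? (indep? (X - x)))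
    go zero ∣X∣≤0 dep | yes (x , x∈X , _) =
      contradiction (ℕ.<-≤-trans (x∈p⇒∣p-x∣<∣p∣ x∈X) ∣X∣≤0) λ ()
    go (suc k) {X} ∣X∣≤1+k dep | yes (x , x∈X , dep′)
      with go k (ℕ.≤-pred (ℕ.<-≤-trans (x∈p⇒∣p-x∣<∣p∣ x∈X) ∣X∣≤1+k)) dep′
    ... | C , circ , C⊆X-x = C , circ , λ c → p─q⊆p X ⁅ x ⁆ (C⊆X-x c)
    go k {X} _ dep | no ∄x = X , (dep , proper) , λ c → c
      where
      proper : ∀ D → D ⊂ X → Indep D
      proper D (D⊆X , x , x∈X , x∉D) = hereditary
        (λ d → x∈p∧x≢y⇒x∈p-y (D⊆X d) λ { refl → x∉D d })
        (decidable-stable (indep? (X - x)) λ ¬i → ∄x (x , x∈X , ¬i))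

  -- The case u = v is included, so single elements are covered as well.
  simple⇒pair-indep : Simple M → ∀ u v → Indep (⁅ u ⁆ ∪ ⁅ v ⁆)
  simple⇒pair-indep simple u v = decidable-stable (indep? _) λ dep →
    let (C , circ , C⊆) = dep⇒circuit dep in
    ℕ.<⇒≱ (simple C circ)
      (ℕ.≤-trans (p⊆q⇒∣p∣≤∣q∣ C⊆)
        (subst (λ k → ∣ ⁅ u ⁆ ∪ ⁅ v ⁆ ∣ ≤ suc k) (∣⁅x⁆∣≡1 u) (∣p∪⁅x⁆∣≤1+∣p∣ ⁅ u ⁆ v)))

-- Boolean vectors

open SemiringSum (FiniteField.semiring 𝔽₂)
  using (sum; sum-cong-≗; ∑-distrib-+; sum-replicate-zero; sum-permute)

xor≡false⇒≡ : ∀ {a b} → a xor b ≡ false → a ≡ b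
xor≡false⇒≡ {true}  {true}  _ = refl
xor≡false⇒≡ {false} {false} _ = refl

true≢false : ∀ {b} → b ≡ true → b ≢ false
true≢false refl ()

module _ {n : ℕ} where

  ⟦_⟧ : (Fin n → Bool) → Subset n
  ⟦ c ⟧ = tabulate c

  ∈⟦⟧⁺ : ∀ {c x} → c x ≡ true → x ∈ ⟦ c ⟧
  ∈⟦⟧⁺ {c} {x} cx = lookup⇒[]= x _ (trans (lookup∘tabulate c x) cx)

  ∈⟦⟧⁻ : ∀ {c x} → x ∈ ⟦ c ⟧ → c x ≡ true
  ∈⟦⟧⁻ {c} {x} x∈ = trans (sym (lookup∘tabulate c x)) ([]=⇒lookup x∈)

infix 4 _≡true?
_≡true? : ∀ b → Dec (b ≡ true)
b ≡true? = b Bool.≟ true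

module _ {n : ℕ} where

  unit : Fin n → Fin n → Bool
  unit g x = does (x ≟ g)

  unit-self : ∀ g → unit g g ≡ true
  unit-self g = dec-true (g ≟ g) refl

  unit-other : ∀ {g x} → x ≢ g → unit g x ≡ false
  unit-other {g} {x} = dec-false (x ≟ g)

abstract
  ⟨_,_⟩ : ∀ {n} (c x : Fin n → Bool) → Bool
  ⟨ c , x ⟩ = sum λ j → c j ∧ x j

  ⟨⟩-cong-∧ : ∀ {n} {c c′ x x′ : Fin n → Bool} →
              (∀ j → c j ∧ x j ≡ c′ j ∧ x′ j) → ⟨ c , x ⟩ ≡ ⟨ c′ , x′ ⟩
  ⟨⟩-cong-∧ eq = sum-cong-≗ eq

  ⟨⟩-zero : ∀ {n} {c x : Fin n → Bool} → (∀ j → c j ∧ x j ≡ false) → ⟨ c , x ⟩ ≡ false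
  ⟨⟩-zero {n} zeros = trans (sum-cong-≗ zeros) (sum-replicate-zero n)

  ⟨⟩-xorˡ : ∀ {n} (c c′ x : Fin n → Bool) →
            ⟨ (λ j → c j xor c′ j) , x ⟩ ≡ ⟨ c , x ⟩ xor ⟨ c′ , x ⟩
  ⟨⟩-xorˡ c c′ x = trans (sum-cong-≗ λ j → Bool.∧-distribʳ-xor (x j) (c j) (c′ j))
    (∑-distrib-+ (λ j → c j ∧ x j) λ j → c′ j ∧ x j)

  ⟨⟩-permute : ∀ {m n} (π : Permutation m n) (c x : Fin n → Bool) →
               ⟨ c , x ⟩ ≡ ⟨ c ∘ (π Perm.⟨$⟩ʳ_) , x ∘ (π Perm.⟨$⟩ʳ_) ⟩
  ⟨⟩-permute π c x = sum-permute (λ j → c j ∧ x j) π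

  ⟨unit⟩ : ∀ {n} g (x : Fin n → Bool) → ⟨ unit g , x ⟩ ≡ x g
  ⟨unit⟩ {suc n} zero x =
    trans (cong (x zero xor_) (sum-replicate-zero n)) (Bool.xor-identityʳ (x zero))
  ⟨unit⟩ (suc g) x = ⟨unit⟩ g (x ∘ suc)

⟨⟩-cong : ∀ {n} {c c′ x x′ : Fin n → Bool} →
          (∀ j → c j ≡ c′ j) → (∀ j → x j ≡ x′ j) → ⟨ c , x ⟩ ≡ ⟨ c′ , x′ ⟩
⟨⟩-cong c≗c′ x≗x′ = ⟨⟩-cong-∧ λ j → cong₂ _∧_ (c≗c′ j) (x≗x′ j)

⟨⟩-comm : ∀ {n} (c x : Fin n → Bool) → ⟨ c , x ⟩ ≡ ⟨ x , c ⟩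
⟨⟩-comm c x = ⟨⟩-cong-∧ λ j → Bool.∧-comm (c j) (x j)

-- Cuts of 2-sums

-- The coboundary over 𝔽₂: the indicator of the edges between the two sides of φ.
δ : ∀ {v m} → Graph v m → (Fin v → Bool) → Fin m → Bool
δ G φ j = φ (proj₁ (G j)) xor φ (proj₂ (G j))

↑-cover : ∀ {m n} {P : Fin (m ℕ.+ n) → Set} →
          (∀ i → P (i ↑ˡ n)) → (∀ j → P (m ↑ʳ j)) → ∀ k → P k
↑-cover {m} {n} {P} left right k with splitAt m k | join-splitAt m n k
... | inj₁ i | refl = left i
... | inj₂ j | refl = right j

mergeEnds-fst : ∀ {v w} (a b : Fin (2 ℕ.+ w)) (a≢b : a ≢ b) (a′ b′ : Fin v) →
                mergeEnds a b a≢b a′ b′ a ≡ a′ ↑ˡ w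
mergeEnds-fst a b a≢b a′ b′ with a ≟ a | b ≟ a
... | yes _  | _ = refl
... | no a≢a | _ = contradiction refl a≢a

mergeEnds-snd : ∀ {v w} (a b : Fin (2 ℕ.+ w)) (a≢b : a ≢ b) (a′ b′ : Fin v) →
                mergeEnds a b a≢b a′ b′ b ≡ b′ ↑ˡ w
mergeEnds-snd a b a≢b a′ b′ with a ≟ b | b ≟ b
... | yes a≡b | _      = contradiction a≡b a≢b
... | no _    | yes _  = refl
... | no _    | no b≢b = contradiction refl b≢b

module TwoSum {v a w b : ℕ} (G : Graph v (suc a)) (p : Fin (suc a))
              (H : Graph (2 ℕ.+ w) (suc b)) (q : Fin (suc b)) (loopless : Loopless H) where

  merge : Fin (2 ℕ.+ w) → Fin (v ℕ.+ w)
  merge = mergeEnds (proj₁ (H q)) (proj₂ (H q)) (loopless q) (proj₁ (G p)) (proj₂ (G p))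

  T : Graph (v ℕ.+ w) (b ℕ.+ a)
  T = twoSum false G p H q loopless

  δ-left : ∀ φ i → δ T φ (i ↑ˡ a) ≡ δ H (φ ∘ merge) (punchIn q i)
  δ-left φ i rewrite splitAt-↑ˡ b i a = refl

  δ-right : ∀ φ j → δ T φ (b ↑ʳ j) ≡ δ G (φ ∘ (_↑ˡ w)) (punchIn p j)
  δ-right φ j rewrite splitAt-↑ʳ b a j = refl

  -- Merging sends the ends of q to the ends of p, so the restrictions of φ to the two summands
  -- agree on the basepoint. This bit is all that one side of a 2-sum knows of a cut on the other
  -- side.
  δ-basepoint : ∀ φ → δ H (φ ∘ merge) q ≡ δ G (φ ∘ (_↑ˡ w)) p
  δ-basepoint φ = cong₂ (λ x y → φ x xor φ y)
    (mergeEnds-fst (proj₁ (H q)) _ (loopless q) (proj₁ (G p)) _)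
    (mergeEnds-snd (proj₁ (H q)) _ (loopless q) (proj₁ (G p)) _)

-- Ladders as words in the pieces

-- The basepoint of a piece on the side of its predecessor; the next basepoint is always 0F.
opposite : ∀ k → Edge k
opposite K₄ = 5F
opposite K₃ = 2F
opposite B₃ = 2F

opposite≢0 : ∀ k → opposite k ≢ 0F
opposite≢0 K₄ ()
opposite≢0 K₃ ()
opposite≢0 B₃ ()

opposite-matching : ∀ k → k ≡ K₄ → Matching (graph k) (opposite k) 0F
opposite-matching K₄ _ x (inj₁ refl , inj₁ ())
opposite-matching K₄ _ x (inj₁ refl , inj₂ ())
opposite-matching K₄ _ x (inj₂ refl , inj₁ ())
opposite-matching K₄ _ x (inj₂ refl , inj₂ ())

-- The values of a cut on the edges of a piece: s and t on the basepoints opposite k and 0F.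
Step : ∀ k → Vec Bool (extraEdges k) → Bool → Bool → Set
Step K₄ (a ∷ g ∷ h ∷ b ∷ []) s t = g ≡ s xor a × h ≡ s xor b × t ≡ (s xor a) xor b
Step K₃ (a ∷ [])             s t = t ≡ s xor a
Step B₃ (g ∷ [])             s t = g ≡ s × t ≡ s

-- A cut sums to zero around every cycle, and each equation of `Step` is such a cycle through the
-- opposite edge: in K₄ the triangles 0-2-3 and 1-2-3 and the 4-cycle 0-2-3-1, in K₃ the triangle,
-- in B₃ two digons.
cut⇒step : ∀ k (ψ : Vertex k → Bool) xs {s t} → δ (graph k) ψ (opposite k) ≡ s →
           (∀ i → δ (graph k) ψ (punchIn (opposite k) i) ≡ lookup (t ∷ xs) i) → Step k xs s t
cut⇒step K₄ ψ (a ∷ g ∷ h ∷ b ∷ []) refl on =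
  values (ψ 0F) (ψ 1F) (ψ 2F) (ψ 3F) (on 0F) (on 1F) (on 2F) (on 3F) (on 4F)
  where
  values : ∀ p q r u {a g h b t} → p xor q ≡ t → p xor r ≡ a → p xor u ≡ g → q xor r ≡ h →
           q xor u ≡ b → Step K₄ (a ∷ g ∷ h ∷ b ∷ []) (r xor u) t
  values p q false u refl refl refl refl refl = tail p q u
    where
    tail : ∀ p q u → p xor u ≡ u xor (p xor false) × q xor false ≡ u xor (q xor u) ×
                     p xor q ≡ (u xor (p xor false)) xor (q xor u)
    tail false false false = refl , refl , refl
    tail false false true  = refl , refl , refl
    tail false true  false = refl , refl , refl
    tail false true  true  = refl , refl , refl
    tail true  false false = refl , refl , refl
    tail true  false true  = refl , refl , refl
    tail true  true  false = refl , refl , refl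
    tail true  true  true  = refl , refl , refl
  values p q true u refl refl refl refl refl = tail p q u
    where
    tail : ∀ p q u → p xor u ≡ not u xor (p xor true) × q xor true ≡ not u xor (q xor u) ×
                     p xor q ≡ (not u xor (p xor true)) xor (q xor u)
    tail false false false = refl , refl , refl
    tail false false true  = refl , refl , refl
    tail false true  false = refl , refl , refl
    tail false true  true  = refl , refl , refl
    tail true  false false = refl , refl , refl
    tail true  false true  = refl , refl , refl
    tail true  true  false = refl , refl , refl
    tail true  true  true  = refl , refl , refl
cut⇒step K₃ ψ (a ∷ []) refl on = values (ψ 0F) (ψ 1F) (ψ 2F) (on 0F) (on 1F)
  where
  values : ∀ p q r {a t} → p xor q ≡ t → p xor r ≡ a → t ≡ (q xor r) xor a
  values false false false refl refl = refl
  values false false true  refl refl = refl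
  values false true  false refl refl = refl
  values false true  true  refl refl = refl
  values true  false false refl refl = refl
  values true  false true  refl refl = refl
  values true  true  false refl refl = refl
  values true  true  true  refl refl = refl
cut⇒step B₃ ψ (g ∷ []) refl on = sym (on 1F) , sym (on 0F)

-- The values y and z at the ends of the opposite edge are prescribed, and not only their sum s, so
-- that the result can extend a labelling already chosen on the earlier pieces.
step⇒cut : ∀ k xs {s t} y z → Step k xs s t → y xor z ≡ s →
           ∃[ ψ ] (ψ (proj₁ (graph k (opposite k))) ≡ y × ψ (proj₂ (graph k (opposite k))) ≡ z ×
                   (∀ i → δ (graph k) ψ (punchIn (opposite k) i) ≡ lookup (t ∷ xs) i))
step⇒cut K₄ (a ∷ g ∷ h ∷ b ∷ []) y z (refl , refl , refl) refl = ψ , refl , refl , on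
  where
  ψ : Fin 4 → Bool
  -- The edges a and b join the two new vertices to the prescribed ones, which forces their values.
  ψ 0F = a xor y
  ψ 1F = z xor b
  ψ 2F = y
  ψ 3F = z
  values : ∀ a b y z → ((a xor y) xor (z xor b) ≡ ((y xor z) xor a) xor b) ×
    ((a xor y) xor y ≡ a) × ((a xor y) xor z ≡ (y xor z) xor a) ×
    ((z xor b) xor y ≡ (y xor z) xor b) × ((z xor b) xor z ≡ b)
  values false false false false = refl , refl , refl , refl , refl
  values false false false true  = refl , refl , refl , refl , refl
  values false false true  false = refl , refl , refl , refl , refl
  values false false true  true  = refl , refl , refl , refl , refl
  values false true  false false = refl , refl , refl , refl , refl
  values false true  false true  = refl , refl , refl , refl , refl
  values false true  true  false = refl , refl , refl , refl , refl
  values false true  true  true  = refl , refl , refl , refl , refl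
  values true  false false false = refl , refl , refl , refl , refl
  values true  false false true  = refl , refl , refl , refl , refl
  values true  false true  false = refl , refl , refl , refl , refl
  values true  false true  true  = refl , refl , refl , refl , refl
  values true  true  false false = refl , refl , refl , refl , refl
  values true  true  false true  = refl , refl , refl , refl , refl
  values true  true  true  false = refl , refl , refl , refl , refl
  values true  true  true  true  = refl , refl , refl , refl , refl
  on : ∀ i → δ (graph K₄) ψ (punchIn 5F i) ≡
       lookup ((((y xor z) xor a) xor b) ∷ a ∷ ((y xor z) xor a) ∷ ((y xor z) xor b) ∷ b ∷ []) i
  on 0F = proj₁ (values a b y z)
  on 1F = proj₁ (proj₂ (values a b y z))
  on 2F = proj₁ (proj₂ (proj₂ (values a b y z)))
  on 3F = proj₁ (proj₂ (proj₂ (proj₂ (values a b y z))))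
  on 4F = proj₂ (proj₂ (proj₂ (proj₂ (values a b y z))))
step⇒cut K₃ (a ∷ []) y z refl refl = ψ , refl , refl , on
  where
  ψ : Fin 3 → Bool
  ψ 0F = a xor z
  ψ 1F = y
  ψ 2F = z
  values : ∀ a y z → ((a xor z) xor y ≡ (y xor z) xor a) × ((a xor z) xor z ≡ a)
  values false false false = refl , refl
  values false false true  = refl , refl
  values false true  false = refl , refl
  values false true  true  = refl , refl
  values true  false false = refl , refl
  values true  false true  = refl , refl
  values true  true  false = refl , refl
  values true  true  true  = refl , refl
  on : ∀ i → δ (graph K₃) ψ (punchIn 2F i) ≡ lookup (((y xor z) xor a) ∷ a ∷ []) i
  on 0F = proj₁ (values a y z)
  on 1F = proj₂ (values a y z)
step⇒cut B₃ (g ∷ []) y z (refl , refl) refl = (λ { 0F → y ; 1F → z }) , refl , refl , λ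
  { 0F → refl ; 1F → refl }

-- The first clause keeps B₃ away from the start of the path, the second forbids consecutive copies
-- of it.
Joinable : Maybe Piece → Piece → Set
Joinable nothing  k′ = k′ ≢ B₃
Joinable (just k) k′ = ¬ (k ≡ B₃ × k′ ≡ B₃)

-- A ladder minus its last basepoint, with edges labelled by elements of A.  Labels follow the edges
-- of a piece other than its basepoints; the edge replacing the first basepoint is labelled by the
-- parameter e below.
data Word (A : Set) : Maybe Piece → Set where
  base : Word A nothing
  grow : ∀ {mk} → Word A mk → ∀ k → Joinable mk k → Vec A (extraEdges k) → Word A (just k)

segment : ∀ {A k} → Word A (just k) → Segment k
segment (grow base k ok _)               = first k ok 0F
segment (grow w@(grow _ _ _ _) k ok _) =
  next (segment w) false k ok (opposite k) 0F (opposite≢0 k) (opposite-matching k)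

module _ {A : Set} {k : Piece} (w : Word A (just k)) where
  open Rooted (segmentGraph (segment w)) public
    renaming (vertexCount to ∣V∣; edgeCount to ∣E∣; rootedGraph to ladder; root to ladderRoot)

-- The root computes to 0F for each concrete piece, but not for a variable one. The arguments on
-- 2-sums below therefore abstract over the root and match on this equation.
ladderRoot≡0 : ∀ {A k} (w : Word A (just k)) → ladderRoot w ≡ 0F
ladderRoot≡0 (grow base _ _ _)               = refl
ladderRoot≡0 (grow (grow _ _ _ _) K₄ _ _) = refl
ladderRoot≡0 (grow (grow _ _ _ _) K₃ _ _) = refl
ladderRoot≡0 (grow (grow _ _ _ _) B₃ _ _) = refl

-- The root is still an edge of the rooted graph. Closing the decomposition with the last piece thus
-- yields the very same 2-sum, and the isomorphism is the identity.
ladder-clean : ∀ {A k} (w : Word A (just k)) → k ≢ B₃ → CleanLadder (ladder w)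
ladder-clean (grow base k ok _) k≢B₃ = single k ok , Perm.id , Perm.id , λ _ _ _ → mk⇔ id id
ladder-clean (grow w@(grow _ _ _ _) k ok _) k≢B₃ =
  last (segment w) false k k≢B₃ (opposite k) , Perm.id , Perm.id , λ _ _ _ → mk⇔ id id

module Labels {A : Set} (e : A) where

  -- Edge `suc j` carries label j. Edge 0F, the current last basepoint, stays unlabelled. The order
  -- is that of `twoSum`, the edges of the newest piece preceding the older ones; in the first piece
  -- the opposite edge comes last and is labelled e.
  labels : ∀ {k} (w : Word A (just k)) → Vec A (∣E∣ w)
  labels (grow base _ _ xs)               = xs ∷ʳ e
  labels (grow w@(grow _ _ _ _) _ _ xs) = xs ++ labels w

  labelList : ∀ {mk} → Word A mk → List A
  labelList base            = e ∷ []
  labelList (grow w _ _ xs) = toList xs List.++ labelList w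

  toList-labels : ∀ {k} (w : Word A (just k)) → toList (labels w) ≡ labelList w
  toList-labels (grow base _ _ xs)               = toList-∷ʳ e xs
  toList-labels (grow w@(grow _ _ _ _) _ _ xs) =
    trans (toList-++ xs (labels w)) (cong (toList xs List.++_) (toList-labels w))

  -- A cut as the run of an automaton along the word, whose state is the value on the current
  -- basepoint. Before the first piece that basepoint is e itself.
  Run : ∀ {mk} → Word A mk → (A → Bool) → Bool → Set
  Run base            x t = t ≡ x e
  Run (grow w k _ xs) x t = ∃[ s ] (Run w x s × Step k (map x xs) s t)

  Cut : ∀ {k} → Word A (just k) → (A → Bool) → Bool → Set
  Cut w x t = ∃[ φ ] (δ (ladder w) φ 0F ≡ t ×
    (∀ j → δ (ladder w) φ (suc j) ≡ x (lookup (labels w) j)))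

  private
    first-edges : ∀ k (ψ : Vertex k → Bool) {x xs t} →
      δ (graph k) ψ (opposite k) ≡ x e →
      (∀ i → δ (graph k) ψ (punchIn (opposite k) i) ≡ lookup (t ∷ map x xs) i) →
      δ (graph k) ψ 0F ≡ t × (∀ j → δ (graph k) ψ (suc j) ≡ x (lookup (xs ∷ʳ e) j))
    first-edges K₄ ψ {xs = _ ∷ _ ∷ _ ∷ _ ∷ []} opp on = on 0F , λ
      { 0F → on 1F ; 1F → on 2F ; 2F → on 3F ; 3F → on 4F ; 4F → opp }
    first-edges K₃ ψ {xs = _ ∷ []} opp on = on 0F , λ { 0F → on 1F ; 1F → opp }
    first-edges B₃ ψ {xs = _ ∷ []} opp on = on 0F , λ { 0F → on 1F ; 1F → opp }

    first-edges⁻ : ∀ k (ψ : Vertex k → Bool) {x xs t} →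
      δ (graph k) ψ 0F ≡ t → (∀ j → δ (graph k) ψ (suc j) ≡ x (lookup (xs ∷ʳ e) j)) →
      δ (graph k) ψ (opposite k) ≡ x e ×
      (∀ i → δ (graph k) ψ (punchIn (opposite k) i) ≡ lookup (t ∷ map x xs) i)
    first-edges⁻ K₄ ψ {xs = _ ∷ _ ∷ _ ∷ _ ∷ []} on₀ on = on 4F , λ
      { 0F → on₀ ; 1F → on 0F ; 2F → on 1F ; 3F → on 2F ; 4F → on 3F }
    first-edges⁻ K₃ ψ {xs = _ ∷ []} on₀ on = on 1F , λ { 0F → on₀ ; 1F → on 0F }
    first-edges⁻ B₃ ψ {xs = _ ∷ []} on₀ on = on 1F , λ { 0F → on₀ ; 1F → on 0F }

  cut⇒run : ∀ {k} (w : Word A (just k)) {x t} → Cut w x t → Run w x t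
  cut⇒run (grow base k _ xs) {x} (ψ , on₀ , on) =
    let (opp , on′) = first-edges⁻ k ψ {xs = xs} on₀ on
    in x e , refl , cut⇒step k ψ (map x xs) opp on′
  cut⇒run (grow w@(grow _ _ _ _) k _ xs) {x} {t} (φ , on₀ , on) =
    let (s , cut , stepₖ) = split (ladderRoot w) (ladderRoot≡0 w) φ on₀′ on′
    in s , cut⇒run w cut , stepₖ
    where
    module TS (p : Fin (suc (∣E∣ w))) =
      TwoSum (ladder w) p (graph k) (opposite k) (graph-loopless k)
    on₀′ : δ (TS.T (ladderRoot w)) φ 0F ≡ t
    on₀′ = on₀
    on′ : ∀ j → δ (TS.T (ladderRoot w)) φ (suc j) ≡ x (lookup (xs ++ labels w) j)
    on′ = on
    split : ∀ p → p ≡ 0F → ∀ φ → δ (TS.T p) φ 0F ≡ t →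
           (∀ j → δ (TS.T p) φ (suc j) ≡ x (lookup (xs ++ labels w) j)) →
           ∃[ s ] (Cut w x s × Step k (map x xs) s t)
    split p refl φ on₀ on = δ (ladder w) φG 0F ,
      (φG , refl , λ j → trans (sym (δ-right φ j))
        (trans (on (extraEdges k ↑ʳ j)) (cong x (lookup-++ʳ xs (labels w) j)))) ,
      cut⇒step k (φ ∘ merge) (map x xs) (δ-basepoint φ) piece
      where
      open TS p
      φG : Fin (∣V∣ w) → Bool
      φG = φ ∘ (_↑ˡ extraVertices k)
      piece : ∀ i → δ (graph k) (φ ∘ merge) (punchIn (opposite k) i) ≡ lookup (t ∷ map x xs) i
      piece zero    = trans (sym (δ-left φ 0F)) on₀
      piece (suc i) = trans (sym (δ-left φ (suc i))) (trans (on (i ↑ˡ ∣E∣ w))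
        (trans (cong x (lookup-++ˡ xs (labels w) i)) (sym (lookup-map i x xs))))

  run⇒cut : ∀ {k} (w : Word A (just k)) {x t} → Run w x t → Cut w x t
  run⇒cut (grow base k _ xs) {x} (s , refl , stepₖ) =
    let (ψ , ψy , ψz , on) = step⇒cut k (map x xs) false (x e) stepₖ refl
    in ψ , first-edges k ψ {xs = xs} (cong₂ _xor_ ψy ψz) on
  run⇒cut (grow w@(grow _ _ _ _) k _ xs) {x} {t} (s , run , stepₖ) with run⇒cut w run
  ... | φG , refl , onG = glue (ladderRoot w) (ladderRoot≡0 w)
    where
    module TS (p : Fin (suc (∣E∣ w))) =
      TwoSum (ladder w) p (graph k) (opposite k) (graph-loopless k)
    -- The cut of the earlier ladder dictates the values at both ends of the shared basepoint.
    extended : ∃[ ψ ] _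
    extended = step⇒cut k (map x xs)
      (φG (proj₁ (ladder w 0F))) (φG (proj₂ (ladder w 0F))) stepₖ refl
    ψ : Vertex k → Bool
    ψ = proj₁ extended
    ψ-fst = proj₁ (proj₂ extended)
    ψ-snd = proj₁ (proj₂ (proj₂ extended))
    ψ-on = proj₂ (proj₂ (proj₂ extended))
    φ : Fin (∣V∣ w ℕ.+ extraVertices k) → Bool
    -- The ends of `opposite k` are the two highest-numbered vertices of the piece, so its new
    -- vertices are exactly those reached by two `inject₁`.
    φ = [ φG , ψ ∘ inject₁ ∘ inject₁ ]′ ∘ splitAt (∣V∣ w)
    φ-old : ∀ y → φ (y ↑ˡ extraVertices k) ≡ φG y
    φ-old y = cong [ φG , _ ]′ (splitAt-↑ˡ (∣V∣ w) y _)
    φ-new : ∀ y → φ (∣V∣ w ↑ʳ y) ≡ ψ (inject₁ (inject₁ y))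
    φ-new y = cong [ φG , _ ]′ (splitAt-↑ʳ (∣V∣ w) _ y)
    glue : ∀ p → p ≡ 0F → ∃[ φ ] (δ (TS.T p) φ 0F ≡ t ×
           (∀ j → δ (TS.T p) φ (suc j) ≡ x (lookup (xs ++ labels w) j)))
    glue p refl = φ , trans (δ-left φ 0F) (piece 0F) , ↑-cover
      (λ i → trans (δ-left φ (suc i)) (trans (piece (suc i))
        (trans (lookup-map i x xs) (cong x (sym (lookup-++ˡ xs (labels w) i))))))
      (λ j → trans (δ-right φ j) (trans (cong₂ _xor_ (φ-old _) (φ-old _))
        (trans (onG j) (cong x (sym (lookup-++ʳ xs (labels w) j))))))
      where
      open TS p
      φ∘merge : ∀ k (ψ : Vertex k → Bool) (φ : Fin (∣V∣ w ℕ.+ extraVertices k) → Bool) →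
        (∀ y → φ (y ↑ˡ extraVertices k) ≡ φG y) → (∀ y → φ (∣V∣ w ↑ʳ y) ≡ ψ (inject₁ (inject₁ y))) →
        ψ (proj₁ (graph k (opposite k))) ≡ φG (proj₁ (ladder w 0F)) →
        ψ (proj₂ (graph k (opposite k))) ≡ φG (proj₂ (ladder w 0F)) →
        ∀ y → φ (TwoSum.merge (ladder w) 0F (graph k) (opposite k) (graph-loopless k) y) ≡ ψ y
      φ∘merge K₄ ψ φ old new fst snd 0F = new 0F
      φ∘merge K₄ ψ φ old new fst snd 1F = new 1F
      φ∘merge K₄ ψ φ old new fst snd 2F = trans (old _) (sym fst)
      φ∘merge K₄ ψ φ old new fst snd 3F = trans (old _) (sym snd)
      φ∘merge K₃ ψ φ old new fst snd 0F = new 0F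
      φ∘merge K₃ ψ φ old new fst snd 1F = trans (old _) (sym fst)
      φ∘merge K₃ ψ φ old new fst snd 2F = trans (old _) (sym snd)
      φ∘merge B₃ ψ φ old new fst snd 0F = trans (old _) (sym fst)
      φ∘merge B₃ ψ φ old new fst snd 1F = trans (old _) (sym snd)
      ψ≗ : ∀ y → φ (merge y) ≡ ψ y
      ψ≗ = φ∘merge k ψ φ φ-old φ-new ψ-fst ψ-snd
      piece : ∀ i → δ (graph k) (φ ∘ merge) (punchIn (opposite k) i) ≡ lookup (t ∷ map x xs) i
      piece i = trans (cong₂ _xor_ (ψ≗ _) (ψ≗ _)) (ψ-on i)

-- Cycle matroids over 𝔽₂

does-agree : ∀ {A B : Set} (a? : Dec A) (b? : Dec B) → (A → B) → (B → A) →
             does a? xor does b? ≡ false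
does-agree (yes a) (yes b) to from = refl
does-agree (yes a) (no ¬b) to from = contradiction (to a) ¬b
does-agree (no ¬a) (yes b) to from = contradiction (from b) ¬a
does-agree (no ¬a) (no ¬b) to from = refl

module _ {v m : ℕ} (G : Graph v m) where
  open CycleMatroidProof G

  -- The cycle space, defined as the orthogonal complement of the cuts instead of the span of the
  -- cycles.
  Cyclical : (Fin m → Bool) → Set
  Cyclical c = ∀ φ → ⟨ c , δ G φ ⟩ ≡ false

  acyclic⇒0 : ∀ {X c} → Acyclic G X → Cyclical c → (∀ j → c j ≡ true → j ∈ X) → ∀ j → c j ≡ false
  acyclic⇒0 {X} {c} acyc cyc supp j = Bool.¬-not λ cj → acyclic⇒ind acyc
    (j , supp j cj , mono (λ (cg , g≢j) → supp _ cg , g≢j) (connected cj))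
    where
    Rest : Fin m → Set
    Rest g = c g ≡ true × g ≢ j
    rest? : ∀ x y → Dec (Conn Rest x y)
    rest? = conn? λ g → (c g ≡true?) ×-dec ¬? (g ≟ j)
    -- Otherwise the component of an end of j defines a cut meeting c in j only.
    connected : c j ≡ true → Conn Rest (proj₁ (G j)) (proj₂ (G j))
    connected cj = decidable-stable (rest? _ _) λ disc →
      true≢false (trans (⟨⟩-cong-∧ (only-j disc)) (⟨unit⟩ j λ _ → true)) (cyc φ)
      where
      φ : Fin v → Bool
      φ y = does (rest? (proj₁ (G j)) y)
      only-j : ¬ Conn Rest (proj₁ (G j)) (proj₂ (G j)) → ∀ g → c g ∧ δ G φ g ≡ unit j g ∧ true
      only-j disc g with g ≟ j
      ... | yes refl = cong₂ _∧_ cj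
            (cong₂ _xor_ (dec-true (rest? _ _) []) (dec-false (rest? _ _) disc))
      ... | no g≢j with c g in cg
      ...   | false = refl
      ...   | true  = does-agree (rest? _ _) (rest? _ _)
                (_⊕ step g (cg , g≢j) (inj₁ refl) []) (_⊕ step g (cg , g≢j) (inj₂ refl) [])

  parity : List (Fin m) → Fin m → Bool
  parity []       j = false
  parity (g ∷ gs) j = unit g j xor parity gs j

  parity⇒∈ : ∀ gs {j} → parity gs j ≡ true → j List.∈ gs
  parity⇒∈ (g ∷ gs) {j} pj with j ≟ g
  ... | yes j≡g = here j≡g
  ... | no _    = there (parity⇒∈ gs pj)

  joins-δ : ∀ {g x y} φ → Joins G g x y → δ G φ g ≡ φ x xor φ y
  joins-δ φ (inj₁ eq) = cong (λ (x , y) → φ x xor φ y) eq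
  joins-δ {g} {x} {y} φ (inj₂ eq) =
    trans (cong (λ (x , y) → φ x xor φ y) eq) (Bool.xor-comm (φ y) (φ x))

  ⟨walk⟩ : ∀ {x y} (w : Walk G x y) φ → ⟨ parity (edges w) , δ G φ ⟩ ≡ φ x xor φ y
  ⟨walk⟩ {x} [] φ = trans (⟨⟩-zero {c = parity []} {δ G φ} λ _ → refl) (sym (Bool.xor-same (φ x)))
  ⟨walk⟩ {x} {z} (step {y = y} g j w) φ = begin
    ⟨ parity (g ∷ edges w) , δ G φ ⟩           ≡⟨ ⟨⟩-xorˡ (unit g) (parity (edges w)) (δ G φ) ⟩
    ⟨ unit g , δ G φ ⟩ xor ⟨ parity (edges w) , δ G φ ⟩
      ≡⟨ cong₂ _xor_ (trans (⟨unit⟩ g (δ G φ)) (joins-δ φ j)) (⟨walk⟩ w φ) ⟩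
    (φ x xor φ y) xor (φ y xor φ z)            ≡⟨ telescope (φ x) (φ y) (φ z) ⟩
    φ x xor φ z                                ∎
    where
    open ≡-Reasoning
    telescope : ∀ a b c → (a xor b) xor (b xor c) ≡ a xor c
    telescope false false c = refl
    telescope false true  c = Bool.not-involutive c
    telescope true  false c = refl
    telescope true  true  c = refl

  -- The edge vector of a cycle is orthogonal to cuts because the sum along its path telescopes. It
  -- is nonzero because the closing edge is not on the path.
  0⇒acyclic : ∀ {X} → (∀ {c} → Cyclical c → (∀ j → c j ≡ true → j ∈ X) → ∀ j → c j ≡ false) →
              Acyclic G X
  0⇒acyclic zeros (cy , inX) = true≢false at-closing (zeros cyclical
      (λ j pj → All.lookup inX (parity⇒∈ (cycleEdges cy) pj)) closing)
    where
    open Cycle cy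
    at-closing : parity (cycleEdges cy) closing ≡ true
    at-closing = cong₂ _xor_ (unit-self closing) (Bool.¬-not (fresh ∘ parity⇒∈ (edges path)))
    cyclical : Cyclical (parity (cycleEdges cy))
    cyclical φ = trans (⟨⟩-xorˡ (unit closing) (parity (edges path)) (δ G φ))
      (trans (cong₂ _xor_ (trans (⟨unit⟩ closing (δ G φ)) (joins-δ φ closes)) (⟨walk⟩ path φ))
        (trans (cong (_xor (φ start xor φ end)) (Bool.xor-comm (φ end) (φ start)))
          (Bool.xor-same (φ start xor φ end))))

toList-lookup-injective : ∀ {A : Set} {n} (xs : Vec A n) → Unique (toList xs) →
                          ∀ {i j} → lookup xs i ≡ lookup xs j → i ≡ j
toList-lookup-injective (x ∷ xs) _        {zero}  {zero}  _  = refl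
toList-lookup-injective (x ∷ xs) (x∉ ∷ _) {zero}  {suc j} eq =
  contradiction eq (All.lookup x∉ (∈-toList⁺ (∈-lookup j xs)))
toList-lookup-injective (x ∷ xs) (x∉ ∷ _) {suc i} {zero}  eq =
  contradiction (sym eq) (All.lookup x∉ (∈-toList⁺ (∈-lookup i xs)))
toList-lookup-injective (x ∷ xs) (_ ∷ u)  {suc i} {suc j} eq =
  cong suc (toList-lookup-injective xs u eq)

infixl 8 _when_

_when_ : Fin 3 → Bool → Fin 3
u when true  = u
u when false = 0F

-- Chords of a spanning circuit

module Chords {n : ℕ} (M : Matroid n) (simple : Simple M) (e f : Fin n) (e≢f : e ≢ f)
              (spanning : ∀ C → Circuit M C → e ∈ C → f ∈ C → Spanning M C)
              (C : Subset n) (circuit : Circuit M C) (e∈C : e ∈ C) (f∈C : f ∈ C)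
              (ker₂ : Kernel 𝔽₂ M) (ker₃ : Kernel 𝔽₃ M) where
  open Matroid M
  open Kernel ker₂

  χ : Fin n → Bool
  χ = lookup C

  χ⇒∈ : ∀ {x} → χ x ≡ true → x ∈ C
  χ⇒∈ {x} = lookup⇒[]= x C

  χe : χ e ≡ true
  χe = []=⇒lookup e∈C

  χf : χ f ≡ true
  χf = []=⇒lookup f∈C

  C-x-indep : ∀ {x} → χ x ≡ true → Indep (C - x)
  C-x-indep χx = proj₂ circuit _ (x∈p⇒p-x⊂p (χ⇒∈ χx))

  K-xor : ∀ {c d} → K c → K d → K (λ x → c x xor d x)
  K-xor = K-linear true true

  vanishes : ∀ {I c} → Indep I → K c → (∀ x → c x ≡ true → x ∈ I) → ∀ x → c x ≡ false
  vanishes ind Kc supp = indep⇒0 ind Kc λ x x∉I → Bool.¬-not (x∉I ∘ supp x)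

  vanishes-on-pair : ∀ {c} u v → K c → (∀ x → c x ≡ true → x ≡ u ⊎ x ≡ v) → ∀ x → c x ≡ false
  vanishes-on-pair {c} u v Kc supp =
    vanishes (simple⇒pair-indep M simple u v) Kc λ x cx → inPair (supp x cx)
    where
    inPair : ∀ {x} → x ≡ u ⊎ x ≡ v → x ∈ ⁅ u ⁆ ∪ ⁅ v ⁆
    inPair (inj₁ refl) = x∈p∪q⁺ (inj₁ (x∈⁅x⁆ u))
    inPair (inj₂ refl) = x∈p∪q⁺ (inj₂ (x∈⁅x⁆ v))

  Outside : List (Fin n) → (Fin n → Bool) → Set
  Outside gs c = ∀ x → c x ≡ true → χ x ≡ true ⊎ x List.∈ gs

  within : ∀ {c x} → Outside [] c → c x ≡ true → χ x ≡ true
  within {x = x} out cx with out x cx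
  ... | inj₁ χx = χx

  vanishes-at⇒zero : ∀ {c y} → K c → Outside [] c → χ y ≡ true → c y ≡ false → ∀ x → c x ≡ false
  vanishes-at⇒zero {c} {y} Kc out χy cy = vanishes (C-x-indep χy) Kc λ x cx →
    x∈p∧x≢y⇒x∈p-y (χ⇒∈ (within out cx)) λ { refl → true≢false cx cy }

  -- A nonzero dependence supported on C vanishes nowhere on C, since C minus a point is
  -- independent; over 𝔽₂ this leaves only the indicator.
  Kχ : K χ
  Kχ with dep⇒≢0 (proj₁ circuit)
  ... | c , Kc , supp , j , cj≢0 = K-resp c≗χ Kc
    where
    out : Outside [] c
    out x cx = inj₁ (Bool.¬-not {χ x} {false} λ χx →
      true≢false cx (supp x λ x∈C → true≢false ([]=⇒lookup x∈C) χx))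
    c≗χ : ∀ x → c x ≡ χ x
    c≗χ x with c x in cx | χ x in χx
    ... | true  | true  = refl
    ... | false | false = refl
    ... | true  | false = contradiction (within out cx) λ χx′ → true≢false χx′ χx
    ... | false | true  = contradiction (vanishes-at⇒zero Kc out χx cx j) cj≢0

  -- One of c and c + χ vanishes at y and therefore everywhere.
  constant-on-C : ∀ {c} → K c → Outside [] c →
                  ∀ {x y} → χ x ≡ true → χ y ≡ true → c x ≡ c y
  constant-on-C {c} Kc out {x} {y} χx χy with c y in cy
  ... | false = vanishes-at⇒zero Kc out χy cy x
  ... | true  = xor≡false⇒≡ (subst (λ b → c x xor b ≡ false) χx
      (vanishes-at⇒zero (K-xor Kc Kχ) out′ χy (cong₂ _xor_ cy χy) x))
    where
    out′ : Outside [] (λ x → c x xor χ x)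
    out′ x cx with c x in eq | χ x in eq′
    ... | true  | true  = inj₁ refl
    ... | true  | false = inj₁ (trans (sym eq′) (within out eq))
    ... | false | true  = inj₁ refl

  abstract
    -- The fundamental cycle of g for the basis C - f, and the zero vector for g in C.
    chords : ∀ g → ∃[ d ] (K d × (∀ {x} → d x ≡ true → χ x ≡ true ⊎ x ≡ g) × d f ≡ false ×
                          (χ g ≡ true → ∀ x → d x ≡ false) × (χ g ≡ false → d g ≡ true))
    chords g with χ g in χg
    ... | true = (λ _ → false) , K-linear false false Kχ Kχ , (λ ()) , refl , (λ _ _ → refl) , λ ()
    ... | false with dep⇒≢0 dep
      where
      -- This set has at least as many elements as the spanning circuit C.
      dep : ¬ Indep ((C - f) ∪ ⁅ g ⁆)
      dep ind = ℕ.<⇒≱ (∣indep∣<∣spanning-circuit∣ M circuit (spanning C circuit e∈C f∈C) e∈C ind)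
        (ℕ.≤-trans (∣p∣≤1+∣p-x∣ C f) (p⊂q⇒∣p∣<∣q∣
          ( (λ x∈ → x∈p∪q⁺ (inj₁ x∈)) , g , x∈p∪q⁺ (inj₂ (x∈⁅x⁆ g))
          , λ g∈ → true≢false ([]=⇒lookup (p─q⊆p C ⁅ f ⁆ g∈)) χg)))
    ... | c , Kc , supp , j , cj≢0 = c , Kc , outside-g , Bool.¬-not ¬cf , (λ ()) , λ _ → cg
      where
      member : ∀ {x} → c x ≡ true → x ∈ (C - f) ∪ ⁅ g ⁆
      member {x} cx = decidable-stable (x ∈? _) λ x∉ → true≢false cx (supp x x∉)
      inC-f : ∀ {x} → x ∈ C - f → χ x ≡ true × x ≢ f
      inC-f x∈ = []=⇒lookup (p─q⊆p C ⁅ f ⁆ x∈) , λ { refl → x∉p-x C x∈ }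
      outside-g : ∀ {x} → c x ≡ true → χ x ≡ true ⊎ x ≡ g
      outside-g cx with x∈p∪q⁻ (C - f) ⁅ g ⁆ (member cx)
      ... | inj₁ x∈ = inj₁ (proj₁ (inC-f x∈))
      ... | inj₂ x∈ = inj₂ (x∈⁅y⁆⇒x≡y g x∈)
      ¬cf : c f ≢ true
      ¬cf cf with x∈p∪q⁻ (C - f) ⁅ g ⁆ (member cf)
      ... | inj₁ f∈ = proj₂ (inC-f f∈) refl
      ... | inj₂ f∈ with refl ← x∈⁅y⁆⇒x≡y g f∈ = true≢false χf χg
      cg : c g ≡ true
      cg with c g in eq
      ... | true  = refl
      ... | false = contradiction (vanishes-at⇒zero Kc out χf (Bool.¬-not ¬cf) j) cj≢0
        where
        out : Outside [] c
        out x cx with outside-g cx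
        ... | inj₁ χx = inj₁ χx
        ... | inj₂ refl = contradiction eq (true≢false cx)

    d : Fin n → Fin n → Bool
    d g = proj₁ (chords g)

    Kd : ∀ g → K (d g)
    Kd g = proj₁ (proj₂ (chords g))

    d-support : ∀ {g x} → d g x ≡ true → χ x ≡ true ⊎ x ≡ g
    d-support {g} = proj₁ (proj₂ (proj₂ (chords g)))

    d-f : ∀ g → d g f ≡ false
    d-f g = proj₁ (proj₂ (proj₂ (proj₂ (chords g))))

    d-C : ∀ {g} → χ g ≡ true → ∀ x → d g x ≡ false
    d-C {g} = proj₁ (proj₂ (proj₂ (proj₂ (proj₂ (chords g)))))

    d-self : ∀ {g} → χ g ≡ false → d g g ≡ true
    d-self {g} = proj₂ (proj₂ (proj₂ (proj₂ (proj₂ (chords g)))))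

  d-off : ∀ {g x} → χ x ≡ false → x ≢ g → d g x ≡ false
  d-off χx x≢g = Bool.¬-not λ dx → case d-support dx of λ where
    (inj₁ χx′)  → true≢false χx′ χx
    (inj₂ x≡g) → x≢g x≡g

  -- Gaussian elimination of the coordinate g by its fundamental cycle. For g in C the vector `d g`
  -- is zero, so eliminations can run over all elements without a case distinction.
  elim : Fin n → (Fin n → Bool) → Fin n → Bool
  elim g c x = c x xor (c g ∧ d g x)

  K-elim : ∀ g {c} → K c → K (elim g c)
  K-elim g {c} Kc = K-linear true (c g) Kc (Kd g)

  elim-outside : ∀ {g gs c} → Outside (g ∷ gs) c → Outside gs (elim g c)
  elim-outside {g} {gs} {c} out x ex with χ x in χx
  ... | true = inj₁ refl
  ... | false with x ≟ g
  ...   | yes refl = contradiction (trans (cong (λ b → c x xor (c x ∧ b)) (d-self χx))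
                       (trans (cong (c x xor_) (Bool.∧-identityʳ (c x))) (Bool.xor-same (c x))))
                     (true≢false ex)
  ...   | no x≢g = case out x cx of λ where
          (inj₁ χx′)         → contradiction χx (true≢false χx′)
          (inj₂ (here x≡g))  → contradiction x≡g x≢g
          (inj₂ (there x∈))  → inj₂ x∈
    where
    cx : c x ≡ true
    cx = trans (sym (trans (cong (λ b → c x xor (c g ∧ b)) (d-off χx x≢g))
           (trans (cong (c x xor_) (Bool.∧-zeroʳ (c g))) (Bool.xor-identityʳ (c x))))) ex

  -- A dependence inside a proper part of the support is constant on the support by hypothesis, and
  -- zero at a point that the part misses, hence zero altogether.
  minimal⇒circuit : ∀ {c g} → K c → c g ≡ true →
    (∀ {c′} → K c′ → (∀ {x} → c′ x ≡ true → c x ≡ true) →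
      ∃[ b ] (∀ x → c x ≡ true → c′ x ≡ b)) →
    Circuit M ⟦ c ⟧
  minimal⇒circuit {c} {g} Kc cg minimal =
    (λ ind → true≢false cg (vanishes ind Kc (λ x → ∈⟦⟧⁺ {c = c}) g)) , proper
    where
    proper : ∀ D → D ⊂ ⟦ c ⟧ → Indep D
    proper D (D⊆c , w , w∈c , w∉D) = decidable-stable (indep? D) λ dep → go (dep⇒≢0 dep)
      where
      go : ¬ (∃[ c′ ] (K c′ × (∀ j → j ∉ D → c′ j ≡ false) × ∃[ j ] c′ j ≢ false))
      go (c′ , Kc′ , supp , j , c′j) with minimal Kc′ sub
        where
        sub : ∀ {x} → c′ x ≡ true → c x ≡ true
        sub {x} c′x = ∈⟦⟧⁻ {c = c} (D⊆c
          (decidable-stable (x ∈? D) λ x∉ → true≢false c′x (supp x x∉)))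
      ... | b , const = c′j (trans (const j (∈⟦⟧⁻ {c = c} (D⊆c j∈D)))
              (trans (sym (const w (∈⟦⟧⁻ {c = c} w∈c))) (supp w w∉D)))
        where
        j∈D : j ∈ D
        j∈D = decidable-stable (j ∈? D) λ j∉D → c′j (supp j j∉D)

  -- Restrictions on chords from simplicity and the spanning condition

  ∣C∣≤∣circuit∣ : ∀ {X} → Circuit M X → e ∈ X → f ∈ X → ∣ C ∣ ≤ ∣ X ∣
  ∣C∣≤∣circuit∣ {X} circ e∈X f∈X = ℕ.≤-trans (∣p∣≤1+∣p-x∣ C e)
    (∣indep∣<∣spanning-circuit∣ M circ (spanning X circ e∈X f∈X) e∈X (C-x-indep χe))

  -- Otherwise the support would fit into the pair g, u, which is independent.
  two-in-support : ∀ {c g} u → K c → c g ≡ true → ∃[ x ] (c x ≡ true × x ≢ g × x ≢ u)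
  two-in-support {c} {g} u Kc cg
    with any? (λ x → (c x Bool.≟ true) ×-dec ¬? (x ≟ g) ×-dec ¬? (x ≟ u))
  ... | yes p = p
  ... | no ∄x = contradiction (vanishes-on-pair g u Kc pair g) (true≢false cg)
    where
    pair : ∀ x → c x ≡ true → x ≡ g ⊎ x ≡ u
    pair x cx with x ≟ g | x ≟ u
    ... | yes x≡g | _ = inj₁ x≡g
    ... | no _ | yes x≡u = inj₂ x≡u
    ... | no x≢g | no x≢u = contradiction (x , cx , x≢g , x≢u) ∄x

  in-chord : ∀ {g} u → χ g ≡ false → ∃[ x ] (χ x ≡ true × d g x ≡ true × x ≢ u)
  in-chord {g} u χg with two-in-support u (Kd g) (d-self χg)
  ... | x , dx , x≢g , x≢u with d-support dx
  ...   | inj₁ χx = x , χx , dx , x≢u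
  ...   | inj₂ x≡g = contradiction x≡g x≢g

  -- The cycle `χ + d g` plays the part that `d g` plays in `in-chord`, with C - D in place of D.
  out-chord : ∀ {g} u → χ g ≡ false → ∃[ x ] (χ x ≡ true × d g x ≡ false × x ≢ u)
  out-chord {g} u χg with two-in-support {g = g} u (K-xor Kχ (Kd g)) (cong₂ _xor_ χg (d-self χg))
  ... | x , cx , x≢g , x≢u with χ x in χx
  ...   | false = contradiction (d-off χx x≢g) (true≢false cx)
  ...   | true  = x , χx , Bool.not-injective cx , x≢u

  -- Otherwise the sum of the two chords would be supported on the pair g, h.
  distinct : ∀ {g h} → χ g ≡ false → χ h ≡ false → (∀ x → χ x ≡ true → d g x ≡ d h x) → g ≡ h
  distinct {g} {h} χg χh same = decidable-stable (g ≟ h) λ g≢h →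
    true≢false (cong₂ _xor_ (d-self χg) (d-off χg g≢h))
      (vanishes-on-pair g h (K-xor (Kd g) (Kd h)) pair g)
    where
    pair : ∀ x → d g x xor d h x ≡ true → x ≡ g ⊎ x ≡ h
    pair x cx with χ x in χx | x ≟ g | x ≟ h
    ... | _ | yes x≡g | _ = inj₁ x≡g
    ... | _ | no _ | yes x≡h = inj₂ x≡h
    ... | true  | no _ | no _ = contradiction
          (trans (cong (_xor d h x) (same x χx)) (Bool.xor-same (d h x))) (true≢false cx)
    ... | false | no x≢g | no x≢h = contradiction
          (cong₂ _xor_ (d-off χx x≢g) (d-off χx x≢h)) (true≢false cx)

  -- Otherwise C + d g would be a circuit through e and f shorter than C.
  d-e : ∀ {g} → χ g ≡ false → d g e ≡ true
  d-e {g} χg = decidable-stable (d g e Bool.≟ true) (absurd ∘ Bool.¬-not)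
    where
    c : Fin n → Bool
    c x = χ x xor d g x
    cg : c g ≡ true
    cg = cong₂ _xor_ χg (d-self χg)
    absurd : d g e ≢ false
    -- Two points x and y of D are needed: passing from C to c loses both and gains only g.
    absurd dge with in-chord g χg
    ... | x , χx , dx , _ with in-chord x χg
    ...   | y , χy , dy , y≢x = ℕ.<⇒≱ small (∣C∣≤∣circuit∣
      (minimal⇒circuit (K-xor Kχ (Kd g)) cg minimal)
      (∈⟦⟧⁺ {c = c} (cong₂ _xor_ χe dge)) (∈⟦⟧⁺ {c = c} (cong₂ _xor_ χf (d-f g))))
      where
      small : ∣ ⟦ c ⟧ ∣ < ∣ C ∣
      small = ℕ.≤-<-trans (ℕ.≤-trans (p⊆q⇒∣p∣≤∣q∣ sub) (∣p∪⁅x⁆∣≤1+∣p∣ (C - x - y) g))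
        (ℕ.≤-<-trans (x∈p⇒∣p-x∣<∣p∣ (x∈p∧x≢y⇒x∈p-y (χ⇒∈ χy) y≢x)) (x∈p⇒∣p-x∣<∣p∣ (χ⇒∈ χx)))
        where
        sub : ⟦ c ⟧ ⊆ (C - x - y) ∪ ⁅ g ⁆
        sub {z} z∈ with z ≟ g
        ... | yes refl = x∈p∪q⁺ (inj₂ (x∈⁅x⁆ g))
        ... | no z≢g = x∈p∪q⁺ (inj₁ (x∈p∧x≢y⇒x∈p-y (x∈p∧x≢y⇒x∈p-y (χ⇒∈ χz)
                (λ { refl → true≢false cz (cong₂ _xor_ χx dx) }))
                (λ { refl → true≢false cz (cong₂ _xor_ χy dy) })))
          where
          cz : c z ≡ true
          cz = ∈⟦⟧⁻ {c = c} z∈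
          χz : χ z ≡ true
          χz = Bool.¬-not λ χz → true≢false cz (cong₂ _xor_ χz (d-off χz z≢g))

      minimal : ∀ {c′} → K c′ → (∀ {z} → c′ z ≡ true → c z ≡ true) →
                ∃[ b ] (∀ z → c z ≡ true → c′ z ≡ b)
      minimal {c′} Kc′ sub = c′ g , const
        where
        out : Outside (g ∷ []) c′
        out z c′z with χ z in χz | z ≟ g
        ... | true  | _        = inj₁ refl
        ... | false | yes refl = inj₂ (here refl)
        ... | false | no z≢g   =
          contradiction (cong₂ _xor_ χz (d-off χz z≢g)) (true≢false (sub c′z))
        c′x : c′ x ≡ false
        c′x = Bool.¬-not λ c′x → true≢false (sub c′x) (cong₂ _xor_ χx dx)
        -- Clearing g from `c′` leaves a vector constant on C. It is compared at z, where `d g`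
        -- vanishes, and at x, where `c′` vanishes but `d g` does not.
        const : ∀ z → c z ≡ true → c′ z ≡ c′ g
        const z cz with χ z in χz | z ≟ g
        ... | _ | yes refl = refl
        ... | false | no z≢g = contradiction (d-off χz z≢g) (true≢false cz)
        ... | true | no z≢g = begin
          c′ z                      ≡⟨ Bool.xor-identityʳ (c′ z) ⟨
          c′ z xor false            ≡⟨ cong (c′ z xor_) (Bool.∧-zeroʳ (c′ g)) ⟨
          c′ z xor (c′ g ∧ false)   ≡⟨ cong (λ b → c′ z xor (c′ g ∧ b)) (Bool.not-injective cz) ⟨
          elim g c′ z               ≡⟨ constant-on-C (K-elim g Kc′) (elim-outside out) χz χx ⟩
          c′ x xor (c′ g ∧ d g x)   ≡⟨ cong₂ (λ a b → a xor (c′ g ∧ b)) c′x dx ⟩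
          c′ g ∧ true               ≡⟨ Bool.∧-identityʳ (c′ g) ⟩
          c′ g                      ∎
          where open ≡-Reasoning

  -- Otherwise C + d g + d h would be a circuit through e and f shorter than C.
  crossing : ∀ {g h a b x} → χ g ≡ false → χ h ≡ false → χ a ≡ true → χ b ≡ true → χ x ≡ true →
             d g a ≡ true → d h a ≡ false → d g b ≡ false → d h b ≡ true →
             x ≢ a → x ≢ b → d g x ≡ d h x
  crossing {g} {h} {a} {b} {x} χg χh χa χb χx ga ha gb hb x≢a x≢b =
    decidable-stable (d g x Bool.≟ d h x) absurd
    where
    g≢h : g ≢ h
    g≢h refl = true≢false ga ha
    a≢b : a ≢ b
    a≢b refl = true≢false ga gb
    c : Fin n → Bool
    c z = χ z xor (d g z xor d h z)
    Kc : K c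
    Kc = K-xor Kχ (K-xor (Kd g) (Kd h))
    dgh : d g h ≡ false
    dgh = d-off χh (g≢h ∘ sym)
    cg : c g ≡ true
    cg = cong₂ _xor_ χg (cong₂ _xor_ (d-self χg) (d-off χg g≢h))
    ca : c a ≡ false
    ca = cong₂ _xor_ χa (cong₂ _xor_ ga ha)
    cb : c b ≡ false
    cb = cong₂ _xor_ χb (cong₂ _xor_ gb hb)
    c-off : ∀ {z} → χ z ≡ false → z ≢ g → z ≢ h → c z ≡ false
    c-off χz z≢g z≢h = cong₂ _xor_ χz (cong₂ _xor_ (d-off χz z≢g) (d-off χz z≢h))

    absurd : d g x ≢ d h x → _
    absurd gx≢hx = ℕ.<⇒≱ small (∣C∣≤∣circuit∣ (minimal⇒circuit Kc cg minimal)
      (∈⟦⟧⁺ {c = c} (cong₂ _xor_ χe (cong₂ _xor_ (d-e χg) (d-e χh))))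
      (∈⟦⟧⁺ {c = c} (cong₂ _xor_ χf (cong₂ _xor_ (d-f g) (d-f h)))))
      where
      cx : c x ≡ false
      cx = cong₂ _xor_ χx (differ gx≢hx)
        where
        differ : ∀ {u v} → u ≢ v → u xor v ≡ true
        differ {true}  {true}  u≢v = contradiction refl u≢v
        differ {true}  {false} u≢v = refl
        differ {false} {true}  u≢v = refl
        differ {false} {false} u≢v = contradiction refl u≢v

      small : ∣ ⟦ c ⟧ ∣ < ∣ C ∣
      -- The points a, b and x leave C while only g and h join it.
      small = ℕ.≤-<-trans
        (ℕ.≤-trans (p⊆q⇒∣p∣≤∣q∣ sub)
          (ℕ.≤-trans (∣p∪⁅x⁆∣≤1+∣p∣ ((C - a - b - x) ∪ ⁅ g ⁆) h)
            (s≤s (∣p∪⁅x⁆∣≤1+∣p∣ (C - a - b - x) g))))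
        (ℕ.≤-<-trans (s≤s (x∈p⇒∣p-x∣<∣p∣ x∈C-a-b))
          (ℕ.≤-<-trans (x∈p⇒∣p-x∣<∣p∣ b∈C-a) (x∈p⇒∣p-x∣<∣p∣ (χ⇒∈ χa))))
        where
        b∈C-a : b ∈ C - a
        b∈C-a = x∈p∧x≢y⇒x∈p-y (χ⇒∈ χb) (a≢b ∘ sym)
        x∈C-a-b : x ∈ C - a - b
        x∈C-a-b = x∈p∧x≢y⇒x∈p-y (x∈p∧x≢y⇒x∈p-y (χ⇒∈ χx) x≢a) x≢b
        sub : ⟦ c ⟧ ⊆ ((C - a - b - x) ∪ ⁅ g ⁆) ∪ ⁅ h ⁆
        sub {z} z∈ with z ≟ g | z ≟ h
        ... | _ | yes refl = x∈p∪q⁺ (inj₂ (x∈⁅x⁆ h))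
        ... | yes refl | no _ = x∈p∪q⁺ (inj₁ (x∈p∪q⁺ (inj₂ (x∈⁅x⁆ g))))
        ... | no z≢g | no z≢h = x∈p∪q⁺ (inj₁ (x∈p∪q⁺ (inj₁
                (x∈p∧x≢y⇒x∈p-y (x∈p∧x≢y⇒x∈p-y (x∈p∧x≢y⇒x∈p-y (χ⇒∈ χz)
                  (λ { refl → true≢false cz ca }))
                  (λ { refl → true≢false cz cb }))
                  (λ { refl → true≢false cz cx })))))
          where
          cz : c z ≡ true
          cz = ∈⟦⟧⁻ {c = c} z∈
          χz : χ z ≡ true
          χz = Bool.¬-not λ χz → true≢false cz (c-off χz z≢g z≢h)

      minimal : ∀ {c′} → K c′ → (∀ {z} → c′ z ≡ true → c z ≡ true) →
                ∃[ b ] (∀ z → c z ≡ true → c′ z ≡ b)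
      minimal {c′} Kc′ sub = c′ g , const
        where
        c″ : Fin n → Bool
        c″ = elim h (elim g c′)
        c″≡ : ∀ z → c″ z ≡ (c′ z xor (c′ g ∧ d g z)) xor (c′ h ∧ d h z)
        c″≡ z = cong (λ u → (c′ z xor (c′ g ∧ d g z)) xor (u ∧ d h z))
          (trans (cong (λ u → c′ h xor (c′ g ∧ u)) dgh)
            (trans (cong (c′ h xor_) (Bool.∧-zeroʳ (c′ g))) (Bool.xor-identityʳ (c′ h))))
        out : Outside (g ∷ h ∷ []) c′
        out z c′z with χ z in χz | z ≟ g | z ≟ h
        ... | true  | _        | _        = inj₁ refl
        ... | false | yes refl | _        = inj₂ (here refl)
        ... | false | no _     | yes refl = inj₂ (there (here refl))
        ... | false | no z≢g   | no z≢h   =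
          contradiction (c-off χz z≢g z≢h) (true≢false (sub c′z))
        same : ∀ {y z} → χ y ≡ true → χ z ≡ true → c″ y ≡ c″ z
        same = constant-on-C (K-elim h (K-elim g Kc′)) (elim-outside (elim-outside out))
        c′-off : ∀ {z} → c z ≡ false → c′ z ≡ false
        c′-off cz = Bool.¬-not λ c′z → true≢false (sub c′z) cz
        c″-value : ∀ z {u v w} → c′ z ≡ u → d g z ≡ v → d h z ≡ w →
                   c″ z ≡ (u xor (c′ g ∧ v)) xor (c′ h ∧ w)
        c″-value z refl refl refl = c″≡ z
        c″a : c″ a ≡ c′ g
        c″a = trans (c″-value a (c′-off ca) ga ha) (drop (c′ g) (c′ h))
          where
          drop : ∀ u v → (u ∧ true) xor (v ∧ false) ≡ u
          drop false false = refl
          drop false true  = refl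
          drop true  false = refl
          drop true  true  = refl
        c″b : c″ b ≡ c′ h
        c″b = trans (c″-value b (c′-off cb) gb hb) (drop (c′ g) (c′ h))
          where
          drop : ∀ u v → (u ∧ false) xor (v ∧ true) ≡ v
          drop false false = refl
          drop false true  = refl
          drop true  false = refl
          drop true  true  = refl
        -- The vector `c″` is constant on C. Its value is `c′ g` at a and `c′ h` at b, so these two
        -- agree; at any other z of C in the support of c both chords take the same value, so their
        -- contributions cancel and leave `c′ z`.
        const : ∀ z → c z ≡ true → c′ z ≡ c′ g
        const z cz with z ≟ g | z ≟ h
        ... | yes refl | _        = refl
        ... | no _     | yes refl = trans (sym c″b) (trans (same χb χa) c″a)
        ... | no z≢g   | no z≢h with χ z in χz
        ...   | false = contradiction (cong₂ _xor_ (d-off χz z≢g) (d-off χz z≢h)) (true≢false cz)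
        ...   | true  = cancel (c′ z) (d g z) (d h z) (c′ g) cz
                (trans (cong (λ u → (c′ z xor (c′ g ∧ d g z)) xor (u ∧ d h z))
                         (trans (sym c″a) (trans (same χa χb) c″b)))
                  (trans (sym (c″≡ z)) (trans (same χz χa) c″a)))
          where
          cancel : ∀ u v w t → true xor (v xor w) ≡ true →
                   (u xor (t ∧ v)) xor (t ∧ w) ≡ t → u ≡ t
          cancel u false false t    _ eq = cancel₀ u t eq
            where
            cancel₀ : ∀ u t → (u xor (t ∧ false)) xor (t ∧ false) ≡ t → u ≡ t
            cancel₀ false false _ = refl
            cancel₀ true  true  _ = refl
          cancel false true true false _ _ = refl
          cancel true  true true true  _ _ = refl

  -- Ternary dependences on C and its chords

  open Kernel ker₃ using ()
    renaming (K to Kᵗ; K-linear to Kᵗ-linear; indep⇒0 to indep⇒0ᵗ; dep⇒≢0 to dep⇒≢0ᵗ)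

  vanishesᵗ : ∀ {I c} → Indep I → Kᵗ c → (∀ x → c x ≢ 0F → x ∈ I) → ∀ x → c x ≡ 0F
  vanishesᵗ ind Kc supp = indep⇒0ᵗ ind Kc λ x x∉I →
    decidable-stable (_ ≟ 0F) λ cx≢0 → x∉I (supp x cx≢0)

  vanishes-at⇒zeroᵗ : ∀ {c y} → Kᵗ c → (∀ x → χ x ≡ false → c x ≡ 0F) → χ y ≡ true → c y ≡ 0F →
                      ∀ x → c x ≡ 0F
  vanishes-at⇒zeroᵗ {c} Kc out χy cy = vanishesᵗ (C-x-indep χy) Kc λ x cx≢0 →
    x∈p∧x≢y⇒x∈p-y (χ⇒∈ (Bool.¬-not (cx≢0 ∘ out x))) λ { refl → cx≢0 cy }

  -- The two representations communicate through the matroid alone: the support of a nonzero binary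
  -- cycle is dependent, and a dependent set carries a ternary vector.
  dependentᵗ : ∀ {c g} → K c → c g ≡ true →
    ∃[ k ] (Kᵗ k × (∀ x → c x ≡ false → k x ≡ 0F) × ∃[ j ] k j ≢ 0F)
  dependentᵗ {c} {g} Kc cg with dep⇒≢0ᵗ {⟦ c ⟧} (λ ind →
    true≢false cg (vanishes ind Kc (λ x → ∈⟦⟧⁺ {c = c}) g))
  ... | k , Kk , supp , nonzero =
    k , Kk , (λ x cx → supp x λ x∈ → true≢false (∈⟦⟧⁻ {c = c} x∈) cx) , nonzero

  private
    κ-vector : ∃[ k ] (Kᵗ k × (∀ x → χ x ≡ false → k x ≡ 0F) × ∃[ j ] k j ≢ 0F)
    κ-vector = dependentᵗ Kχ χe

  -- The ternary counterpart of χ, nonzero on all of C but with unknown signs. Expressing other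
  -- vectors on C as multiples of κ absorbs these signs.
  κ : Fin n → Fin 3
  κ = proj₁ κ-vector

  Kκ : Kᵗ κ
  Kκ = proj₁ (proj₂ κ-vector)

  κ-off : ∀ x → χ x ≡ false → κ x ≡ 0F
  κ-off = proj₁ (proj₂ (proj₂ κ-vector))

  κ≢0 : ∀ {x} → χ x ≡ true → κ x ≢ 0F
  κ≢0 χx κx≡0 = proj₂ (proj₂ (proj₂ (proj₂ κ-vector))) (vanishes-at⇒zeroᵗ Kκ κ-off χx κx≡0 _)

  multiple-of-κ : ∀ {c} → Kᵗ c → (∀ x → χ x ≡ false → c x ≡ 0F) → ∃[ ν ] (∀ x → c x ≡ ν *₃ κ x)
  multiple-of-κ {c} Kc out = ν , λ x → difference (c x) (κ x) ν (vanishes-at⇒zeroᵗ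
      (Kᵗ-linear 1F (2F *₃ ν) Kc Kκ)
      (λ y χy → trans (cong₂ (λ u v → u +₃ 2F *₃ ν *₃ v) (out y χy) (κ-off y χy)) (zeros ν))
      χf (at-f (c f) (κ f) (κ≢0 χf)) x)
    where
    -- Nonzero elements of 𝔽₃ are their own inverses, so this is the quotient of `c f` by `κ f`. The
    -- scalar 2F below is -1.
    ν = c f *₃ κ f
    zeros : ∀ ν → 2F *₃ ν *₃ 0F ≡ 0F
    zeros = toWitness {a? = all? λ ν → (2F *₃ ν *₃ 0F) ≟ 0F} _
    at-f : ∀ u v → v ≢ 0F → u +₃ 2F *₃ (u *₃ v) *₃ v ≡ 0F
    at-f = toWitness {a? = all? λ u → all? λ v → ¬? (v ≟ 0F) →-dec
             ((u +₃ 2F *₃ (u *₃ v) *₃ v) ≟ 0F)} _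
    difference : ∀ u v ν → u +₃ 2F *₃ ν *₃ v ≡ 0F → u ≡ ν *₃ v
    difference = toWitness {a? = all? λ u → all? λ v → all? λ ν →
             ((u +₃ 2F *₃ ν *₃ v) ≟ 0F) →-dec (u ≟ ν *₃ v)} _

  -- The two ternary cycles through g and one side of C differ by a multiple of κ off g, so each of
  -- them is a multiple of κ on its side.
  chordᵗ : ∀ {g} → χ g ≡ false →
    ∃[ k ] (Kᵗ k × k g ≡ 1F × (∀ {x} → χ x ≡ false → x ≢ g → k x ≡ 0F) ×
            ∃[ μ ] (μ ≢ 0F × (∀ {x} → χ x ≡ true → k x ≡ (μ when d g x) *₃ κ x)))
  chordᵗ {g} χg
    with dependentᵗ (Kd g) (d-self χg)
       | dependentᵗ {g = g} (K-xor Kχ (Kd g)) (cong₂ _xor_ χg (d-self χg))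
  ... | k , Kk , supp , i , ki≢0 | k′ , Kk′ , supp′ , j , k′j≢0 =
    k̂ , Kᵗ-linear u 0F Kk Kk , square u u≢0 , off , μ , μ≢0 , on
    where
    u = k g
    v = k′ g
    k-off : ∀ {x} → χ x ≡ false → x ≢ g → k x ≡ 0F
    k-off χx x≢g = supp _ (d-off χx x≢g)
    k′-off : ∀ {x} → χ x ≡ false → x ≢ g → k′ x ≡ 0F
    k′-off χx x≢g = supp′ _ (cong₂ _xor_ χx (d-off χx x≢g))
    -- Without g, the vector k would live on C and vanish at f; in the same way `k′` would live on C
    -- and vanish at e.
    u≢0 : u ≢ 0F
    u≢0 u≡0 = ki≢0 (vanishes-at⇒zeroᵗ Kk out χf (supp f (d-f g)) i)
      where
      out : ∀ x → χ x ≡ false → k x ≡ 0F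
      out x χx with x ≟ g
      ... | yes refl = u≡0
      ... | no x≢g   = k-off χx x≢g
    v≢0 : v ≢ 0F
    v≢0 v≡0 = k′j≢0 (vanishes-at⇒zeroᵗ Kk′ out χe (supp′ e (cong₂ _xor_ χe (d-e χg))) j)
      where
      out : ∀ x → χ x ≡ false → k′ x ≡ 0F
      out x χx with x ≟ g
      ... | yes refl = v≡0
      ... | no x≢g   = k′-off χx x≢g

    difference : ∃[ ν ] (∀ x → v *₃ k x +₃ 2F *₃ u *₃ k′ x ≡ ν *₃ κ x)
    difference = multiple-of-κ (Kᵗ-linear v (2F *₃ u) Kk Kk′) out
      where
      cancel : ∀ u v → v *₃ u +₃ 2F *₃ u *₃ v ≡ 0F
      cancel = toWitness {a? = all? λ u → all? λ v → (v *₃ u +₃ 2F *₃ u *₃ v) ≟ 0F} _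
      zeros : ∀ u v → v *₃ 0F +₃ 2F *₃ u *₃ 0F ≡ 0F
      zeros = toWitness {a? = all? λ u → all? λ v → (v *₃ 0F +₃ 2F *₃ u *₃ 0F) ≟ 0F} _
      out : ∀ x → χ x ≡ false → v *₃ k x +₃ 2F *₃ u *₃ k′ x ≡ 0F
      out x χx with x ≟ g
      ... | yes refl = cancel u v
      ... | no x≢g   = trans
        (cong₂ (λ a b → v *₃ a +₃ 2F *₃ u *₃ b) (k-off χx x≢g) (k′-off χx x≢g)) (zeros u v)
    ν = proj₁ difference

    k̂ : Fin n → Fin 3
    k̂ x = u *₃ k x +₃ 0F
    -- On D the vector `k′` vanishes, so `v *₃ k x` equals `ν *₃ κ x`. Multiplying by v, its own
    -- inverse, and by u, which normalises the value at g to 1F, gives this factor.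
    μ = u *₃ v *₃ ν
    square : ∀ u → u ≢ 0F → u *₃ u +₃ 0F ≡ 1F
    square = toWitness {a? = all? λ u → ¬? (u ≟ 0F) →-dec ((u *₃ u +₃ 0F) ≟ 1F)} _
    zero-case : ∀ u → u *₃ 0F +₃ 0F ≡ 0F
    zero-case = toWitness {a? = all? λ u → (u *₃ 0F +₃ 0F) ≟ 0F} _
    off : ∀ {x} → χ x ≡ false → x ≢ g → k̂ x ≡ 0F
    off χx x≢g = trans (cong (λ a → u *₃ a +₃ 0F) (k-off χx x≢g)) (zero-case u)
    rescale : ∀ u v w ν z → v ≢ 0F → v *₃ w +₃ 2F *₃ u *₃ 0F ≡ ν *₃ z →
              u *₃ w +₃ 0F ≡ u *₃ v *₃ ν *₃ z
    rescale = toWitness {a? = all? λ u → all? λ v → all? λ w → all? λ ν → all? λ z →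
      ¬? (v ≟ 0F) →-dec (((v *₃ w +₃ 2F *₃ u *₃ 0F) ≟ ν *₃ z) →-dec
      ((u *₃ w +₃ 0F) ≟ (u *₃ v *₃ ν *₃ z)))} _
    on : ∀ {x} → χ x ≡ true → k̂ x ≡ (μ when d g x) *₃ κ x
    on {x} χx with d g x in dx
    ... | false = trans (cong (λ a → u *₃ a +₃ 0F) (supp x dx)) (zero-case u)
    ... | true  = rescale u v (k x) ν (κ x) v≢0
      (trans (cong (λ a → v *₃ k x +₃ 2F *₃ u *₃ a) (sym (supp′ x (cong₂ _xor_ χx dx))))
        (proj₂ difference x))
    μ≢0 : μ ≢ 0F
    -- With μ zero the vector would be supported on g alone, making g a loop.
    μ≢0 μ≡0 = contradiction (trans (sym (square u u≢0)) (vanishesᵗ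
      (simple⇒pair-indep M simple g g) (Kᵗ-linear u 0F Kk Kk) only-g g)) λ ()
      where
      on-C : ∀ {x} → χ x ≡ true → k̂ x ≡ 0F
      on-C {x} χx = trans (on χx) (zero-when (d g x))
        where
        zero-when : ∀ b → (μ when b) *₃ κ x ≡ 0F
        zero-when false = refl
        zero-when true  = cong (_*₃ κ x) μ≡0
      only-g : ∀ x → k̂ x ≢ 0F → x ∈ ⁅ g ⁆ ∪ ⁅ g ⁆
      only-g x k̂x≢0 with χ x in χx | x ≟ g
      ... | true  | _        = contradiction (on-C χx) k̂x≢0
      ... | false | no x≢g   = contradiction (off χx x≢g) k̂x≢0
      ... | false | yes refl = x∈p∪q⁺ (inj₁ (x∈⁅x⁆ x))

  -- The support of the binary cycle t carries a ternary dependence, which involves C and the three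
  -- chords with weights ν and pᵢ; it must vanish at the points of C that t avoids.
  three-chords : ∀ {g₁ g₂ g₃ t} → χ g₁ ≡ false → χ g₂ ≡ false → χ g₃ ≡ false →
    g₁ ≢ g₂ → g₁ ≢ g₃ → g₂ ≢ g₃ → K t → t g₁ ≡ true →
    (∀ {x} → χ x ≡ false → x ≢ g₁ → x ≢ g₂ → x ≢ g₃ → t x ≡ false) →
    ∃[ ν ] ∃[ p₁ ] ∃[ p₂ ] ∃[ p₃ ]
      ((∀ {x} → χ x ≡ true → t x ≡ false →
         p₁ when d g₁ x +₃ p₂ when d g₂ x +₃ p₃ when d g₃ x ≡ ν) ×
       ¬ (ν ≡ 0F × p₁ ≡ 0F × p₂ ≡ 0F × p₃ ≡ 0F))
  three-chords {g₁} {g₂} {g₃} {t} χ₁ χ₂ χ₃ g₁≢g₂ g₁≢g₃ g₂≢g₃ Kt tg₁ t-off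
    with dependentᵗ Kt tg₁ | chordᵗ χ₁ | chordᵗ χ₂ | chordᵗ χ₃
  ... | k , Kk , supp , j , kj≢0
      | k₁ , Kk₁ , one₁ , off₁ , μ₁ , μ₁≢0 , on₁
      | k₂ , Kk₂ , one₂ , off₂ , μ₂ , μ₂≢0 , on₂
      | k₃ , Kk₃ , one₃ , off₃ , μ₃ , μ₃≢0 , on₃ =
    ν , p μ₁ (k g₁) , p μ₂ (k g₂) , p μ₃ (k g₃) , relation , nontrivial
    where
    p : Fin 3 → Fin 3 → Fin 3
    p μ λ′ = 2F *₃ λ′ *₃ μ
    -- Subtracting `k gᵢ` times the i-th chord vector clears all three chords, so what is left is a
    -- multiple of κ. Where t vanishes on C so does k, and cancelling κ gives the relation with
    -- weights p.
    l : Fin n → Fin 3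
    l x = k x +₃ 2F *₃ k g₁ *₃ k₁ x +₃ 2F *₃ k g₂ *₃ k₂ x +₃ 2F *₃ k g₃ *₃ k₃ x
    combine : ∀ {x a a₁ a₂ a₃} → k x ≡ a → k₁ x ≡ a₁ → k₂ x ≡ a₂ → k₃ x ≡ a₃ →
              l x ≡ a +₃ 2F *₃ k g₁ *₃ a₁ +₃ 2F *₃ k g₂ *₃ a₂ +₃ 2F *₃ k g₃ *₃ a₃
    combine refl refl refl refl = refl
    at₀ : ∀ λ₁ λ₂ λ₃ → 0F +₃ 2F *₃ λ₁ *₃ 0F +₃ 2F *₃ λ₂ *₃ 0F +₃ 2F *₃ λ₃ *₃ 0F ≡ 0F
    at₀ = toWitness {a? = all? λ λ₁ → all? λ λ₂ → all? λ λ₃ →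
      (0F +₃ 2F *₃ λ₁ *₃ 0F +₃ 2F *₃ λ₂ *₃ 0F +₃ 2F *₃ λ₃ *₃ 0F) ≟ 0F} _
    at₁ : ∀ λ₁ λ₂ λ₃ → λ₁ +₃ 2F *₃ λ₁ *₃ 1F +₃ 2F *₃ λ₂ *₃ 0F +₃ 2F *₃ λ₃ *₃ 0F ≡ 0F
    at₁ = toWitness {a? = all? λ λ₁ → all? λ λ₂ → all? λ λ₃ →
      (λ₁ +₃ 2F *₃ λ₁ *₃ 1F +₃ 2F *₃ λ₂ *₃ 0F +₃ 2F *₃ λ₃ *₃ 0F) ≟ 0F} _
    at₂ : ∀ λ₁ λ₂ λ₃ → λ₂ +₃ 2F *₃ λ₁ *₃ 0F +₃ 2F *₃ λ₂ *₃ 1F +₃ 2F *₃ λ₃ *₃ 0F ≡ 0F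
    at₂ = toWitness {a? = all? λ λ₁ → all? λ λ₂ → all? λ λ₃ →
      (λ₂ +₃ 2F *₃ λ₁ *₃ 0F +₃ 2F *₃ λ₂ *₃ 1F +₃ 2F *₃ λ₃ *₃ 0F) ≟ 0F} _
    at₃ : ∀ λ₁ λ₂ λ₃ → λ₃ +₃ 2F *₃ λ₁ *₃ 0F +₃ 2F *₃ λ₂ *₃ 0F +₃ 2F *₃ λ₃ *₃ 1F ≡ 0F
    at₃ = toWitness {a? = all? λ λ₁ → all? λ λ₂ → all? λ λ₃ →
      (λ₃ +₃ 2F *₃ λ₁ *₃ 0F +₃ 2F *₃ λ₂ *₃ 0F +₃ 2F *₃ λ₃ *₃ 1F) ≟ 0F} _
    out : ∀ x → χ x ≡ false → l x ≡ 0F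
    out x χx with x ≟ g₁ | x ≟ g₂ | x ≟ g₃
    ... | yes refl | _ | _ = trans
      (combine refl one₁ (off₂ χx g₁≢g₂) (off₃ χx g₁≢g₃)) (at₁ (k g₁) (k g₂) (k g₃))
    ... | no x≢g₁ | yes refl | _ = trans
      (combine refl (off₁ χx x≢g₁) one₂ (off₃ χx g₂≢g₃)) (at₂ (k g₁) (k g₂) (k g₃))
    ... | no x≢g₁ | no x≢g₂ | yes refl = trans
      (combine refl (off₁ χx x≢g₁) (off₂ χx x≢g₂) one₃) (at₃ (k g₁) (k g₂) (k g₃))
    ... | no x≢g₁ | no x≢g₂ | no x≢g₃ = trans
      (combine (supp x (t-off χx x≢g₁ x≢g₂ x≢g₃)) (off₁ χx x≢g₁) (off₂ χx x≢g₂) (off₃ χx x≢g₃))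
      (at₀ (k g₁) (k g₂) (k g₃))
    multiple : ∃[ ν ] (∀ x → l x ≡ ν *₃ κ x)
    multiple = multiple-of-κ (Kᵗ-linear 1F (2F *₃ k g₃)
      (Kᵗ-linear 1F (2F *₃ k g₂) (Kᵗ-linear 1F (2F *₃ k g₁) Kk Kk₁) Kk₂) Kk₃) out
    ν = proj₁ multiple

    pull : ∀ λ′ μ b z → 2F *₃ λ′ *₃ ((μ when b) *₃ z) ≡ (p μ λ′ when b) *₃ z
    pull λ′ μ true z = pull-true λ′ μ z
      where
      pull-true : ∀ λ′ μ z → 2F *₃ λ′ *₃ (μ *₃ z) ≡ 2F *₃ λ′ *₃ μ *₃ z
      pull-true = toWitness {a? = all? λ λ′ → all? λ μ → all? λ z →
        (2F *₃ λ′ *₃ (μ *₃ z)) ≟ (2F *₃ λ′ *₃ μ *₃ z)} _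
    pull λ′ μ false z = *-zeroʳ (2F *₃ λ′)
      where
      *-zeroʳ : ∀ u → u *₃ 0F ≡ 0F
      *-zeroʳ = toWitness {a? = all? λ u → (u *₃ 0F) ≟ 0F} _
    cancel : ∀ q₁ q₂ q₃ ν z → z ≢ 0F → q₁ *₃ z +₃ q₂ *₃ z +₃ q₃ *₃ z ≡ ν *₃ z →
             q₁ +₃ q₂ +₃ q₃ ≡ ν
    cancel = toWitness {a? = all? λ q₁ → all? λ q₂ → all? λ q₃ → all? λ ν → all? λ z →
      ¬? (z ≟ 0F) →-dec (((q₁ *₃ z +₃ q₂ *₃ z +₃ q₃ *₃ z) ≟ ν *₃ z) →-dec
      ((q₁ +₃ q₂ +₃ q₃) ≟ ν))} _
    relation : ∀ {x} → χ x ≡ true → t x ≡ false →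
      p μ₁ (k g₁) when d g₁ x +₃ p μ₂ (k g₂) when d g₂ x +₃ p μ₃ (k g₃) when d g₃ x ≡ ν
    relation {x} χx tx = cancel
      (p μ₁ (k g₁) when d g₁ x) (p μ₂ (k g₂) when d g₂ x) (p μ₃ (k g₃) when d g₃ x) ν (κ x) (κ≢0 χx)
      (trans
      (sym (trans (combine (supp x tx) (on₁ χx) (on₂ χx) (on₃ χx))
        (cong₂ _+₃_ (cong₂ _+₃_ (pull (k g₁) μ₁ (d g₁ x) (κ x)) (pull (k g₂) μ₂ (d g₂ x) (κ x)))
          (pull (k g₃) μ₃ (d g₃ x) (κ x)))))
      (proj₂ multiple x))

    nontrivial : ¬ (ν ≡ 0F × p μ₁ (k g₁) ≡ 0F × p μ₂ (k g₂) ≡ 0F × p μ₃ (k g₃) ≡ 0F)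
    -- If all weights vanished, l would be zero and equal to k.
    nontrivial (ν≡0 , p₁≡0 , p₂≡0 , p₃≡0) = kj≢0 (trans (sym (trans
        (congᵗ (nonzero (k g₁) μ₁ μ₁≢0 p₁≡0) (nonzero (k g₂) μ₂ μ₂≢0 p₂≡0)
          (nonzero (k g₃) μ₃ μ₃≢0 p₃≡0))
        (drop-zeros (k j))))
      (trans (proj₂ multiple j) (cong (_*₃ κ j) ν≡0)))
      where
      nonzero : ∀ λ′ μ → μ ≢ 0F → 2F *₃ λ′ *₃ μ ≡ 0F → λ′ ≡ 0F
      nonzero = toWitness {a? = all? λ λ′ → all? λ μ → ¬? (μ ≟ 0F) →-dec
        (((2F *₃ λ′ *₃ μ) ≟ 0F) →-dec (λ′ ≟ 0F))} _
      drop-zeros : ∀ u → u +₃ 0F +₃ 0F +₃ 0F ≡ u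
      drop-zeros = toWitness {a? = all? λ u → (u +₃ 0F +₃ 0F +₃ 0F) ≟ u} _
      congᵗ : k g₁ ≡ 0F → k g₂ ≡ 0F → k g₃ ≡ 0F → l j ≡ k j +₃ 0F +₃ 0F +₃ 0F
      congᵗ e₁ e₂ e₃ = congruent e₁ e₂ e₃
        where
        congruent : ∀ {a b c} → a ≡ 0F → b ≡ 0F → c ≡ 0F →
          k j +₃ 2F *₃ a *₃ k₁ j +₃ 2F *₃ b *₃ k₂ j +₃ 2F *₃ c *₃ k₃ j ≡ k j +₃ 0F +₃ 0F +₃ 0F
        congruent refl refl refl = refl

  -- On e, a, b, c the circuit C and the three chords read 1111, 1100, 1010, 1001: a determinant ±2,
  -- so zero over 𝔽₂ but not over 𝔽₃.
  no-three-private : ∀ {g₁ g₂ g₃ a b c} → χ g₁ ≡ false → χ g₂ ≡ false → χ g₃ ≡ false →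
    χ a ≡ true → χ b ≡ true → χ c ≡ true →
    d g₁ a ≡ true  → d g₂ a ≡ false → d g₃ a ≡ false →
    d g₁ b ≡ false → d g₂ b ≡ true  → d g₃ b ≡ false →
    d g₁ c ≡ false → d g₂ c ≡ false → ¬ d g₃ c ≡ true
  no-three-private {g₁} {g₂} {g₃} {a} {b} {c} χ₁ χ₂ χ₃ χa χb χc a₁ a₂ a₃ b₁ b₂ b₃ c₁ c₂ c₃
    = conclude (three-chords {t = λ x → χ x xor (d g₁ x xor (d g₂ x xor d g₃ x))} χ₁ χ₂ χ₃
      g₁≢g₂ g₁≢g₃ g₂≢g₃ (K-xor Kχ (K-xor (Kd g₁) (K-xor (Kd g₂) (Kd g₃))))
      (xor₃ χ₁ (d-self χ₁) (d-off χ₁ g₁≢g₂) (d-off χ₁ g₁≢g₃))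
      (λ χx x≢g₁ x≢g₂ x≢g₃ → xor₃ χx (d-off χx x≢g₁) (d-off χx x≢g₂) (d-off χx x≢g₃)))
    where
    g₁≢g₂ : g₁ ≢ g₂
    g₁≢g₂ refl = true≢false a₁ a₂
    g₁≢g₃ : g₁ ≢ g₃
    g₁≢g₃ refl = true≢false a₁ a₃
    g₂≢g₃ : g₂ ≢ g₃
    g₂≢g₃ refl = true≢false b₂ b₃
    xor₃ : ∀ {x p q r s} → χ x ≡ p → d g₁ x ≡ q → d g₂ x ≡ r → d g₃ x ≡ s →
           χ x xor (d g₁ x xor (d g₂ x xor d g₃ x)) ≡ p xor (q xor (r xor s))
    xor₃ refl refl refl refl = refl
    Relation : (ν p₁ p₂ p₃ : Fin 3) → Set
    Relation ν p₁ p₂ p₃ = ∀ {x} → χ x ≡ true → χ x xor (d g₁ x xor (d g₂ x xor d g₃ x)) ≡ false →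
      p₁ when d g₁ x +₃ p₂ when d g₂ x +₃ p₃ when d g₃ x ≡ ν
    solve : ∀ ν p₁ p₂ p₃ → p₁ +₃ p₂ +₃ p₃ ≡ ν → p₁ +₃ 0F +₃ 0F ≡ ν → 0F +₃ p₂ +₃ 0F ≡ ν →
            0F +₃ 0F +₃ p₃ ≡ ν → ν ≡ 0F × p₁ ≡ 0F × p₂ ≡ 0F × p₃ ≡ 0F
    solve = toWitness {a? = all? λ ν → all? λ p₁ → all? λ p₂ → all? λ p₃ →
      ((p₁ +₃ p₂ +₃ p₃) ≟ ν) →-dec (((p₁ +₃ 0F +₃ 0F) ≟ ν) →-dec (((0F +₃ p₂ +₃ 0F) ≟ ν) →-dec
      (((0F +₃ 0F +₃ p₃) ≟ ν) →-dec
      ((ν ≟ 0F) ×-dec (p₁ ≟ 0F) ×-dec (p₂ ≟ 0F) ×-dec (p₃ ≟ 0F)))))} _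
    conclude : ¬ (∃[ ν ] ∃[ p₁ ] ∃[ p₂ ] ∃[ p₃ ] (Relation ν p₁ p₂ p₃ ×
      ¬ (ν ≡ 0F × p₁ ≡ 0F × p₂ ≡ 0F × p₃ ≡ 0F)))
    conclude (ν , p₁ , p₂ , p₃ , relation , nontrivial) = nontrivial (solve ν p₁ p₂ p₃
      (at χe (d-e χ₁) (d-e χ₂) (d-e χ₃) refl) (at χa a₁ a₂ a₃ refl) (at χb b₁ b₂ b₃ refl)
      (at χc c₁ c₂ c₃ refl))
      where
        at : ∀ {x q r s} → χ x ≡ true → d g₁ x ≡ q → d g₂ x ≡ r → d g₃ x ≡ s →
             true xor (q xor (r xor s)) ≡ false → p₁ when q +₃ p₂ when r +₃ p₃ when s ≡ ν
        at {x} χx refl refl refl even = relation χx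
          (trans (cong (_xor (d g₁ x xor (d g₂ x xor d g₃ x))) χx) even)

  -- The mirror image of `no-three-private` under exchanging e and f: the complements C - D then
  -- have the private points. On f, a, b, c the chords read 000, 011, 101, 110, so ν is zero and the
  -- weights sum to zero in pairs, which over 𝔽₃ forces them all to vanish.
  no-three-missing : ∀ {g₁ g₂ g₃ a b c} → χ g₁ ≡ false → χ g₂ ≡ false → χ g₃ ≡ false →
    χ a ≡ true → χ b ≡ true → χ c ≡ true →
    d g₁ a ≡ false → d g₂ a ≡ true  → d g₃ a ≡ true →
    d g₁ b ≡ true  → d g₂ b ≡ false → d g₃ b ≡ true →
    d g₁ c ≡ true  → d g₂ c ≡ true  → ¬ d g₃ c ≡ false
  no-three-missing {g₁} {g₂} {g₃} {a} {b} {c} χ₁ χ₂ χ₃ χa χb χc a₁ a₂ a₃ b₁ b₂ b₃ c₁ c₂ c₃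
    = conclude (three-chords {t = λ x → d g₁ x xor (d g₂ x xor d g₃ x)} χ₁ χ₂ χ₃
      g₁≢g₂ g₁≢g₃ g₂≢g₃ (K-xor (Kd g₁) (K-xor (Kd g₂) (Kd g₃)))
      (xor₃ (d-self χ₁) (d-off χ₁ g₁≢g₂) (d-off χ₁ g₁≢g₃))
      (λ χx x≢g₁ x≢g₂ x≢g₃ → xor₃ (d-off χx x≢g₁) (d-off χx x≢g₂) (d-off χx x≢g₃)))
    where
    g₁≢g₂ : g₁ ≢ g₂
    g₁≢g₂ refl = true≢false a₂ a₁
    g₁≢g₃ : g₁ ≢ g₃
    g₁≢g₃ refl = true≢false a₃ a₁
    g₂≢g₃ : g₂ ≢ g₃
    g₂≢g₃ refl = true≢false b₃ b₂
    xor₃ : ∀ {x q r s} → d g₁ x ≡ q → d g₂ x ≡ r → d g₃ x ≡ s →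
           d g₁ x xor (d g₂ x xor d g₃ x) ≡ q xor (r xor s)
    xor₃ refl refl refl = refl
    Relation : (ν p₁ p₂ p₃ : Fin 3) → Set
    Relation ν p₁ p₂ p₃ = ∀ {x} → χ x ≡ true → d g₁ x xor (d g₂ x xor d g₃ x) ≡ false →
      p₁ when d g₁ x +₃ p₂ when d g₂ x +₃ p₃ when d g₃ x ≡ ν
    solve : ∀ ν p₁ p₂ p₃ → 0F ≡ ν → 0F +₃ p₂ +₃ p₃ ≡ ν → p₁ +₃ 0F +₃ p₃ ≡ ν →
            p₁ +₃ p₂ +₃ 0F ≡ ν → ν ≡ 0F × p₁ ≡ 0F × p₂ ≡ 0F × p₃ ≡ 0F
    solve = toWitness {a? = all? λ ν → all? λ p₁ → all? λ p₂ → all? λ p₃ →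
      (0F ≟ ν) →-dec (((0F +₃ p₂ +₃ p₃) ≟ ν) →-dec (((p₁ +₃ 0F +₃ p₃) ≟ ν) →-dec
      (((p₁ +₃ p₂ +₃ 0F) ≟ ν) →-dec
      ((ν ≟ 0F) ×-dec (p₁ ≟ 0F) ×-dec (p₂ ≟ 0F) ×-dec (p₃ ≟ 0F)))))} _
    conclude : ¬ (∃[ ν ] ∃[ p₁ ] ∃[ p₂ ] ∃[ p₃ ] (Relation ν p₁ p₂ p₃ ×
      ¬ (ν ≡ 0F × p₁ ≡ 0F × p₂ ≡ 0F × p₃ ≡ 0F)))
    conclude (ν , p₁ , p₂ , p₃ , relation , nontrivial) = nontrivial (solve ν p₁ p₂ p₃
      (at χf (d-f g₁) (d-f g₂) (d-f g₃) refl) (at χa a₁ a₂ a₃ refl) (at χb b₁ b₂ b₃ refl)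
      (at χc c₁ c₂ c₃ refl))
      where
        at : ∀ {x q r s} → χ x ≡ true → d g₁ x ≡ q → d g₂ x ≡ r → d g₃ x ≡ s →
             q xor (r xor s) ≡ false → p₁ when q +₃ p₂ when r +₃ p₃ when s ≡ ν
        at χx refl refl refl even = relation χx even

  -- Growing the word piece by piece

  open Labels e
  open DecMembership (_≟_ {n}) using () renaming (_∈?_ to _∈ᴸ?_)

  infixl 6 _⊹_

  abstract
    -- Addition over 𝔽₂ rather than union, so that the pairing is additive in it. In every
    -- application s lies outside P.
    _⊹_ : (Fin n → Bool) → Fin n → Fin n → Bool
    (P ⊹ s) x = P x xor unit s x

    ⊹-self : ∀ {P s} → P s ≡ false → (P ⊹ s) s ≡ true
    ⊹-self {P} {s} Ps = cong₂ _xor_ Ps (unit-self s)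

    ⊹-other : ∀ {P s x} → x ≢ s → (P ⊹ s) x ≡ P x
    ⊹-other {P} {s} {x} x≢s = trans (cong (P x xor_) (unit-other x≢s)) (Bool.xor-identityʳ (P x))

    ⟨⊹⟩ : ∀ P s x → ⟨ P ⊹ s , x ⟩ ≡ ⟨ P , x ⟩ xor x s
    ⟨⊹⟩ P s x = trans (⟨⟩-xorˡ P (unit s) x) (cong (⟨ P , x ⟩ xor_) (⟨unit⟩ s x))

  ⊹-⊆ : ∀ {P s x} → P s ≡ false → P x ≡ true → (P ⊹ s) x ≡ true
  ⊹-⊆ {P} Ps Px = trans (⊹-other {P} λ { refl → true≢false Px Ps }) Px

  ⊹-cases : ∀ {P s x} → (P ⊹ s) x ≡ true → x ≡ s ⊎ P x ≡ true
  ⊹-cases {P} {s} {x} Psx with x ≟ s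
  ... | yes x≡s = inj₁ x≡s
  ... | no x≢s  = inj₂ (trans (sym (⊹-other {P} x≢s)) Psx)

  -- On all elements `d g` is then `P ⊹ g`, so orthogonality to the chord says that x takes the
  -- basepoint value at g.
  ⟨chord⟩ : ∀ {g P} → χ g ≡ false → (∀ {x} → P x ≡ true → χ x ≡ true) →
            (∀ {x} → χ x ≡ true → d g x ≡ P x) → ∀ x → ⟨ d g , x ⟩ ≡ ⟨ P , x ⟩ xor x g
  ⟨chord⟩ {g} {P} χg P⊆χ d≗P x = trans (⟨⟩-cong d≗P⊹g λ _ → refl) (⟨⊹⟩ P g x)
    where
    Pg : P g ≡ false
    Pg = Bool.¬-not λ Pg → true≢false (P⊆χ Pg) χg
    d≗P⊹g : ∀ y → d g y ≡ (P ⊹ g) y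
    d≗P⊹g y with χ y in χy
    ... | true  = trans (d≗P χy) (sym (⊹-other λ { refl → true≢false χy χg }))
    ... | false with y ≟ g
    ...   | yes refl = trans (d-self χg) (sym (⊹-self {P} Pg))
    ...   | no y≢g = trans (d-off χy y≢g) (sym (trans (⊹-other {P} y≢g)
              (Bool.¬-not λ Py → true≢false (P⊆χ Py) χy)))

  -- The elements of C placed so far form P, and a cut x takes the value ⟨ P , x ⟩ on the last
  -- basepoint of w; the chords not yet placed all contain P.
  record State {mk} (w : Word (Fin n) mk) (P : Fin n → Bool) : Set where
    field
      P⊆χ      : ∀ {x} → P x ≡ true → χ x ≡ true
      Pf       : P f ≡ false
      unique   : Unique (labelList w)
      placed   : ∀ {x} → χ x ≡ true → x List.∈ labelList w → P x ≡ true
      placed⁻  : ∀ {x} → P x ≡ true → x List.∈ labelList w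
      below    : ∀ {g} → χ g ≡ false → g List.∉ labelList w → ∀ {x} → P x ≡ true → d g x ≡ true
      run⇒     : ∀ {x t} → Run w x t →
                 t ≡ ⟨ P , x ⟩ × (∀ {g} → χ g ≡ false → g List.∈ labelList w → ⟨ d g , x ⟩ ≡ false)
      ⇒run     : ∀ {x} → (∀ {g} → χ g ≡ false → g List.∈ labelList w → ⟨ d g , x ⟩ ≡ false) →
                 Run w x ⟨ P , x ⟩

    unplaced : ∀ {x} → χ x ≡ true → P x ≡ false → x List.∉ labelList w
    unplaced χx Px x∈ = true≢false (placed χx x∈) Px

  fresh∷ : ∀ {x : Fin n} {xs} → x List.∉ xs → Unique xs → Unique (x ∷ xs)
  fresh∷ x∉ u = All.¬Any⇒All¬ _ x∉ ∷ u

  -- Excludes pending chords that agree with P on C; such a chord has to be spent as a B₃ before P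
  -- can grow.
  Strict : ∀ {mk} → Word (Fin n) mk → (Fin n → Bool) → Set
  Strict w P = ∀ {g} → χ g ≡ false → g List.∉ labelList w →
               ∃[ x ] (χ x ≡ true × d g x ≡ true × P x ≡ false)

  start : State base (unit e)
  start = record
    { P⊆χ     = λ ex → subst (λ y → χ y ≡ true) (sym (is-e ex)) χe
    ; Pf      = unit-other (e≢f ∘ sym)
    ; unique  = [] ∷ []
    ; placed  = λ { _ (here refl) → unit-self e }
    ; placed⁻ = λ ex → here (is-e ex)
    ; below   = λ {g} χg _ ex → subst (λ y → d g y ≡ true) (sym (is-e ex)) (d-e χg)
    ; run⇒    = λ { {x} refl → sym (⟨unit⟩ e x) , λ
        { χg (here refl) → contradiction χg (true≢false χe) } }
    ; ⇒run    = λ {x} _ → ⟨unit⟩ e x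
    }
    where
    is-e : ∀ {x} → unit e x ≡ true → x ≡ e
    is-e {x} ex = decidable-stable (x ≟ e) λ x≢e → true≢false ex (unit-other x≢e)

  -- A chord with D = {e} would be parallel to e. Hence the ladder does not begin with a B₃.
  start-strict : Strict base (unit e)
  start-strict χg _ with in-chord e χg
  ... | x , χx , dx , x≢e = x , χx , dx , unit-other x≢e

  module _ {mk : Maybe Piece} {w : Word (Fin n) mk} {P : Fin n → Bool} (S : State w P) where
    open State S

    grow-B₃ : ∀ {g} (ok : Joinable mk B₃) → χ g ≡ false → g List.∉ labelList w →
              (∀ {x} → χ x ≡ true → d g x ≡ P x) → State (grow w B₃ ok (g ∷ [])) P
    grow-B₃ {g} ok χg g∉ d≗P = record
      { P⊆χ     = P⊆χ
      ; Pf      = Pf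
      ; unique  = fresh∷ g∉ unique
      ; placed  = λ
          { χx (here refl) → contradiction χg (true≢false χx) ; χx (there x∈) → placed χx x∈ }
      ; placed⁻ = there ∘ placed⁻
      ; below   = λ χh h∉ → below χh (h∉ ∘ there)
      ; run⇒    = λ { (s , run , xg≡s , t≡s) →
          let (s≡ , zeros) = run⇒ run in trans t≡s s≡ , λ
          { _ (here refl) → trans (⟨chord⟩ χg P⊆χ d≗P _)
              (trans (cong₂ _xor_ (sym s≡) xg≡s) (Bool.xor-same s))
          ; χh (there h∈) → zeros χh h∈ } }
      ; ⇒run    = λ {x} zeros → ⟨ P , x ⟩ , ⇒run (λ χh h∈ → zeros χh (there h∈)) ,
          sym (xor≡false⇒≡ (trans (sym (⟨chord⟩ χg P⊆χ d≗P x)) (zeros χg (here refl)))) , refl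
      }

    grow-K₃ : ∀ {s} (ok : Joinable mk K₃) → χ s ≡ true → P s ≡ false → s ≢ f →
              (∀ {g} → χ g ≡ false → g List.∉ labelList w → d g s ≡ true) →
              State (grow w K₃ ok (s ∷ [])) (P ⊹ s)
    grow-K₃ {s} ok χs Ps s≢f common = record
      { P⊆χ     = λ Psx → case ⊹-cases Psx of λ { (inj₁ refl) → χs ; (inj₂ Px) → P⊆χ Px }
      ; Pf      = trans (⊹-other (s≢f ∘ sym)) Pf
      ; unique  = fresh∷ (unplaced χs Ps) unique
      ; placed  = λ { _ (here refl) → ⊹-self {P} Ps ; χx (there x∈) → ⊹-⊆ Ps (placed χx x∈) }
      ; placed⁻ = λ Psx → case ⊹-cases Psx of λ
          { (inj₁ x≡s) → here x≡s ; (inj₂ Px) → there (placed⁻ Px) }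
      ; below   = λ χg g∉ Psx → case ⊹-cases Psx of λ
          { (inj₁ refl) → common χg (g∉ ∘ there) ; (inj₂ Px) → below χg (g∉ ∘ there) Px }
      ; run⇒    = λ { {x} (_ , run , refl) →
          let (s≡ , zeros) = run⇒ run in trans (cong (_xor x s) s≡) (sym (⟨⊹⟩ P s x)) , λ
          { χg (here refl) → contradiction χg (true≢false χs) ; χg (there g∈) → zeros χg g∈ } }
      ; ⇒run    = λ {x} zeros → ⟨ P , x ⟩ , ⇒run (λ χg g∈ → zeros χg (there g∈)) , ⟨⊹⟩ P s x
      }

    -- The triangles of K₄ on the old basepoint express orthogonality to the cycles P + a + g and P
    -- + b + h; the 4-cycle through both basepoints makes the new value that of P + a + b.
    grow-K₄ : ∀ {a g h b} (ok : Joinable mk K₄) → χ a ≡ true → P a ≡ false → a ≢ f →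
              χ b ≡ true → P b ≡ false → b ≢ f → a ≢ b →
              χ g ≡ false → g List.∉ labelList w → (∀ {x} → χ x ≡ true → d g x ≡ (P ⊹ a) x) →
              χ h ≡ false → h List.∉ labelList w → (∀ {x} → χ x ≡ true → d h x ≡ (P ⊹ b) x) →
              (∀ {i} → χ i ≡ false → i List.∉ labelList w → i ≢ g → i ≢ h →
                d i a ≡ true × d i b ≡ true) →
              State (grow w K₄ ok (a ∷ g ∷ h ∷ b ∷ [])) (P ⊹ a ⊹ b)
    grow-K₄ {a} {g} {h} {b} ok χa Pa a≢f χb Pb b≢f a≢b χg g∉ dg χh h∉ dh common = record
      { P⊆χ     = λ Q → case cases Q of λ
          { (inj₁ refl) → χa ; (inj₂ (inj₁ refl)) → χb ; (inj₂ (inj₂ Px)) → P⊆χ Px }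
      ; Pf      = trans (⊹-other (b≢f ∘ sym)) (trans (⊹-other (a≢f ∘ sym)) Pf)
      ; unique  = fresh∷ (∉∷ a≢g (∉∷ a≢h (∉∷ a≢b (unplaced χa Pa))))
                    (fresh∷ (∉∷ g≢h (∉∷ g≢b g∉)) (fresh∷ (∉∷ h≢b h∉)
                      (fresh∷ (unplaced χb Pb) unique)))
      ; placed  = λ
          { _  (here refl)                         → ⊹-⊆ Qb (⊹-self {P} Pa)
          ; χx (there (here refl))                 → contradiction χg (true≢false χx)
          ; χx (there (there (here refl)))         → contradiction χh (true≢false χx)
          ; _  (there (there (there (here refl)))) → ⊹-self {P ⊹ a} Qb
          ; χx (there (there (there (there x∈))))  → ⊹-⊆ Qb (⊹-⊆ Pa (placed χx x∈)) }
      ; placed⁻ = λ Q → case cases Q of λ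
          { (inj₁ x≡a) → here x≡a ; (inj₂ (inj₁ x≡b)) → there (there (there (here x≡b)))
          ; (inj₂ (inj₂ Px)) → there (there (there (there (placed⁻ Px)))) }
      ; below   = λ {i} χi i∉ Q →
          let i∉w = λ i∈ → i∉ (there (there (there (there i∈))))
              (da , db) = common χi i∉w (λ i≡g → i∉ (there (here i≡g)))
                                        (λ i≡h → i∉ (there (there (here i≡h))))
          in case cases Q of λ
          { (inj₁ refl) → da ; (inj₂ (inj₁ refl)) → db ; (inj₂ (inj₂ Px)) → below χi i∉w Px }
      ; run⇒    = λ { {x} (s , run , xg , xh , t≡) →
          let (s≡ , zeros) = run⇒ run in
          trans t≡ (trans (cong (λ s → (s xor x a) xor x b) s≡) (sym (value x))) , λ
          { χa′ (here refl) → contradiction χa′ (true≢false χa)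
          ; _ (there (here refl)) → trans (⟨g⟩ x)
              (trans (cong₂ _xor_ (cong (_xor x a) (sym s≡)) xg) (Bool.xor-same (s xor x a)))
          ; _ (there (there (here refl))) → trans (⟨h⟩ x)
              (trans (cong₂ _xor_ (cong (_xor x b) (sym s≡)) xh) (Bool.xor-same (s xor x b)))
          ; χb′ (there (there (there (here refl)))) → contradiction χb′ (true≢false χb)
          ; χi (there (there (there (there i∈)))) → zeros χi i∈ } }
      ; ⇒run    = λ {x} zeros → ⟨ P , x ⟩ ,
          ⇒run (λ χi i∈ → zeros χi (there (there (there (there i∈))))) ,
          sym (xor≡false⇒≡ (trans (sym (⟨g⟩ x)) (zeros χg (there (here refl))))) ,
          sym (xor≡false⇒≡ (trans (sym (⟨h⟩ x)) (zeros χh (there (there (here refl)))))) ,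
          value x
      }
      where
      ∉∷ : ∀ {x y : Fin n} {xs} → x ≢ y → x List.∉ xs → x List.∉ (y ∷ xs)
      ∉∷ x≢y x∉ (here x≡y) = x≢y x≡y
      ∉∷ x≢y x∉ (there x∈) = x∉ x∈
      C≢chord : ∀ {x y} → χ x ≡ true → χ y ≡ false → x ≢ y
      C≢chord χx χy refl = true≢false χx χy
      a≢g = C≢chord χa χg
      a≢h = C≢chord χa χh
      g≢b : g ≢ b
      g≢b = C≢chord χb χg ∘ sym
      h≢b : h ≢ b
      h≢b = C≢chord χb χh ∘ sym
      g≢h : g ≢ h
      g≢h refl = true≢false (trans (dg χa) (⊹-self {P} Pa)) (trans (dh χa) (trans (⊹-other a≢b) Pa))
      Qb : (P ⊹ a) b ≡ false
      Qb = trans (⊹-other (a≢b ∘ sym)) Pb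
      cases : ∀ {x} → (P ⊹ a ⊹ b) x ≡ true → x ≡ a ⊎ x ≡ b ⊎ P x ≡ true
      cases Q with ⊹-cases Q
      ... | inj₁ x≡b = inj₂ (inj₁ x≡b)
      ... | inj₂ Q′ with ⊹-cases Q′
      ...   | inj₁ x≡a = inj₁ x≡a
      ...   | inj₂ Px  = inj₂ (inj₂ Px)
      ⊹⊆χ : ∀ {s} → χ s ≡ true → ∀ {x} → (P ⊹ s) x ≡ true → χ x ≡ true
      ⊹⊆χ χs Q = case ⊹-cases Q of λ { (inj₁ refl) → χs ; (inj₂ Px) → P⊆χ Px }
      ⟨g⟩ : ∀ x → ⟨ d g , x ⟩ ≡ (⟨ P , x ⟩ xor x a) xor x g
      ⟨g⟩ x = trans (⟨chord⟩ χg (⊹⊆χ χa) dg x) (cong (_xor x g) (⟨⊹⟩ P a x))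
      ⟨h⟩ : ∀ x → ⟨ d h , x ⟩ ≡ (⟨ P , x ⟩ xor x b) xor x h
      ⟨h⟩ x = trans (⟨chord⟩ χh (⊹⊆χ χb) dh x) (cong (_xor x h) (⟨⊹⟩ P b x))
      value : ∀ x → ⟨ P ⊹ a ⊹ b , x ⟩ ≡ (⟨ P , x ⟩ xor x a) xor x b
      value x = trans (⟨⊹⟩ (P ⊹ a) b x) (cong (_xor x b) (⟨⊹⟩ P a x))

  -- The termination measure. A B₃ leaves it unchanged, which is why `build` follows each B₃ at once
  -- by an advance.
  remaining : (Fin n → Bool) → ℕ
  remaining P = ∣ ⟦ (λ x → χ x ∧ not (P x)) ⟧ ∣

  remaining-< : ∀ {P Q : Fin n → Bool} {s} → (∀ {x} → P x ≡ true → Q x ≡ true) →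
                χ s ≡ true → P s ≡ false → Q s ≡ true → remaining Q < remaining P
  remaining-< {P} {Q} {s} P⊆Q χs Ps Qs = p⊂q⇒∣p∣<∣q∣
    ( (λ {x} x∈ → ∈⟦⟧⁺ (mono x (∈⟦⟧⁻ x∈)))
    , s , ∈⟦⟧⁺ (cong₂ (λ a b → a ∧ not b) χs Ps)
    , λ s∈ → true≢false (∈⟦⟧⁻ s∈) (cong₂ (λ a b → a ∧ not b) χs Qs))
    where
    mono : ∀ x → χ x ∧ not (Q x) ≡ true → χ x ∧ not (P x) ≡ true
    mono x h with χ x | P x in Px
    ... | true | false = refl
    ... | true | true  = trans (cong not (sym (P⊆Q Px))) h

  excess : ∀ {g} {P : Fin n → Bool} → (∀ {x} → P x ≡ true → d g x ≡ true) →
           ¬ (∀ {x} → χ x ≡ true → d g x ≡ P x) →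
           ∃[ x ] (χ x ≡ true × d g x ≡ true × P x ≡ false)
  excess {g} {P} P⊆d d≢P
    with any? (λ x → (χ x ≡true?) ×-dec (d g x ≡true?) ×-dec (P x Bool.≟ false))
  ... | yes found = found
  ... | no ∄x = contradiction (λ {x} → agree {x}) d≢P
    where
    agree : ∀ {x} → χ x ≡ true → d g x ≡ P x
    agree {x} χx with P x in Px | d g x in dx
    ... | true  | true  = refl
    ... | false | false = refl
    ... | true  | false = contradiction dx (true≢false (P⊆d Px))
    ... | false | true  = contradiction (x , χx , dx , Px) ∄x

  record Advance {mk} (w : Word (Fin n) mk) (P : Fin n → Bool) : Set where
    field
      {k}     : Piece
      {w′}    : Word (Fin n) (just k)
      {P′}    : Fin n → Bool
      state   : State w′ P′
      k≢B₃    : k ≢ B₃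
      smaller : remaining P′ < remaining P

  joinable : ∀ mk {k} → k ≢ B₃ → Joinable mk k
  joinable nothing  k≢B₃         = k≢B₃
  joinable (just _) k≢B₃ (_ , k≡B₃) = k≢B₃ k≡B₃

  module _ {mk : Maybe Piece} {w : Word (Fin n) mk} {P : Fin n → Bool}
           (S : State w P) (strict : Strict w P) where
    open State S

    private
      Pending : Fin n → Set
      Pending g = χ g ≡ false × g List.∉ labelList w

      pending? : ∀ g → Dec (Pending g)
      pending? g = (χ g Bool.≟ false) ×-dec ¬? (g ∈ᴸ? labelList w)

      _⊑_ : Fin n → Fin n → Set
      g ⊑ h = ∀ x → χ x ≡ true → d g x ≡ true → d h x ≡ true

      minimal-pending : ∀ {g} → Pending g →
                        ∃[ m ] (Pending m × (∀ {h} → Pending h → h ⊑ m → m ⊑ h))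
      minimal-pending {g} pg = descend (size g) g pg ℕ.≤-refl
        where
        size : Fin n → ℕ
        size g = ∣ ⟦ (λ x → χ x ∧ d g x) ⟧ ∣
        descend : ∀ N g → Pending g → size g ≤ N →
                  ∃[ m ] (Pending m × (∀ {h} → Pending h → h ⊑ m → m ⊑ h))
        descend N g pg size≤N with any? (λ h → pending? h
          ×-dec all? (λ x → (χ x ≡true?) →-dec ((d h x ≡true?) →-dec (d g x ≡true?)))
          ×-dec any? (λ x → (χ x ≡true?) ×-dec (d g x ≡true?) ×-dec (d h x Bool.≟ false)))
        ... | no ∄h = g , pg , λ {h} ph h⊑g x χx gx → Bool.¬-not λ hx →
                ∄h (h , ph , h⊑g , x , χx , gx , hx)
        ... | yes (h , ph , h⊑g , x , χx , gx , hx) = continue N size≤N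
          where
          smaller : size h < size g
          smaller = p⊂q⇒∣p∣<∣q∣
            ( (λ {y} y∈ → ∈⟦⟧⁺ (mono y (∈⟦⟧⁻ y∈)))
            , x , ∈⟦⟧⁺ (cong₂ _∧_ χx gx) , λ x∈ → true≢false (∈⟦⟧⁻ x∈) (cong₂ _∧_ χx hx))
            where
            mono : ∀ y → χ y ∧ d h y ≡ true → χ y ∧ d g y ≡ true
            mono y hy with χ y in χy
            ... | true = h⊑g y χy hy
          continue : ∀ N → size g ≤ N → ∃[ m ] (Pending m × (∀ {h} → Pending h → h ⊑ m → m ⊑ h))
          continue zero    size≤0    = contradiction (ℕ.<-≤-trans smaller size≤0) λ ()
          continue (suc N) size≤1+N = descend N h ph (ℕ.≤-pred (ℕ.<-≤-trans smaller size≤1+N))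

      -- A minimal pending chord g and the chord h crossing it are P plus one element each; these two
      -- elements, g and h make up a K₄.
      module _ (missing : ∀ {s} → χ s ≡ true → s ≢ f → P s ≡ false →
                          ∃[ h ] (Pending h × d h s ≡ false))
               {g : Fin n} (pg : Pending g)
               (minimal : ∀ {h} → Pending h → h ⊑ g → g ⊑ h) where

        χg = proj₁ pg

        -- Some pending h misses s. Were it inside g, minimality would put g inside h, although g
        -- contains s.
        crossed : ∀ {s} → χ s ≡ true → d g s ≡ true → P s ≡ false →
          ∃[ h ] ∃[ b ] (Pending h × d h s ≡ false × χ b ≡ true × d h b ≡ true × d g b ≡ false)
        crossed {s} χs gs Ps with missing χs (λ { refl → true≢false gs (d-f g) }) Ps
        ... | h , ph , hs
          with any? (λ b → (χ b ≡true?) ×-dec (d h b ≡true?) ×-dec (d g b Bool.≟ false))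
        ...   | yes (b , χb , hb , gb) = h , b , ph , hs , χb , hb , gb
        ...   | no ∄b = contradiction hs (true≢false (minimal ph
                  (λ x χx hx → Bool.¬-not λ gx → ∄b (x , χx , hx , gx)) s χs gs))

        -- Given two such points, let h miss s and `h′` miss `s′`. By `crossing`, h contains `s′`
        -- and `h′` contains s; these two chords then cross each other and agree at b. So g, h and
        -- `h′` each miss one of b, s, `s′` and contain the other two.
        only : ∀ {s s′} → χ s ≡ true → d g s ≡ true → P s ≡ false →
               χ s′ ≡ true → d g s′ ≡ true → P s′ ≡ false → s ≡ s′
        only {s} {s′} χs gs Ps χs′ gs′ Ps′ = decidable-stable (s ≟ s′) go
          where
          go : s ≢ s′ → _
          go s≢s′ with crossed χs gs Ps | crossed χs′ gs′ Ps′
          ... | h , b , ph , hs , χb , hb , gb | h′ , b′ , ph′ , hs′ , χb′ , hb′ , gb′ =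
            no-three-missing χg (proj₁ ph) (proj₁ ph′) χb χs χs′
              gb hb h′b gs hs h′s gs′ hs≡ hs′
            where
            b≢s : b ≢ s
            b≢s refl = true≢false gs gb
            b≢s′ : b ≢ s′
            b≢s′ refl = true≢false gs′ gb
            b′≢s : b′ ≢ s
            b′≢s refl = true≢false gs gb′
            hs≡ : d h s′ ≡ true
            hs≡ = trans (sym (crossing χg (proj₁ ph) χs χb χs′ gs hs gb hb
              (s≢s′ ∘ sym) (b≢s′ ∘ sym))) gs′
            h′s : d h′ s ≡ true
            h′s = trans (sym (crossing χg (proj₁ ph′) χs′ χb′ χs gs′ hs′ gb′ hb′
              s≢s′ (b′≢s ∘ sym))) gs
            h′b : d h′ b ≡ true
            h′b = trans (sym (crossing (proj₁ ph) (proj₁ ph′) χs′ χs χb hs≡ hs′ hs h′s b≢s′ b≢s)) hb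

        advance-K₄ : Advance w P
        advance-K₄ with strict χg (proj₂ pg)
        ... | s , χs , gs , Ps with crossed χs gs Ps
        ...   | h , b , ph , hs , χb , hb , gb = record
          { state   = grow-K₄ S (joinable mk λ ()) χs Ps (λ { refl → true≢false gs (d-f g) })
                        χb Pb (λ { refl → true≢false hb (d-f h) }) s≢b
                        χg (proj₂ pg) dg χh (proj₂ ph) dh common
          ; k≢B₃    = λ ()
          ; smaller = remaining-< (⊹-⊆ Qb ∘ ⊹-⊆ Ps) χs Ps (⊹-⊆ Qb (⊹-self {P} Ps))
          }
          where
          χh = proj₁ ph
          Pb : P b ≡ false
          Pb = Bool.¬-not λ Pb → true≢false (below χg (proj₂ pg) Pb) gb
          s≢b : s ≢ b
          s≢b refl = true≢false gs gb
          Qb : (P ⊹ s) b ≡ false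
          Qb = trans (⊹-other {P} (s≢b ∘ sym)) Pb
          dg : ∀ {x} → χ x ≡ true → d g x ≡ (P ⊹ s) x
          dg {x} χx with x ≟ s
          ... | yes refl = trans gs (sym (⊹-self {P} Ps))
          ... | no x≢s with P x in Px
          ...   | true  = trans (below χg (proj₂ pg) Px) (sym (⊹-⊆ Ps Px))
          ...   | false = trans (Bool.¬-not λ gx → x≢s (only χx gx Px χs gs Ps))
                                (sym (trans (⊹-other {P} x≢s) Px))
          same : ∀ {x} → χ x ≡ true → x ≢ s → x ≢ b → d g x ≡ d h x
          same χx x≢s x≢b = crossing χg χh χs χb χx gs hs gb hb x≢s x≢b
          -- Off s and b the chord h agrees with g, which is P + s.
          dh : ∀ {x} → χ x ≡ true → d h x ≡ (P ⊹ b) x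
          dh {x} χx with x ≟ s | x ≟ b
          ... | yes refl | _        = trans hs (sym (trans (⊹-other {P} s≢b) Ps))
          ... | no _     | yes refl = trans hb (sym (⊹-self {P} Pb))
          ... | no x≢s   | no x≢b   = trans (sym (same χx x≢s x≢b))
                (trans (dg χx) (trans (⊹-other {P} x≢s) (sym (⊹-other {P} x≢b))))

          -- A chord i with exactly one of s and b crosses h or g and is thereby forced to equal the
          -- other one. If it has neither, strictness yields a point c of i outside P, and g, h, i
          -- have the private points s, b, c.
          common : ∀ {i} → χ i ≡ false → i List.∉ labelList w → i ≢ g → i ≢ h →
                   d i s ≡ true × d i b ≡ true
          common {i} χi i∉ i≢g i≢h with d i s in is | d i b in ib
          ... | true  | true  = refl , refl
          ... | true  | false = contradiction (distinct χi χg agree) i≢g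
            where
            agree : ∀ x → χ x ≡ true → d i x ≡ d g x
            agree x χx with x ≟ s | x ≟ b
            ... | yes refl | _        = trans is (sym gs)
            ... | no _     | yes refl = trans ib (sym gb)
            ... | no x≢s   | no x≢b   =
              trans (crossing χi χh χs χb χx is hs ib hb x≢s x≢b) (sym (same χx x≢s x≢b))
          ... | false | true  = contradiction (distinct χi χh agree) i≢h
            where
            agree : ∀ x → χ x ≡ true → d i x ≡ d h x
            agree x χx with x ≟ s | x ≟ b
            ... | yes refl | _        = trans is (sym hs)
            ... | no _     | yes refl = trans ib (sym hb)
            ... | no x≢s   | no x≢b   =
              trans (sym (crossing χg χi χs χb χx gs is gb ib x≢s x≢b)) (same χx x≢s x≢b)
          ... | false | false with strict χi i∉
          ...   | c , χc , ic , Pc = contradiction ic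
                  (no-three-private χg χh χi χs χb χc gs hs is gb hb ib
                    (trans (dg χc) gc) (trans (sym (same χc c≢s c≢b)) (trans (dg χc) gc)))
            where
            c≢s : c ≢ s
            c≢s refl = true≢false ic is
            c≢b : c ≢ b
            c≢b refl = true≢false ic ib
            gc : (P ⊹ s) c ≡ false
            gc = trans (⊹-other {P} c≢s) Pc

    -- An unplaced element other than f shared by all pending chords can be added as a K₃. If none
    -- exists, each such element is missed by a pending chord, which is the hypothesis `missing` of
    -- the K₄ case.
    advance : ∃[ s ] (χ s ≡ true × s ≢ f × P s ≡ false) → Advance w P
    advance (s₀ , χs₀ , s₀≢f , Ps₀)
      with any? (λ s → (χ s ≡true?) ×-dec ¬? (s ≟ f) ×-dec (P s Bool.≟ false)
                  ×-dec all? (λ g → pending? g →-dec (d g s ≡true?)))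
    ... | yes (s , χs , s≢f , Ps , common) = record
          { state   = grow-K₃ S (joinable mk λ ()) χs Ps s≢f (λ χg g∉ → common _ (χg , g∉))
          ; k≢B₃    = λ ()
          ; smaller = remaining-< (⊹-⊆ Ps) χs Ps (⊹-self {P} Ps)
          }
    ... | no ∄s =
      let (g , pg , _) = missing χs₀ s₀≢f Ps₀
          (m , pm , minimal) = minimal-pending pg
      in advance-K₄ missing pm minimal
      where
      missing : ∀ {s} → χ s ≡ true → s ≢ f → P s ≡ false → ∃[ h ] (Pending h × d h s ≡ false)
      missing {s} χs s≢f Ps with any? (λ h → pending? h ×-dec (d h s Bool.≟ false))
      ... | yes found = found
      ... | no ∄h = contradiction
            (s , χs , s≢f , Ps , λ h ph → Bool.¬-not λ hs → ∄h (h , ph , hs)) ∄s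

  -- C and the chords span the cycle space, so this is the cut space of M.
  InCutSpace : (Fin n → Bool) → Set
  InCutSpace x = ⟨ χ , x ⟩ ≡ false × (∀ {g} → χ g ≡ false → ⟨ d g , x ⟩ ≡ false)

  -- The last basepoint remains an edge and represents f, so a run has to end in `x f`.
  record Layout : Set where
    field
      {k}      : Piece
      word     : Word (Fin n) (just k)
      k≢B₃     : k ≢ B₃
      unique   : Unique (f ∷ labelList word)
      complete : ∀ x → x List.∈ f ∷ labelList word
      run⇒     : ∀ {x} → Run word x (x f) → InCutSpace x
      ⇒run     : ∀ {x} → InCutSpace x → Run word x (x f)

  finish : ∀ {k} {w : Word (Fin n) (just k)} {P} → State w P → k ≢ B₃ →
           ¬ (∃[ s ] (χ s ≡ true × s ≢ f × P s ≡ false)) → Layout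
  finish {w = w} {P} S k≢B₃ ∄s = record
    { word     = w
    ; k≢B₃     = k≢B₃
    ; unique   = fresh∷ (unplaced χf Pf) unique
    ; complete = complete
    ; run⇒     = λ {x} run → let (xf≡ , zeros) = run⇒ run in
        trans (⟨χ⟩ x) (trans (cong (_xor x f) (sym xf≡)) (Bool.xor-same (x f))) ,
        λ {g} χg → zeros χg (all-placed χg)
    ; ⇒run     = λ {x} (χx , zeros) → subst (Run w x)
        (xor≡false⇒≡ (trans (sym (⟨χ⟩ x)) χx)) (⇒run λ χg _ → zeros χg)
    }
    where
    open State S
    full : ∀ {x} → χ x ≡ true → x ≢ f → P x ≡ true
    full {x} χx x≢f = Bool.¬-not λ Px → ∄s (x , χx , x≢f , Px)
    -- By now P is C - f. A chord still pending would contain P, but every chord misses a point of C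
    -- other than f.
    all-placed : ∀ {g} → χ g ≡ false → g List.∈ labelList w
    all-placed {g} χg = decidable-stable (g ∈ᴸ? labelList w) λ g∉ →
      let (x , χx , dx , x≢f) = out-chord f χg in true≢false (below χg g∉ (full χx x≢f)) dx
    complete : ∀ x → x List.∈ f ∷ labelList w
    complete x with χ x in χx | x ≟ f
    ... | _     | yes x≡f = here x≡f
    ... | true  | no x≢f  = there (placed⁻ (full χx x≢f))
    ... | false | no _    = there (all-placed χx)
    χ≗ : ∀ x → χ x ≡ (P ⊹ f) x
    χ≗ x with x ≟ f
    ... | yes refl = trans χf (sym (⊹-self {P} Pf))
    ... | no x≢f with χ x in χx
    ...   | true  = sym (trans (⊹-other {P} x≢f) (full χx x≢f))
    ...   | false = sym (trans (⊹-other {P} x≢f) (Bool.¬-not λ Px → true≢false (P⊆χ Px) χx))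
    ⟨χ⟩ : ∀ x → ⟨ χ , x ⟩ ≡ ⟨ P , x ⟩ xor x f
    ⟨χ⟩ x = trans (⟨⟩-cong χ≗ λ _ → refl) (⟨⊹⟩ P f x)

  build : ∀ N {k} {w : Word (Fin n) (just k)} {P} → State w P → k ≢ B₃ → remaining P ≤ N → Layout
  build N {k} {w} {P} S k≢B₃ rem≤N
    with any? (λ s → (χ s ≡true?) ×-dec ¬? (s ≟ f) ×-dec (P s Bool.≟ false))
  ... | no ∄s = finish S k≢B₃ ∄s
  ... | yes s with any? (λ g → (χ g Bool.≟ false) ×-dec ¬? (g ∈ᴸ? labelList w)
                    ×-dec all? (λ x → (χ x ≡true?) →-dec (d g x Bool.≟ P x)))
  ...   | no ∄g = continue N (advance S strict s) rem≤N
    where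
    strict : Strict w P
    strict χg g∉ = excess (below χg g∉) λ same → ∄g (_ , χg , g∉ , λ _ → same)
      where open State S
    continue : ∀ N → Advance w P → remaining P ≤ N → Layout
    continue zero    A rem≤ = contradiction (ℕ.<-≤-trans (Advance.smaller A) rem≤) λ ()
    continue (suc N) A rem≤ = build N (Advance.state A) (Advance.k≢B₃ A)
      (ℕ.≤-pred (ℕ.<-≤-trans (Advance.smaller A) rem≤))
  ...   | yes (g , χg , g∉ , same) = continue N (advance S′ strict s) rem≤N
    where
    S′ : State (grow w B₃ (λ (k≡B₃ , _) → k≢B₃ k≡B₃) (g ∷ [])) P
    S′ = grow-B₃ S _ χg g∉ λ χx → same _ χx
    -- By `distinct` at most one chord agrees with P on C, so a single B₃ restores strictness.
    strict : Strict (grow w B₃ (λ (k≡B₃ , _) → k≢B₃ k≡B₃) (g ∷ [])) P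
    strict {h} χh h∉ = excess (below χh h∉) λ same′ →
      h∉ (here (distinct χh χg λ x χx → trans (same′ χx) (sym (same x χx))))
      where open State S′
    continue : ∀ N → Advance (grow w B₃ _ (g ∷ [])) P → remaining P ≤ N → Layout
    continue zero    A rem≤ = contradiction (ℕ.<-≤-trans (Advance.smaller A) rem≤) λ ()
    continue (suc N) A rem≤ = build N (Advance.state A) (Advance.k≢B₃ A)
      (ℕ.≤-pred (ℕ.<-≤-trans (Advance.smaller A) rem≤))

  abstract
    layout : Layout
    layout = build _ (Advance.state first-step) (Advance.k≢B₃ first-step) ℕ.≤-refl
      where
      -- By simplicity C has an element besides e and f, so at least one piece is grown.
      third : ∃[ s ] (χ s ≡ true × s ≢ f × unit e s ≡ false)
      third with two-in-support f Kχ χe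
      ... | s , χs , s≢e , s≢f = s , χs , s≢f , unit-other s≢e
      first-step : Advance base (unit e)
      first-step = advance start start-strict third

  -- Duality between the kernel over 𝔽₂ and the cut space

  ⟨d⟩≡0 : ∀ {x} → InCutSpace x → ∀ g → ⟨ d g , x ⟩ ≡ false
  ⟨d⟩≡0 {x} (_ , zeros) g with χ g in χg
  ... | false = zeros χg
  ... | true  = ⟨⟩-zero λ j → cong (_∧ x j) (d-C χg j)

  ⟨elim⟩ : ∀ {x} → InCutSpace x → ∀ g c → ⟨ elim g c , x ⟩ ≡ ⟨ c , x ⟩
  ⟨elim⟩ {x} cut g c = trans (⟨⟩-xorˡ c (λ j → c g ∧ d g j) x)
    (trans (cong (⟨ c , x ⟩ xor_) scaled) (Bool.xor-identityʳ ⟨ c , x ⟩))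
    where
    scaled : ⟨ (λ j → c g ∧ d g j) , x ⟩ ≡ false
    scaled with c g
    ... | true  = ⟨d⟩≡0 cut g
    ... | false = ⟨⟩-zero {c = λ _ → false} {x} λ _ → refl

  scale-χ : ∀ {c} → Outside [] c → (∀ {x} → χ x ≡ true → c x ≡ c e) → ∀ x → c x ≡ c e ∧ χ x
  scale-χ {c} out const x with χ x in χx
  ... | true  = trans (const χx) (sym (Bool.∧-identityʳ (c e)))
  ... | false = trans (Bool.¬-not λ cx → true≢false (within out cx) χx) (sym (Bool.∧-zeroʳ (c e)))

  -- Eliminating every coordinate outside C changes no pairing with a cut and leaves a multiple of
  -- χ.
  K⇒orthogonal : ∀ {c x} → K c → InCutSpace x → ⟨ c , x ⟩ ≡ false
  K⇒orthogonal {x = x} Kc cut = go (allFin n) Kc λ y _ → inj₂ (∈-allFin y)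
    where
    go : ∀ gs {c} → K c → Outside gs c → ⟨ c , x ⟩ ≡ false
    go [] {c} Kc out = trans
      (⟨⟩-cong (scale-χ out λ χx → constant-on-C Kc out χx χe) λ _ → refl) scaled
      where
      scaled : ⟨ (λ j → c e ∧ χ j) , x ⟩ ≡ false
      scaled with c e
      ... | true  = proj₁ cut
      ... | false = ⟨⟩-zero {c = λ _ → false} {x} λ _ → refl
    go (g ∷ gs) {c} Kc out =
      trans (sym (⟨elim⟩ cut g c)) (go gs (K-elim g Kc) (elim-outside out))

  -- For y different from e this is the cut meeting C in y and e only, together with the chords
  -- whose D contains exactly one of them. It tests whether a vector supported on C has equal values
  -- at y and e.
  cut-through : ∀ {y} → χ y ≡ true → ∃[ x ] (InCutSpace x ×
                (∀ c → (∀ {j} → c j ≡ true → χ j ≡ true) → ⟨ c , x ⟩ ≡ c y xor c e))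
  cut-through {y} χy = x , (χ-zero , d-zero) , inside-C
    where
    r x : Fin n → Bool
    r j = d j y xor d j e
    x j = (unit y j xor unit e j) xor r j
    r-C : ∀ {j} → χ j ≡ true → r j ≡ false
    r-C χj = cong₂ _xor_ (d-C χj y) (d-C χj e)
    expand : ∀ c → ⟨ c , x ⟩ ≡ (c y xor c e) xor ⟨ c , r ⟩
    expand c = begin
      ⟨ c , x ⟩                                    ≡⟨ ⟨⟩-comm c x ⟩
      ⟨ x , c ⟩                                    ≡⟨ ⟨⟩-xorˡ (λ j → unit y j xor unit e j) r c ⟩
      ⟨ (λ j → unit y j xor unit e j) , c ⟩ xor ⟨ r , c ⟩
        ≡⟨ cong₂ _xor_ (trans (⟨⟩-xorˡ (unit y) (unit e) c)
             (cong₂ _xor_ (⟨unit⟩ y c) (⟨unit⟩ e c))) (⟨⟩-comm r c) ⟩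
      (c y xor c e) xor ⟨ c , r ⟩                  ∎
      where open ≡-Reasoning
    inside-C : ∀ c → (∀ {j} → c j ≡ true → χ j ≡ true) → ⟨ c , x ⟩ ≡ c y xor c e
    inside-C c c⊆χ = trans (expand c)
      (trans (cong ((c y xor c e) xor_) (⟨⟩-zero disjoint)) (Bool.xor-identityʳ (c y xor c e)))
      where
      disjoint : ∀ j → c j ∧ r j ≡ false
      disjoint j with c j in cj
      ... | false = refl
      ... | true  = r-C (c⊆χ cj)
    χ-zero : ⟨ χ , x ⟩ ≡ false
    χ-zero = trans (inside-C χ id) (cong₂ _xor_ χy χe)
    d-zero : ∀ {g} → χ g ≡ false → ⟨ d g , x ⟩ ≡ false
    d-zero {g} χg = trans (expand (d g)) (trans (cong (r g xor_)
        (trans (⟨⟩-cong-∧ at-g) (⟨unit⟩ g r))) (Bool.xor-same (r g)))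
      where
      at-g : ∀ j → d g j ∧ r j ≡ unit g j ∧ r j
      at-g j with j ≟ g
      ... | yes refl = cong (_∧ r j) (d-self χg)
      ... | no j≢g with χ j in χj
      ...   | true  = trans (cong (d g j ∧_) (r-C χj)) (Bool.∧-zeroʳ (d g j))
      ...   | false = cong (_∧ r j) (d-off χj j≢g)

  -- Elimination reduces to a vector on C, which the cuts of `cut-through` force to be constant
  -- there, hence a multiple of χ.
  orthogonal⇒K : ∀ {c} → (∀ {x} → InCutSpace x → ⟨ c , x ⟩ ≡ false) → K c
  orthogonal⇒K ⊥c = go (allFin n) ⊥c λ y _ → inj₂ (∈-allFin y)
    where
    go : ∀ gs {c} → (∀ {x} → InCutSpace x → ⟨ c , x ⟩ ≡ false) → Outside gs c → K c
    go [] {c} ⊥c out = K-resp (λ j → trans (Bool.xor-identityʳ (c e ∧ χ j))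
        (sym (scale-χ out const j))) (K-linear (c e) false Kχ Kχ)
      where
      const : ∀ {y} → χ y ≡ true → c y ≡ c e
      const {y} χy with cut-through χy
      ... | x , cut , value = xor≡false⇒≡ (trans (sym (value c (within out))) (⊥c cut))
    go (g ∷ gs) {c} ⊥c out = K-resp (λ j → restore (c j) (c g ∧ d g j))
      (K-linear true (c g)
        (go gs (λ {x} cut → trans (⟨elim⟩ cut g c) (⊥c cut)) (elim-outside out)) (Kd g))
      where
      restore : ∀ a b → (a xor b) xor b ≡ a
      restore false b     = Bool.xor-same b
      restore true  false = refl
      restore true  true  = refl

  -- The isomorphism with the cycle matroid of the ladder

  open Layout layout

  label : Fin (suc (∣E∣ word)) → Fin n
  label = lookup (f ∷ labels word)

  label-injective : ∀ {i j} → label i ≡ label j → i ≡ j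
  label-injective = toList-lookup-injective (f ∷ labels word)
    (subst (λ xs → Unique (f ∷ xs)) (sym (toList-labels word)) unique)

  edgeOf : ∀ x → ∃[ j ] label j ≡ x
  edgeOf x = index x∈ , sym (lookup-index x∈)
    where
    x∈ = ∈-toList⁻ (subst (λ xs → x List.∈ f ∷ xs) (sym (toList-labels word)) (complete x))

  labelling : Permutation n (suc (∣E∣ word))
  labelling = Perm.permutation (proj₁ ∘ edgeOf) label
    (λ j → label-injective (proj₂ (edgeOf (label j)))) (proj₂ ∘ edgeOf)

  cut⇒InCutSpace : ∀ {x} φ → (∀ j → δ (ladder word) φ j ≡ x (label j)) → InCutSpace x
  cut⇒InCutSpace φ on = run⇒ (cut⇒run word (φ , on 0F , on ∘ suc))

  InCutSpace⇒cut : ∀ {x} → InCutSpace x → ∃[ φ ] (∀ j → δ (ladder word) φ j ≡ x (label j))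
  InCutSpace⇒cut cut with run⇒cut word (⇒run cut)
  ... | φ , on₀ , on = φ , λ { zero → on₀ ; (suc j) → on j }

  ⟨label⟩ : ∀ c x → ⟨ c , x ⟩ ≡ ⟨ c ∘ label , x ∘ label ⟩
  ⟨label⟩ c x = ⟨⟩-permute (Perm.flip labelling) c x

  -- In both matroids a set is independent when it supports no nonzero vector of the kernel or of
  -- the cycle space. These spaces are the orthogonal complements of cut spaces that the labelling
  -- identifies.
  isomorphism : M ≅ cycleMatroid (ladder word)
  isomorphism = labelling , λ X → mk⇔ (to X) (from X)
    where
    to : ∀ X → Indep X → Acyclic (ladder word) (image labelling X)
    to X ind = 0⇒acyclic (ladder word) zeros
      where
      zeros : ∀ {c} → Cyclical (ladder word) c → (∀ j → c j ≡ true → j ∈ image labelling X) →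
              ∀ j → c j ≡ false
      zeros {c} cyc supp j = trans (cong c (sym (label-injective (proj₂ (edgeOf (label j))))))
          (vanishes ind K-c support (label j))
        where
        c′ : Fin n → Bool
        c′ y = c (proj₁ (edgeOf y))
        c′-label : ∀ j → c′ (label j) ≡ c j
        c′-label j = cong c (label-injective (proj₂ (edgeOf (label j))))
        K-c : K c′
        K-c = orthogonal⇒K λ {x} cut → let (φ , on) = InCutSpace⇒cut cut in
          trans (⟨label⟩ c′ x) (trans (⟨⟩-cong c′-label (sym ∘ on)) (cyc φ))
        support : ∀ y → c′ y ≡ true → y ∈ X
        support y c′y = lookup⇒[]= y X (trans (cong (lookup X) (sym (proj₂ (edgeOf y))))
          (trans (sym (lookup∘tabulate (lookup X ∘ label) (proj₁ (edgeOf y))))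
            ([]=⇒lookup (supp _ c′y))))
    from : ∀ X → Acyclic (ladder word) (image labelling X) → Indep X
    from X acyc = decidable-stable (indep? X) λ dep → impossible (dep⇒≢0 dep)
      where
      impossible : ¬ (∃[ c ] (K c × (∀ j → j ∉ X → c j ≡ false) × ∃[ j ] c j ≢ false))
      impossible (c , Kc , supp , j , cj≢0) = cj≢0 (trans (cong c (sym (proj₂ (edgeOf j))))
        (acyclic⇒0 (ladder word) acyc cyclical support (proj₁ (edgeOf j))))
        where
        cyclical : Cyclical (ladder word) (c ∘ label)
        cyclical φ = trans (sym (trans (⟨label⟩ c x) (⟨⟩-cong (λ _ → refl) x-label)))
            (K⇒orthogonal Kc (cut⇒InCutSpace φ (sym ∘ x-label)))
          where
          x : Fin n → Bool
          x y = δ (ladder word) φ (proj₁ (edgeOf y))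
          x-label : ∀ j → x (label j) ≡ δ (ladder word) φ j
          x-label j = cong (δ (ladder word) φ) (label-injective (proj₂ (edgeOf (label j))))
        support : ∀ i → c (label i) ≡ true → i ∈ image labelling X
        support i ci = lookup⇒[]= i _ (trans (lookup∘tabulate (lookup X ∘ label) i)
          ([]=⇒lookup (decidable-stable (label i ∈? X) λ i∉ → true≢false ci (supp _ i∉))))

  cycle-matroid-of-clean-ladder :
    ∃[ v ] ∃[ m ] Σ[ L ∈ Graph v m ] (CleanLadder L × M ≅ cycleMatroid L)
  cycle-matroid-of-clean-ladder = _ , _ , ladder word , ladder-clean word k≢B₃ , isomorphism

corollary1p4 : (n : ℕ) (M : Matroid n) → Simple M → Connected M → Regular M →
    (e f : Fin n) → e ≢ f →
    (∀ (C : Subset n) → Circuit M C → e ∈ C → f ∈ C → Spanning M C) →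
    ∃[ v ] ∃[ m ] Σ[ L ∈ Graph v m ] (CleanLadder L × M ≅ cycleMatroid L)
corollary1p4 n M simple connected regular e f e≢f spanning =
  -- Connectedness provides the circuit C on which everything is built.
  let (C , circuit , e∈C , f∈C) = connected e f e≢f in
  Chords.cycle-matroid-of-clean-ladder M simple e f e≢f spanning C circuit e∈C f∈C
    (representable⇒kernel 𝔽₂ (regular (FiniteField.heytingField 𝔽₂)))
    (representable⇒kernel 𝔽₃ (regular (FiniteField.heytingField 𝔽₃)))
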